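{- Let $c_*=\dfrac{1}{40000000010006048640}$. Whenever $G$ is a finite abelian group with $q(G)>2$, every $A\subseteq G$ with $|A|\ge 2$ and no unique sum satisfies $$|A|\ge c_*\,\log q(G)\,\log\log q(G).$$ In particular, $m(G)\gg\log q(G)\,\log\log q(G)$ uniformly as $q(G)\to\infty$, i.e. there are absolute constants $c>0$ and $q_0$ such that $m(G)\ge c\log q(G)\log\log q(G)$ for every finite abelian group $G$ with $q(G)\ge q_0$.
   Context: All logarithms are natural. For a finite abelian group $G$ with $|G|>1$, $q(G)$ denotes the least prime divisor of $|G|$. A set $A\subseteq G$ has no unique sum if for all $a,b\in A$ there are $c,d\in A$ with $a+b=c+d$ and not ($(a=c$ and $b=d)$ or $(a=d$ and $b=c)$); i.e. no element of $A+A$ has exactly one representation as the sum of an unordered pair (two-element multiset, repetition allowed) of elements of $A$. For a finite abelian group $G$ with $|G|\ge3$, $m(G)$ is the minimum of $|A|$ over all $A\subseteq G$ with $|A|\ge2$ having no unique sum (this minimum exists). -}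

module Defs where

open import Level using (Level; _⊔_) renaming (suc to lsuc)
open import Algebra.Bundles using (AbelianGroup)
import Algebra.Properties.Group as GroupProperties
open import Data.Empty using (⊥; ⊥-elim)
open import Data.Fin.Base using (Fin; fromℕ<)
import Data.Fin.Properties as Fin
open import Data.Fin.Subset using (Subset; ∣_∣; ⊤) renaming (_∈_ to _∈ˢ_)
open import Data.Fin.Subset.Properties using (_∈?_; ∈⊤; ∣⊤∣≡n; anySubset?)
open import Data.Integer.Base as ℤ using (-[1+_])
import Data.Integer.Properties as ℤ
open import Data.List.Base using ([]; _∷_)
open import Data.List.Relation.Unary.All using (_∷_)
open import Data.Nat.Base as ℕ using (ℕ; zero; suc; z≤n; s≤s)
open import Data.Nat.Divisibility using (_∣_; _∣?_; divides)
open import Data.Nat.ListAction using (product)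
import Data.Nat.Properties as ℕ
open import Data.Nat.Induction using (<-wellFounded)
open import Data.Nat.Primality using (Prime; prime?; prime⇒nonTrivial)
open import Data.Nat.Primality.Factorisation using (PrimeFactorisation; factorise)
open import Data.Product using (Σ; ∃; _×_; _,_; proj₁; proj₂)
open import Data.Rational.Base as ℚ using (ℚ; mkℚ; 0ℚ; 1ℚ; ½; _+_; _*_; _-_; -_; _≤_; _<_)
  renaming (∣_∣ to abs)
import Data.Rational.Properties as ℚ
open import Data.Rational.Solver using (module +-*-Solver)
import Data.Rational.Unnormalised.Base as ℚᵘ
import Data.Rational.Unnormalised.Properties as ℚᵘ
open import Data.Sum.Base using (_⊎_; inj₁; inj₂; [_,_]′)
open import Function.Base using (_∘_)
open import Function.Bundles using (Inverse)
open import Induction.WellFounded using (Acc; acc)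
open import Relation.Binary.PropositionalEquality
  using (_≡_; _≢_; refl; sym; trans; cong; cong₂; subst; subst₂)
  renaming (setoid to ≡-setoid)
open import Relation.Nullary using (¬_; Dec; yes; no)
open import Relation.Nullary.Decidable using (map′; _×-dec_; _⊎-dec_; _→-dec_; ¬?)
open import Relation.Unary using (Pred; Decidable)

record ℝ : Set where
  constructor mkℝ
  field
    seq    : ℕ → ℚ
    cauchy : ∀ ε → 0ℚ < ε →
             ∃ λ N → ∀ m n → N ℕ.≤ m → N ℕ.≤ n → abs (seq m - seq n) ≤ ε

open ℝ public

infix 4 _≤ᴿ_ _<ᴿ_
infixl 7 _*ᴿ_

_≤ᴿ_ : ℝ → ℝ → Set
x ≤ᴿ y = ∀ ε → 0ℚ < ε → ∃ λ N → ∀ n → N ℕ.≤ n → seq x n ≤ seq y n + ε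

_<ᴿ_ : ℝ → ℝ → Set
x <ᴿ y = ∃ λ ε → 0ℚ < ε × ∃ λ N → ∀ n → N ℕ.≤ n → seq x n + ε ≤ seq y n

fromℚ : ℚ → ℝ
fromℚ p = mkℝ (λ _ → p) λ ε 0<ε →
  0 , λ _ _ _ _ → subst (λ d → abs d ≤ ε) (sym (ℚ.+-inverseʳ p)) (ℚ.<⇒≤ 0<ε)

ιℚ : ℕ → ℚ
ιℚ n = ℤ.+ n ℚ./ 1

fromℕ : ℕ → ℝ
fromℕ n = fromℚ (ιℚ n)

0ᴿ : ℝ
0ᴿ = fromℚ 0ℚ

infix 8 _⁻¹

-- Total inverse, with the convention 0 ⁻¹ = 0.
_⁻¹ : ℚ → ℚ
p ⁻¹ with p ℚ.≟ 0ℚ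
... | yes _   = 0ℚ
... | no p≢0 = ℚ.1/_ p {{ℚ.≢-nonZero p≢0}}

private
  open +-*-Solver

  *-monoˡ : ∀ {a x y} → 0ℚ ≤ a → x ≤ y → a * x ≤ a * y
  *-monoˡ {a} 0≤a x≤y = ℚ.*-monoˡ-≤-nonNeg a {{ℚ.nonNegative 0≤a}} x≤y

  *-monoʳ : ∀ {a x y} → 0ℚ ≤ a → x ≤ y → x * a ≤ y * a
  *-monoʳ {a} 0≤a x≤y = ℚ.*-monoʳ-≤-nonNeg a {{ℚ.nonNegative 0≤a}} x≤y

  *-mono : ∀ {a b x y} → 0ℚ ≤ a → 0ℚ ≤ y → a ≤ b → x ≤ y → a * x ≤ b * y
  *-mono 0≤a 0≤y a≤b x≤y = ℚ.≤-trans (*-monoˡ 0≤a x≤y) (*-monoʳ 0≤y a≤b)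

  *-nonNeg : ∀ {a b} → 0ℚ ≤ a → 0ℚ ≤ b → 0ℚ ≤ a * b
  *-nonNeg {a} {b} 0≤a 0≤b = subst (_≤ a * b) (ℚ.*-zeroʳ a) (*-monoˡ 0≤a 0≤b)

  *-pos : ∀ {a b} → 0ℚ < a → 0ℚ < b → 0ℚ < a * b
  *-pos {a} {b} 0<a 0<b =
    subst (_< a * b) (ℚ.*-zeroʳ a) (ℚ.*-monoʳ-<-pos a {{ℚ.positive 0<a}} 0<b)

  +-nonNeg : ∀ {a b} → 0ℚ ≤ a → 0ℚ ≤ b → 0ℚ ≤ a + b
  +-nonNeg 0≤a 0≤b = ℚ.+-mono-≤ 0≤a 0≤b

  0≤1 : 0ℚ ≤ 1ℚ
  0≤1 = ℚ.nonNegative⁻¹ 1ℚ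

  0<1 : 0ℚ < 1ℚ
  0<1 = ℚ.positive⁻¹ 1ℚ

  0<½ : 0ℚ < ½
  0<½ = ℚ.positive⁻¹ ½

  ≤-+ʳ : ∀ {a b} → 0ℚ ≤ b → a ≤ a + b
  ≤-+ʳ {a} {b} 0≤b = subst (_≤ a + b) (ℚ.+-identityʳ a) (ℚ.+-monoʳ-≤ a 0≤b)

  ≤-+ˡ : ∀ {a b} → 0ℚ ≤ b → a ≤ b + a
  ≤-+ˡ {a} {b} 0≤b = subst (_≤ b + a) (ℚ.+-identityˡ a) (ℚ.+-monoˡ-≤ a 0≤b)

  0≤- : ∀ {a b} → a ≤ b → 0ℚ ≤ b - a
  0≤- {a} {b} a≤b = subst (_≤ b - a) (ℚ.+-inverseʳ a) (ℚ.+-monoˡ-≤ (- a) a≤b)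

  abs-swap : ∀ a b → abs (a - b) ≡ abs (b - a)
  abs-swap a b = trans (sym (ℚ.∣-p∣≡∣p∣ (a - b)))
    (cong abs (solve 2 (λ a b → :- (a :- b) := b :- a) refl a b))

  ≤-abs : ∀ a → a ≤ abs a
  ≤-abs a = [ (λ 0≤a → ℚ.≤-reflexive (sym (ℚ.0≤p⇒∣p∣≡p 0≤a)))
            , (λ a≤0 → ℚ.≤-trans a≤0 (ℚ.0≤∣p∣ a)) ]′ (ℚ.≤-total 0ℚ a)

  abs-triangle : ∀ a b c → abs (a - c) ≤ abs (a - b) + abs (b - c)
  abs-triangle a b c = subst (λ d → abs d ≤ abs (a - b) + abs (b - c))
    (solve 3 (λ a b c → (a :- b) :+ (b :- c) := a :- c) refl a b c)
    (ℚ.∣p+q∣≤∣p∣+∣q∣ (a - b) (b - c))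

  halves : ∀ ε → ½ * ε + ½ * ε ≡ ε
  halves ε = trans (sym (ℚ.*-distribʳ-+ ε ½ ½)) (ℚ.*-identityˡ ε)

  <⇒≢0 : ∀ {p} → 0ℚ < p → p ≢ 0ℚ
  <⇒≢0 0<p refl = ℚ.<-irrefl refl 0<p

  p*p⁻¹≡1 : ∀ {p} → 0ℚ < p → p * p ⁻¹ ≡ 1ℚ
  p*p⁻¹≡1 {p} 0<p with p ℚ.≟ 0ℚ
  ... | yes p≡0 = ⊥-elim (<⇒≢0 0<p p≡0)
  ... | no p≢0  = ℚ.*-inverseʳ p {{ℚ.≢-nonZero p≢0}}

  ⁻¹-pos : ∀ {p} → 0ℚ < p → 0ℚ < p ⁻¹
  ⁻¹-pos {p} 0<p = ℚ.*-cancelˡ-<-nonNeg p {{ℚ.nonNegative (ℚ.<⇒≤ 0<p)}}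
    (subst₂ _<_ (sym (ℚ.*-zeroʳ p)) (sym (p*p⁻¹≡1 0<p)) 0<1)

  ⁻¹-nonNeg : ∀ {p} → 0ℚ < p → 0ℚ ≤ p ⁻¹
  ⁻¹-nonNeg 0<p = ℚ.<⇒≤ (⁻¹-pos 0<p)

  ⁻¹-antitone : ∀ {p q} → 0ℚ < p → p ≤ q → q ⁻¹ ≤ p ⁻¹
  ⁻¹-antitone {p} {q} 0<p p≤q = begin
    q ⁻¹              ≡⟨ ℚ.*-identityˡ (q ⁻¹) ⟨
    1ℚ * q ⁻¹         ≡⟨ cong (_* q ⁻¹) (p*p⁻¹≡1 0<p) ⟨
    p * p ⁻¹ * q ⁻¹   ≤⟨ *-monoʳ (⁻¹-nonNeg 0<q) (*-monoʳ (⁻¹-nonNeg 0<p) p≤q) ⟩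
    q * p ⁻¹ * q ⁻¹   ≡⟨ solve 3 (λ q i j → q :* i :* j := i :* (q :* j)) refl q (p ⁻¹) (q ⁻¹) ⟩
    p ⁻¹ * (q * q ⁻¹) ≡⟨ cong (p ⁻¹ *_) (p*p⁻¹≡1 0<q) ⟩
    p ⁻¹ * 1ℚ         ≡⟨ ℚ.*-identityʳ (p ⁻¹) ⟩
    p ⁻¹              ∎
    where
    open ℚ.≤-Reasoning
    0<q : 0ℚ < q
    0<q = ℚ.<-≤-trans 0<p p≤q

  ⁻¹-diff : ∀ {u v} → 0ℚ < u → 0ℚ < v → u ⁻¹ - v ⁻¹ ≡ (u ⁻¹ * v ⁻¹) * (v - u)
  ⁻¹-diff {u} {v} 0<u 0<v = begin-equality
    u ⁻¹ - v ⁻¹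
      ≡⟨ cong₂ _-_ (ℚ.*-identityʳ (u ⁻¹)) (ℚ.*-identityʳ (v ⁻¹)) ⟨
    u ⁻¹ * 1ℚ - v ⁻¹ * 1ℚ
      ≡⟨ cong₂ (λ s t → u ⁻¹ * s - v ⁻¹ * t) (p*p⁻¹≡1 0<v) (p*p⁻¹≡1 0<u) ⟨
    u ⁻¹ * (v * v ⁻¹) - v ⁻¹ * (u * u ⁻¹)
      ≡⟨ solve 4 (λ u v i j → i :* (v :* j) :- j :* (u :* i) := (i :* j) :* (v :- u))
           refl u v (u ⁻¹) (v ⁻¹) ⟩
    (u ⁻¹ * v ⁻¹) * (v - u) ∎
    where open ℚ.≤-Reasoning

  ι-suc : ∀ n → ιℚ (suc n) ≡ 1ℚ + ιℚ n
  ι-suc n = ℚ.toℚᵘ-injective (begin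
    ℚ.toℚᵘ (ιℚ (suc n))                   ≈⟨ ℚ.toℚᵘ-fromℚᵘ (ℚᵘ.mkℚᵘ (ℤ.+ suc n) 0) ⟩
    ℚᵘ.mkℚᵘ (ℤ.+ suc n) 0                   ≈⟨ ℚᵘ.*≡* (cong (λ k → (ℤ.+ 1 ℤ.+ k) ℤ.* ℤ.+ 1) (sym (ℤ.*-identityʳ (ℤ.+ n)))) ⟩
    ℚᵘ.1ℚᵘ ℚᵘ.+ ℚᵘ.mkℚᵘ (ℤ.+ n) 0           ≈⟨ ℚᵘ.+-cong (ℚᵘ.≃-refl {ℚᵘ.1ℚᵘ}) (ℚ.toℚᵘ-fromℚᵘ (ℚᵘ.mkℚᵘ (ℤ.+ n) 0)) ⟨
    ℚ.toℚᵘ 1ℚ ℚᵘ.+ ℚ.toℚᵘ (ιℚ n)          ≈⟨ ℚ.toℚᵘ-homo-+ 1ℚ (ιℚ n) ⟨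
    ℚ.toℚᵘ (1ℚ + ιℚ n)                    ∎)
    where open ℚᵘ.≃-Reasoning

  ι-nonNeg : ∀ n → 0ℚ ≤ ιℚ n
  ι-nonNeg zero    = ℚ.≤-refl
  ι-nonNeg (suc n) = subst (0ℚ ≤_) (sym (ι-suc n)) (+-nonNeg 0≤1 (ι-nonNeg n))

  ι-mono : ∀ {m n} → m ℕ.≤ n → ιℚ m ≤ ιℚ n
  ι-mono {n = n} z≤n = ι-nonNeg n
  ι-mono {suc m} {suc n} (s≤s m≤n) =
    subst₂ _≤_ (sym (ι-suc m)) (sym (ι-suc n)) (ℚ.+-monoʳ-≤ 1ℚ (ι-mono m≤n))

  ι-pos : ∀ {n} → 1 ℕ.≤ n → 0ℚ < ιℚ n
  ι-pos 1≤n = ℚ.<-≤-trans 0<1 (ι-mono 1≤n)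

  archimedean : ∀ p → ∃ λ N → p ≤ ιℚ N
  archimedean p@(mkℚ -[1+ _ ] _ _) = 0 , ℚ.<⇒≤ (ℚ.negative⁻¹ p)
  archimedean p@(mkℚ (ℤ.+ k) d _) = k , ℚ.toℚᵘ-cancel-≤
    (ℚᵘ.≤-respʳ-≃ (ℚᵘ.≃-sym (ℚ.toℚᵘ-fromℚᵘ (ℚᵘ.mkℚᵘ (ℤ.+ k) 0)))
      (ℚᵘ.*≤* (subst₂ ℤ._≤_ (ℤ.pos-* k 1) (ℤ.pos-* k (suc d))
        (ℤ.+≤+ (ℕ.*-monoʳ-≤ k (s≤s z≤n))))))

  -- T / n → 0
  vanish : ∀ T ε → 0ℚ ≤ T → 0ℚ < ε → ∃ λ N → 1 ℕ.≤ N × (∀ n → N ℕ.≤ n → T * ιℚ n ⁻¹ ≤ ε)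
  vanish T ε 0≤T 0<ε with archimedean (T * ε ⁻¹)
  ... | N , le = suc N , s≤s z≤n , λ n N≤n →
    let 0<n = ι-pos (ℕ.≤-trans (s≤s z≤n) N≤n)
    in begin
      T * ιℚ n ⁻¹                ≡⟨ cong (_* ιℚ n ⁻¹) (ℚ.*-identityʳ T) ⟨
      T * 1ℚ * ιℚ n ⁻¹           ≡⟨ cong (λ t → T * t * ιℚ n ⁻¹) (p*p⁻¹≡1 0<ε) ⟨
      T * (ε * ε ⁻¹) * ιℚ n ⁻¹   ≡⟨ solve 4 (λ t e i j → t :* (e :* i) :* j := (t :* i) :* (e :* j)) refl T ε (ε ⁻¹) (ιℚ n ⁻¹) ⟩
      (T * ε ⁻¹) * (ε * ιℚ n ⁻¹) ≤⟨ *-monoʳ (*-nonNeg (ℚ.<⇒≤ 0<ε) (⁻¹-nonNeg 0<n))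
                                      (ℚ.≤-trans le (ι-mono (ℕ.≤-trans (ℕ.n≤1+n N) N≤n))) ⟩
      ιℚ n * (ε * ιℚ n ⁻¹)       ≡⟨ solve 3 (λ n e j → n :* (e :* j) := e :* (n :* j)) refl (ιℚ n) ε (ιℚ n ⁻¹) ⟩
      ε * (ιℚ n * ιℚ n ⁻¹)       ≡⟨ cong (ε *_) (p*p⁻¹≡1 0<n) ⟩
      ε * 1ℚ                     ≡⟨ ℚ.*-identityʳ ε ⟩
      ε                          ∎
    where open ℚ.≤-Reasoning

  shrink : ∀ M ε → 0ℚ ≤ M → 0ℚ < ε → ∃ λ η → 0ℚ < η × M * η ≤ ε
  shrink M ε 0≤M 0<ε = ε * (1ℚ + M) ⁻¹ , *-pos 0<ε (⁻¹-pos 0<1+M) , (begin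
    M * (ε * (1ℚ + M) ⁻¹)        ≤⟨ *-monoʳ (*-nonNeg (ℚ.<⇒≤ 0<ε) (⁻¹-nonNeg 0<1+M)) (≤-+ˡ {M} 0≤1) ⟩
    (1ℚ + M) * (ε * (1ℚ + M) ⁻¹) ≡⟨ solve 3 (λ n e j → n :* (e :* j) := e :* (n :* j)) refl (1ℚ + M) ε ((1ℚ + M) ⁻¹) ⟩
    ε * ((1ℚ + M) * (1ℚ + M) ⁻¹) ≡⟨ cong (ε *_) (p*p⁻¹≡1 0<1+M) ⟩
    ε * 1ℚ                       ≡⟨ ℚ.*-identityʳ ε ⟩
    ε                            ∎)
    where
    open ℚ.≤-Reasoning
    0<1+M : 0ℚ < 1ℚ + M
    0<1+M = ℚ.<-≤-trans 0<1 (≤-+ʳ {1ℚ} 0≤M)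

  bounded : ∀ x → ∃ λ B → 0ℚ ≤ B × ∃ λ N → ∀ n → N ℕ.≤ n → abs (seq x n) ≤ B
  bounded x with cauchy x 1ℚ 0<1
  ... | N , close = 1ℚ + abs (seq x N) , +-nonNeg 0≤1 (ℚ.0≤∣p∣ (seq x N)) , N , λ n N≤n → begin
    abs (seq x n)                            ≡⟨ cong abs (solve 2 (λ a b → a := (a :- b) :+ b) refl (seq x n) (seq x N)) ⟩
    abs (seq x n - seq x N + seq x N)        ≤⟨ ℚ.∣p+q∣≤∣p∣+∣q∣ (seq x n - seq x N) (seq x N) ⟩
    abs (seq x n - seq x N) + abs (seq x N)  ≤⟨ ℚ.+-monoˡ-≤ _ (close n N N≤n ℕ.≤-refl) ⟩
    1ℚ + abs (seq x N)                       ∎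
    where open ℚ.≤-Reasoning

_*ᴿ_ : ℝ → ℝ → ℝ
x *ᴿ y = mkℝ (λ n → seq x n * seq y n) proof
  where
  open ℚ.≤-Reasoning
  proof : ∀ ε → 0ℚ < ε → ∃ λ N → ∀ m n → N ℕ.≤ m → N ℕ.≤ n →
          abs (seq x m * seq y m - seq x n * seq y n) ≤ ε
  proof ε 0<ε = N , λ m n m≥ n≥ → begin
    abs (seq x m * seq y m - seq x n * seq y n)
      ≡⟨ cong abs (solve 4 (λ a b c d → a :* b :- c :* d := a :* (b :- d) :+ d :* (a :- c))
           refl (seq x m) (seq y m) (seq x n) (seq y n)) ⟩
    abs (seq x m * (seq y m - seq y n) + seq y n * (seq x m - seq x n))
      ≤⟨ ℚ.∣p+q∣≤∣p∣+∣q∣ (seq x m * (seq y m - seq y n)) (seq y n * (seq x m - seq x n)) ⟩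
    abs (seq x m * (seq y m - seq y n)) + abs (seq y n * (seq x m - seq x n))
      ≡⟨ cong₂ _+_ (ℚ.∣p*q∣≡∣p∣*∣q∣ (seq x m) (seq y m - seq y n))
                   (ℚ.∣p*q∣≡∣p∣*∣q∣ (seq y n) (seq x m - seq x n)) ⟩
    abs (seq x m) * abs (seq y m - seq y n) + abs (seq y n) * abs (seq x m - seq x n)
      ≤⟨ ℚ.+-mono-≤
           (*-mono (ℚ.0≤∣p∣ (seq x m)) (ℚ.<⇒≤ 0<η) (bx m (≤₁ m≥)) (cy m n (≤₃ m≥) (≤₃ n≥)))
           (*-mono (ℚ.0≤∣p∣ (seq y n)) (ℚ.<⇒≤ 0<θ) (by n (≤₂ n≥)) (cx m n (≤₄ m≥) (≤₄ n≥))) ⟩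
    A * η + B * θ     ≤⟨ ℚ.+-mono-≤ Aη Bθ ⟩
    ½ * ε + ½ * ε     ≡⟨ halves ε ⟩
    ε                 ∎
    where
    bddX = bounded x ; A = proj₁ bddX ; 0≤A = proj₁ (proj₂ bddX)
    N₁ = proj₁ (proj₂ (proj₂ bddX)) ; bx = proj₂ (proj₂ (proj₂ bddX))
    bddY = bounded y ; B = proj₁ bddY ; 0≤B = proj₁ (proj₂ bddY)
    N₂ = proj₁ (proj₂ (proj₂ bddY)) ; by = proj₂ (proj₂ (proj₂ bddY))
    smallA = shrink A (½ * ε) 0≤A (*-pos 0<½ 0<ε)
    η = proj₁ smallA ; 0<η = proj₁ (proj₂ smallA) ; Aη = proj₂ (proj₂ smallA)
    smallB = shrink B (½ * ε) 0≤B (*-pos 0<½ 0<ε)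
    θ = proj₁ smallB ; 0<θ = proj₁ (proj₂ smallB) ; Bθ = proj₂ (proj₂ smallB)
    N₃ = proj₁ (cauchy y η 0<η) ; cy = proj₂ (cauchy y η 0<η)
    N₄ = proj₁ (cauchy x θ 0<θ) ; cx = proj₂ (cauchy x θ 0<θ)
    N = N₁ ℕ.+ N₂ ℕ.+ N₃ ℕ.+ N₄
    ≤₄ : ∀ {k} → N ℕ.≤ k → N₄ ℕ.≤ k
    ≤₄ = ℕ.m+n≤o⇒n≤o (N₁ ℕ.+ N₂ ℕ.+ N₃)
    ≤₁₂₃ : ∀ {k} → N ℕ.≤ k → N₁ ℕ.+ N₂ ℕ.+ N₃ ℕ.≤ k
    ≤₁₂₃ = ℕ.m+n≤o⇒m≤o (N₁ ℕ.+ N₂ ℕ.+ N₃)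
    ≤₃ : ∀ {k} → N ℕ.≤ k → N₃ ℕ.≤ k
    ≤₃ = ℕ.m+n≤o⇒n≤o (N₁ ℕ.+ N₂) ∘ ≤₁₂₃
    ≤₁₂ : ∀ {k} → N ℕ.≤ k → N₁ ℕ.+ N₂ ℕ.≤ k
    ≤₁₂ = ℕ.m+n≤o⇒m≤o (N₁ ℕ.+ N₂) ∘ ≤₁₂₃
    ≤₂ : ∀ {k} → N ℕ.≤ k → N₂ ℕ.≤ k
    ≤₂ = ℕ.m+n≤o⇒n≤o N₁ ∘ ≤₁₂
    ≤₁ : ∀ {k} → N ℕ.≤ k → N₁ ℕ.≤ k
    ≤₁ = ℕ.m+n≤o⇒m≤o N₁ ∘ ≤₁₂

-- riemann f a h n is the right-endpoint sum Σ_{i=1}^{n} h · f (a + i h).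
riemann : (ℚ → ℚ) → ℚ → ℚ → ℕ → ℚ
riemann f a h zero    = 0ℚ
riemann f a h (suc n) = h * f (a + h) + riemann f (a + h) h n

-- The sum for ∫₁ˣ dt/t with n equal steps of (signed) length (x - 1)/n.
logSum : ℚ → ℕ → ℚ
logSum x n = riemann _⁻¹ 1ℚ ((x - 1ℚ) * ιℚ n ⁻¹) n

private
  module Riemann (f : ℚ → ℚ) (C K : ℚ) (0≤C : 0ℚ ≤ C)
    (lipschitz : ∀ u v → abs (f u - f v) ≤ C * abs (u - v))
    (bound : ∀ u → abs (f u) ≤ K) where
    open ℚ.≤-Reasoning

    private
      0≤ι* : ∀ n p → 0ℚ ≤ ιℚ n * abs p
      0≤ι* n p = *-nonNeg (ι-nonNeg n) (ℚ.0≤∣p∣ p)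

      suc* : ∀ n p → ιℚ (suc n) * p ≡ p + ιℚ n * p
      suc* n p = trans (cong (_* p) (ι-suc n))
        (solve 2 (λ n p → (con 1ℚ :+ n) :* p := p :+ n :* p) refl (ιℚ n) p)

      abs-ι* : ∀ n p → abs (ιℚ n * p) ≡ ιℚ n * abs p
      abs-ι* n p = trans (ℚ.∣p*q∣≡∣p∣*∣q∣ (ιℚ n) p)
        (cong (_* abs p) (ℚ.0≤p⇒∣p∣≡p (ι-nonNeg n)))

    split : ∀ a k p q → riemann f a k (p ℕ.+ q) ≡ riemann f a k p + riemann f (a + ιℚ p * k) k q
    split a k zero q = begin-equality
      riemann f a k q                         ≡⟨ cong (λ b → riemann f b k q)
                                                   (solve 2 (λ a k → a := a :+ con 0ℚ :* k) refl a k) ⟩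
      riemann f (a + 0ℚ * k) k q              ≡⟨ ℚ.+-identityˡ _ ⟨
      0ℚ + riemann f (a + 0ℚ * k) k q         ∎
    split a k (suc p) q = begin-equality
      k * f (a + k) + riemann f (a + k) k (p ℕ.+ q)
        ≡⟨ cong (k * f (a + k) +_) (split (a + k) k p q) ⟩
      k * f (a + k) + (riemann f (a + k) k p + riemann f (a + k + ιℚ p * k) k q)
        ≡⟨ ℚ.+-assoc (k * f (a + k)) (riemann f (a + k) k p) _ ⟨
      k * f (a + k) + riemann f (a + k) k p + riemann f (a + k + ιℚ p * k) k q
        ≡⟨ cong (λ b → k * f (a + k) + riemann f (a + k) k p + riemann f b k q)
             (trans (ℚ.+-assoc a k (ιℚ p * k)) (cong (a +_) (sym (suc* p k)))) ⟩
      k * f (a + k) + riemann f (a + k) k p + riemann f (a + ιℚ (suc p) * k) k q ∎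

    block : ∀ b k D m a → a + ιℚ m * k ≡ b → ιℚ m * abs k ≤ D →
            abs (riemann f a k m - ιℚ m * k * f b) ≤ ιℚ m * (abs k * (C * D))
    block b k D zero a _ _ = ℚ.≤-reflexive (begin-equality
      abs (0ℚ - 0ℚ * k * f b)  ≡⟨ cong abs (solve 2 (λ k c → con 0ℚ :- con 0ℚ :* k :* c := con 0ℚ) refl k (f b)) ⟩
      0ℚ                       ≡⟨ ℚ.*-zeroˡ (abs k * (C * D)) ⟨
      0ℚ * (abs k * (C * D))   ∎)
    block b k D (suc m) a a+mk≡b mk≤D = begin
      abs (k * f (a + k) + r - ιℚ (suc m) * k * f b)
        ≡⟨ cong (λ s → abs (k * f (a + k) + r - s * k * f b)) (ι-suc m) ⟩
      abs (k * f (a + k) + r - (1ℚ + ιℚ m) * k * f b)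
        ≡⟨ cong abs (solve 5 (λ k c r m d → k :* c :+ r :- (con 1ℚ :+ m) :* k :* d
                                := k :* (c :- d) :+ (r :- m :* k :* d))
             refl k (f (a + k)) r (ιℚ m) (f b)) ⟩
      abs (k * (f (a + k) - f b) + (r - ιℚ m * k * f b))
        ≤⟨ ℚ.∣p+q∣≤∣p∣+∣q∣ (k * (f (a + k) - f b)) (r - ιℚ m * k * f b) ⟩
      abs (k * (f (a + k) - f b)) + abs (r - ιℚ m * k * f b)
        ≡⟨ cong (_+ abs (r - ιℚ m * k * f b)) (ℚ.∣p*q∣≡∣p∣*∣q∣ k (f (a + k) - f b)) ⟩
      abs k * abs (f (a + k) - f b) + abs (r - ιℚ m * k * f b)
        ≤⟨ ℚ.+-mono-≤ (*-monoˡ (ℚ.0≤∣p∣ k) (ℚ.≤-trans (lipschitz (a + k) b) (*-monoˡ 0≤C near)))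
                      (block b k D m (a + k) rest mk≤D′) ⟩
      abs k * (C * D) + ιℚ m * (abs k * (C * D))
        ≡⟨ suc* m (abs k * (C * D)) ⟨
      ιℚ (suc m) * (abs k * (C * D)) ∎
      where
      r = riemann f (a + k) k m
      rest : a + k + ιℚ m * k ≡ b
      rest = trans (ℚ.+-assoc a k (ιℚ m * k)) (trans (cong (a +_) (sym (suc* m k))) a+mk≡b)
      mk≤D′ : ιℚ m * abs k ≤ D
      mk≤D′ = ℚ.≤-trans (*-monoʳ (ℚ.0≤∣p∣ k) (ι-mono (ℕ.n≤1+n m))) mk≤D
      near : abs (a + k - b) ≤ D
      near = begin
        abs (a + k - b)                    ≡⟨ cong (λ b → abs (a + k - b)) rest ⟨
        abs (a + k - (a + k + ιℚ m * k))   ≡⟨ abs-swap (a + k) (a + k + ιℚ m * k) ⟩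
        abs (a + k + ιℚ m * k - (a + k))   ≡⟨ cong abs (solve 2 (λ c d → c :+ d :- c := d) refl (a + k) (ιℚ m * k)) ⟩
        abs (ιℚ m * k)                     ≡⟨ abs-ι* m k ⟩
        ιℚ m * abs k                       ≤⟨ mk≤D′ ⟩
        D                                  ∎

    refine : ∀ h k m → ιℚ m * k ≡ h → ∀ n a →
             abs (riemann f a h n - riemann f a k (n ℕ.* m)) ≤ ιℚ n * (abs h * (C * abs h))
    refine h k m mk≡h zero a = ℚ.≤-reflexive (sym (ℚ.*-zeroˡ (abs h * (C * abs h))))
    refine h k m mk≡h (suc n) a = begin
      abs (h * f (a + h) + r - riemann f a k (m ℕ.+ n ℕ.* m))
        ≡⟨ cong (λ s → abs (h * f (a + h) + r - s)) (split a k m (n ℕ.* m)) ⟩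
      abs (h * f (a + h) + r - (s + riemann f (a + ιℚ m * k) k (n ℕ.* m)))
        ≡⟨ cong (λ h′ → abs (h * f (a + h) + r - (s + riemann f (a + h′) k (n ℕ.* m)))) mk≡h ⟩
      abs (h * f (a + h) + r - (s + t))
        ≡⟨ cong abs (solve 4 (λ c r s t → c :+ r :- (s :+ t) := (c :- s) :+ (r :- t))
             refl (h * f (a + h)) r s t) ⟩
      abs ((h * f (a + h) - s) + (r - t))
        ≤⟨ ℚ.∣p+q∣≤∣p∣+∣q∣ (h * f (a + h) - s) (r - t) ⟩
      abs (h * f (a + h) - s) + abs (r - t)
        ≡⟨ cong (_+ abs (r - t)) (abs-swap (h * f (a + h)) s) ⟩
      abs (s - h * f (a + h)) + abs (r - t)
        ≤⟨ ℚ.+-mono-≤ one (refine h k m mk≡h n (a + h)) ⟩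
      abs h * (C * abs h) + ιℚ n * (abs h * (C * abs h))
        ≡⟨ suc* n (abs h * (C * abs h)) ⟨
      ιℚ (suc n) * (abs h * (C * abs h)) ∎
      where
      r = riemann f (a + h) h n
      s = riemann f a k m
      t = riemann f (a + h) k (n ℕ.* m)
      m∣k∣≡∣h∣ : ιℚ m * abs k ≡ abs h
      m∣k∣≡∣h∣ = trans (sym (abs-ι* m k)) (cong abs mk≡h)
      one : abs (s - h * f (a + h)) ≤ abs h * (C * abs h)
      one = begin
        abs (s - h * f (a + h))              ≡⟨ cong (λ h′ → abs (s - h′ * f (a + h))) mk≡h ⟨
        abs (s - ιℚ m * k * f (a + h))       ≤⟨ block (a + h) k (abs h) m a (cong (a +_) mk≡h) (ℚ.≤-reflexive m∣k∣≡∣h∣) ⟩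
        ιℚ m * (abs k * (C * abs h))         ≡⟨ ℚ.*-assoc (ιℚ m) (abs k) (C * abs h) ⟨
        ιℚ m * abs k * (C * abs h)           ≡⟨ cong (_* (C * abs h)) m∣k∣≡∣h∣ ⟩
        abs h * (C * abs h)                  ∎

    move : ∀ h h′ E n a a′ → abs (a - a′) + ιℚ n * abs (h - h′) ≤ E →
           abs (riemann f a h n - riemann f a′ h′ n) ≤ ιℚ n * (abs (h - h′) * K + abs h′ * (C * E))
    move h h′ E zero a a′ _ = ℚ.≤-reflexive (sym (ℚ.*-zeroˡ (abs (h - h′) * K + abs h′ * (C * E))))
    move h h′ E (suc n) a a′ le = begin
      abs (h * u + r - (h′ * v + r′))
        ≡⟨ cong abs (solve 6 (λ h h′ u v r r′ → h :* u :+ r :- (h′ :* v :+ r′)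
                                := (h :- h′) :* u :+ h′ :* (u :- v) :+ (r :- r′))
             refl h h′ u v r r′) ⟩
      abs ((h - h′) * u + h′ * (u - v) + (r - r′))
        ≤⟨ ℚ.∣p+q∣≤∣p∣+∣q∣ ((h - h′) * u + h′ * (u - v)) (r - r′) ⟩
      abs ((h - h′) * u + h′ * (u - v)) + abs (r - r′)
        ≤⟨ ℚ.+-mono-≤ (ℚ.∣p+q∣≤∣p∣+∣q∣ ((h - h′) * u) (h′ * (u - v)))
             (move h h′ E n (a + h) (a′ + h′) le′) ⟩
      abs ((h - h′) * u) + abs (h′ * (u - v)) + ιℚ n * W
        ≡⟨ cong (_+ ιℚ n * W) (cong₂ _+_ (ℚ.∣p*q∣≡∣p∣*∣q∣ (h - h′) u) (ℚ.∣p*q∣≡∣p∣*∣q∣ h′ (u - v))) ⟩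
      abs (h - h′) * abs u + abs h′ * abs (u - v) + ιℚ n * W
        ≤⟨ ℚ.+-monoˡ-≤ (ιℚ n * W) (ℚ.+-mono-≤
             (*-monoˡ (ℚ.0≤∣p∣ (h - h′)) (bound (a + h)))
             (*-monoˡ (ℚ.0≤∣p∣ h′) (ℚ.≤-trans (lipschitz (a + h) (a′ + h′)) (*-monoˡ 0≤C near)))) ⟩
      W + ιℚ n * W         ≡⟨ suc* n W ⟨
      ιℚ (suc n) * W       ∎
      where
      W = abs (h - h′) * K + abs h′ * (C * E)
      u = f (a + h)
      v = f (a′ + h′)
      r = riemann f (a + h) h n
      r′ = riemann f (a′ + h′) h′ n
      le′ : abs (a + h - (a′ + h′)) + ιℚ n * abs (h - h′) ≤ E
      le′ = begin
        abs (a + h - (a′ + h′)) + ιℚ n * abs (h - h′)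
          ≡⟨ cong (λ d → abs d + ιℚ n * abs (h - h′))
               (solve 4 (λ a h a′ h′ → a :+ h :- (a′ :+ h′) := (a :- a′) :+ (h :- h′)) refl a h a′ h′) ⟩
        abs (a - a′ + (h - h′)) + ιℚ n * abs (h - h′)
          ≤⟨ ℚ.+-monoˡ-≤ _ (ℚ.∣p+q∣≤∣p∣+∣q∣ (a - a′) (h - h′)) ⟩
        abs (a - a′) + abs (h - h′) + ιℚ n * abs (h - h′)
          ≡⟨ ℚ.+-assoc (abs (a - a′)) (abs (h - h′)) _ ⟩
        abs (a - a′) + (abs (h - h′) + ιℚ n * abs (h - h′))
          ≡⟨ cong (abs (a - a′) +_) (suc* n (abs (h - h′))) ⟨
        abs (a - a′) + ιℚ (suc n) * abs (h - h′)
          ≤⟨ le ⟩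
        E ∎
      near : abs (a + h - (a′ + h′)) ≤ E
      near = ℚ.≤-trans (≤-+ʳ (0≤ι* n (h - h′))) le′

    Sum : ℚ → ℕ → ℚ
    Sum x n = riemann f 1ℚ ((x - 1ℚ) * ιℚ n ⁻¹) n

    sum-step : ∀ x D n m → 1 ℕ.≤ n → 1 ℕ.≤ m → abs (x - 1ℚ) ≤ D →
               abs (Sum x n - Sum x m) ≤ D * (C * D) * ιℚ n ⁻¹ + D * (C * D) * ιℚ m ⁻¹
    sum-step x D n m 1≤n 1≤m d≤D = begin
      abs (Sum x n - Sum x m)
        ≤⟨ abs-triangle (Sum x n) common (Sum x m) ⟩
      abs (Sum x n - common) + abs (common - Sum x m)
        ≡⟨ cong (abs (Sum x n - common) +_) (abs-swap common (Sum x m)) ⟩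
      abs (Sum x n - common) + abs (Sum x m - common)
        ≡⟨ cong (λ s → abs (Sum x n - common) + abs (Sum x m - s))
             (cong₂ (riemann f 1ℚ) (solve 3 (λ d i j → d :* i :* j := d :* j :* i) refl (x - 1ℚ) (ιℚ n ⁻¹) (ιℚ m ⁻¹))
               (ℕ.*-comm n m)) ⟩
      abs (Sum x n - common) + abs (Sum x m - riemann f 1ℚ ((x - 1ℚ) * ιℚ m ⁻¹ * ιℚ n ⁻¹) (m ℕ.* n))
        ≤⟨ ℚ.+-mono-≤ (half n m 1≤n 1≤m) (half m n 1≤m 1≤n) ⟩
      D * (C * D) * ιℚ n ⁻¹ + D * (C * D) * ιℚ m ⁻¹ ∎
      where
      common = riemann f 1ℚ ((x - 1ℚ) * ιℚ n ⁻¹ * ιℚ m ⁻¹) (n ℕ.* m)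
      half : ∀ n m → 1 ℕ.≤ n → 1 ℕ.≤ m →
             abs (Sum x n - riemann f 1ℚ ((x - 1ℚ) * ιℚ n ⁻¹ * ιℚ m ⁻¹) (n ℕ.* m))
               ≤ D * (C * D) * ιℚ n ⁻¹
      half n m 1≤n 1≤m = begin
        abs (Sum x n - riemann f 1ℚ (h * ιℚ m ⁻¹) (n ℕ.* m))
          ≤⟨ refine h (h * ιℚ m ⁻¹) m mk≡h n 1ℚ ⟩
        ιℚ n * (abs h * (C * abs h))
          ≡⟨ cong (λ s → ιℚ n * (s * (C * s))) ∣h∣ ⟩
        ιℚ n * (d * i * (C * (d * i)))
          ≡⟨ solve 4 (λ n d i c → n :* (d :* i :* (c :* (d :* i))) := d :* (c :* d) :* i :* (n :* i))
               refl (ιℚ n) d i C ⟩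
        d * (C * d) * i * (ιℚ n * i)
          ≡⟨ cong (d * (C * d) * i *_) (p*p⁻¹≡1 (ι-pos 1≤n)) ⟩
        d * (C * d) * i * 1ℚ
          ≡⟨ ℚ.*-identityʳ (d * (C * d) * i) ⟩
        d * (C * d) * i
          ≤⟨ *-monoʳ 0≤i (*-mono 0≤d (*-nonNeg 0≤C (ℚ.≤-trans 0≤d d≤D)) d≤D (*-monoˡ 0≤C d≤D)) ⟩
        D * (C * D) * i ∎
        where
        i = ιℚ n ⁻¹
        h = (x - 1ℚ) * i
        d = abs (x - 1ℚ)
        0≤d = ℚ.0≤∣p∣ (x - 1ℚ)
        0≤i = ⁻¹-nonNeg (ι-pos 1≤n)
        ∣h∣ : abs h ≡ d * i
        ∣h∣ = trans (ℚ.∣p*q∣≡∣p∣*∣q∣ (x - 1ℚ) i) (cong (d *_) (ℚ.0≤p⇒∣p∣≡p 0≤i))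
        mk≡h : ιℚ m * (h * ιℚ m ⁻¹) ≡ h
        mk≡h = trans (solve 3 (λ m h j → m :* (h :* j) := h :* (m :* j)) refl (ιℚ m) h (ιℚ m ⁻¹))
          (trans (cong (h *_) (p*p⁻¹≡1 (ι-pos 1≤m))) (ℚ.*-identityʳ h))

    sum-move : ∀ x y D n → 1 ℕ.≤ n → abs (y - 1ℚ) ≤ D →
               abs (Sum x n - Sum y n) ≤ (K + D * C) * abs (x - y)
    sum-move x y D n 1≤n d≤D = begin
      abs (Sum x n - Sum y n)
        ≤⟨ move h h′ e n 1ℚ 1ℚ (ℚ.≤-reflexive begins) ⟩
      ιℚ n * (abs (h - h′) * K + abs h′ * (C * e))
        ≡⟨ cong₂ (λ s t → ιℚ n * (s * K + t * (C * e))) ∣h-h′∣ ∣h′∣ ⟩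
      ιℚ n * (e * i * K + d * i * (C * e))
        ≡⟨ solve 6 (λ n e i k d c → n :* (e :* i :* k :+ d :* i :* (c :* e))
                      := (k :+ d :* c) :* e :* (n :* i)) refl (ιℚ n) e i K d C ⟩
      (K + d * C) * e * (ιℚ n * i)
        ≡⟨ cong ((K + d * C) * e *_) (p*p⁻¹≡1 (ι-pos 1≤n)) ⟩
      (K + d * C) * e * 1ℚ
        ≡⟨ ℚ.*-identityʳ ((K + d * C) * e) ⟩
      (K + d * C) * e
        ≤⟨ *-monoʳ (ℚ.0≤∣p∣ (x - y)) (ℚ.+-monoʳ-≤ K (*-monoʳ 0≤C d≤D)) ⟩
      (K + D * C) * e ∎
      where
      i = ιℚ n ⁻¹
      h = (x - 1ℚ) * i
      h′ = (y - 1ℚ) * i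
      d = abs (y - 1ℚ)
      e = abs (x - y)
      ∣i∣ : abs i ≡ i
      ∣i∣ = ℚ.0≤p⇒∣p∣≡p (⁻¹-nonNeg (ι-pos 1≤n))
      ∣h′∣ : abs h′ ≡ d * i
      ∣h′∣ = trans (ℚ.∣p*q∣≡∣p∣*∣q∣ (y - 1ℚ) i) (cong (d *_) ∣i∣)
      ∣h-h′∣ : abs (h - h′) ≡ e * i
      ∣h-h′∣ = trans (cong abs (solve 3 (λ x y i → (x :- con 1ℚ) :* i :- (y :- con 1ℚ) :* i := (x :- y) :* i) refl x y i))
        (trans (ℚ.∣p*q∣≡∣p∣*∣q∣ (x - y) i) (cong (e *_) ∣i∣))
      begins : abs (1ℚ - 1ℚ) + ιℚ n * abs (h - h′) ≡ e
      begins = begin-equality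
        0ℚ + ιℚ n * abs (h - h′)  ≡⟨ ℚ.+-identityˡ _ ⟩
        ιℚ n * abs (h - h′)       ≡⟨ cong (ιℚ n *_) ∣h-h′∣ ⟩
        ιℚ n * (e * i)            ≡⟨ solve 3 (λ n e i → n :* (e :* i) := e :* (n :* i)) refl (ιℚ n) e i ⟩
        e * (ιℚ n * i)            ≡⟨ cong (e *_) (p*p⁻¹≡1 (ι-pos 1≤n)) ⟩
        e * 1ℚ                    ≡⟨ ℚ.*-identityʳ e ⟩
        e                         ∎

  -- The reciprocal, made globally Lipschitz by truncating its argument at δ > 0.
  module Truncated (δ : ℚ) (0<δ : 0ℚ < δ) where
    open ℚ.≤-Reasoning

    T : ℚ → ℚ
    T t = t ℚ.⊔ δ

    f : ℚ → ℚ
    f t = (T t) ⁻¹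

    K : ℚ
    K = δ ⁻¹

    0≤K : 0ℚ ≤ K
    0≤K = ⁻¹-nonNeg 0<δ

    0<⊔ : ∀ t → 0ℚ < T t
    0<⊔ t = ℚ.<-≤-trans 0<δ (ℚ.p≤q⊔p t δ)

    bound : ∀ u → abs (f u) ≤ K
    bound u = subst (_≤ K) (sym (ℚ.0≤p⇒∣p∣≡p (⁻¹-nonNeg (0<⊔ u))))
      (⁻¹-antitone 0<δ (ℚ.p≤q⊔p u δ))

    ⊔-lipschitz : ∀ u v → abs (T u - T v) ≤ abs (u - v)
    ⊔-lipschitz u v = [ go u v , (λ v≤u → subst₂ _≤_ (abs-swap (T v) (T u)) (abs-swap v u) (go v u v≤u)) ]′ (ℚ.≤-total u v)
      where
      go : ∀ u v → u ≤ v → abs (T u - T v) ≤ abs (u - v)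
      go u v u≤v = subst₂ _≤_ (sym lhs) (sym rhs)
        (subst (_≤ v - u) (solve 2 (λ m d → m :+ d :- d := m) refl (T v - T u) (T u))
          (subst (λ s → s - T u ≤ v - u) (solve 2 (λ a b → a := a :- b :+ b) refl (T v) (T u)) main))
        where
        lhs : abs (T u - T v) ≡ T v - T u
        lhs = trans (abs-swap (T u) (T v)) (ℚ.0≤p⇒∣p∣≡p (0≤- (ℚ.⊔-monoˡ-≤ δ u≤v)))
        rhs : abs (u - v) ≡ v - u
        rhs = trans (abs-swap u v) (ℚ.0≤p⇒∣p∣≡p (0≤- u≤v))
        v⊔δ≤ : T v ≤ (v - u) + T u
        v⊔δ≤ = ℚ.⊔-lub
          (subst (_≤ (v - u) + T u) (solve 2 (λ u v → v :- u :+ u := v) refl u v)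
            (ℚ.+-monoʳ-≤ (v - u) (ℚ.p≤p⊔q u δ)))
          (ℚ.≤-trans (ℚ.p≤q⊔p u δ) (≤-+ˡ (0≤- u≤v)))
        main : T v - T u ≤ v - u
        main = subst (T v - T u ≤_) (solve 2 (λ a b → a :+ b :- b := a) refl (v - u) (T u))
          (ℚ.+-monoˡ-≤ (- (T u)) v⊔δ≤)

    lipschitz : ∀ u v → abs (f u - f v) ≤ K * K * abs (u - v)
    lipschitz u v = begin
      abs (f u - f v)
        ≡⟨ cong abs (⁻¹-diff (0<⊔ u) (0<⊔ v)) ⟩
      abs (f u * f v * (T v - T u))
        ≡⟨ ℚ.∣p*q∣≡∣p∣*∣q∣ (f u * f v) (T v - T u) ⟩
      abs (f u * f v) * abs (T v - T u)
        ≡⟨ cong₂ _*_ (ℚ.∣p*q∣≡∣p∣*∣q∣ (f u) (f v)) (abs-swap (T v) (T u)) ⟩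
      abs (f u) * abs (f v) * abs (T u - T v)
        ≤⟨ *-mono (*-nonNeg (ℚ.0≤∣p∣ (f u)) (ℚ.0≤∣p∣ (f v))) (ℚ.0≤∣p∣ (u - v))
             (*-mono (ℚ.0≤∣p∣ (f u)) 0≤K (bound u) (bound v)) (⊔-lipschitz u v) ⟩
      K * K * abs (u - v) ∎

    open Riemann f (K * K) K (*-nonNeg 0≤K 0≤K) lipschitz bound public

    untruncate : ∀ h n a → δ ≤ a → δ ≤ a + ιℚ n * h → riemann _⁻¹ a h n ≡ riemann f a h n
    untruncate h zero a _ _ = refl
    untruncate h (suc n) a δ≤a δ≤b = cong₂ (λ s t → h * s + t)
      (cong _⁻¹ (sym (ℚ.p≥q⇒p⊔q≡p δ≤a+h)))
      (untruncate h n (a + h) δ≤a+h (subst (δ ≤_) b≡ δ≤b))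
      where
      b≡ : a + ιℚ (suc n) * h ≡ a + h + ιℚ n * h
      b≡ = trans (cong (λ s → a + s * h) (ι-suc n))
        (solve 3 (λ a n h → a :+ (con 1ℚ :+ n) :* h := a :+ h :+ n :* h) refl a (ιℚ n) h)
      δ≤a+h : δ ≤ a + h
      δ≤a+h = [ (λ 0≤h → ℚ.≤-trans δ≤a (≤-+ʳ 0≤h))
              , (λ h≤0 → ℚ.≤-trans (subst (δ ≤_) b≡ δ≤b)
                  (subst (a + h + ιℚ n * h ≤_) (ℚ.+-identityʳ (a + h))
                    (ℚ.+-monoʳ-≤ (a + h) (subst (ιℚ n * h ≤_) (ℚ.*-zeroʳ (ιℚ n))
                      (*-monoˡ (ι-nonNeg n) h≤0)))))
              ]′ (ℚ.≤-total 0ℚ h)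

    logSum≡Sum : ∀ x n → 1 ℕ.≤ n → δ ≤ 1ℚ → δ ≤ x → logSum x n ≡ Sum x n
    logSum≡Sum x n 1≤n δ≤1 δ≤x = untruncate ((x - 1ℚ) * ιℚ n ⁻¹) n 1ℚ δ≤1 (subst (δ ≤_) end δ≤x)
      where
      end : x ≡ 1ℚ + ιℚ n * ((x - 1ℚ) * ιℚ n ⁻¹)
      end = begin-equality
        x                                        ≡⟨ solve 1 (λ x → x := con 1ℚ :+ (x :- con 1ℚ) :* con 1ℚ) refl x ⟩
        1ℚ + (x - 1ℚ) * 1ℚ                       ≡⟨ cong (λ s → 1ℚ + (x - 1ℚ) * s) (p*p⁻¹≡1 (ι-pos 1≤n)) ⟨
        1ℚ + (x - 1ℚ) * (ιℚ n * ιℚ n ⁻¹)         ≡⟨ solve 3 (λ d n i → con 1ℚ :+ d :* (n :* i) := con 1ℚ :+ n :* (d :* i)) refl (x - 1ℚ) (ιℚ n) (ιℚ n ⁻¹) ⟩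
        1ℚ + ιℚ n * ((x - 1ℚ) * ιℚ n ⁻¹)         ∎

-- log x = ∫₁ˣ dt/t.  Only finitely many terms of seq x can fail to be positive,
-- so the convention 0 ⁻¹ = 0 does not affect the limit.
log : (x : ℝ) → 0ᴿ <ᴿ x → ℝ
log x (δ₀ , 0<δ₀ , N₀ , δ₀≤x) = mkℝ (λ n → logSum (seq x n) n) proof
  where
  open ℚ.≤-Reasoning
  δ : ℚ
  δ = δ₀ ℚ.⊓ 1ℚ
  0<δ : 0ℚ < δ
  0<δ = [ (λ le → subst (0ℚ <_) (sym (ℚ.p≤q⇒p⊓q≡p le)) 0<δ₀)
        , (λ ge → subst (0ℚ <_) (sym (ℚ.p≥q⇒p⊓q≡q ge)) 0<1) ]′ (ℚ.≤-total δ₀ 1ℚ)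
  δ≤1 : δ ≤ 1ℚ
  δ≤1 = ℚ.p⊓q≤q δ₀ 1ℚ
  δ≤x : ∀ n → N₀ ℕ.≤ n → δ ≤ seq x n
  δ≤x n N₀≤n = ℚ.≤-trans (ℚ.p⊓q≤p δ₀ 1ℚ)
    (subst (_≤ seq x n) (ℚ.+-identityˡ δ₀) (δ₀≤x n N₀≤n))
  open Truncated δ 0<δ
  proof : ∀ ε → 0ℚ < ε → ∃ λ N → ∀ m n → N ℕ.≤ m → N ℕ.≤ n →
          abs (logSum (seq x m) m - logSum (seq x n) n) ≤ ε
  proof ε 0<ε = N , λ m n m≥ n≥ →
    let xm = seq x m ; xn = seq x n
        1≤m = ℕ.≤-trans 1≤N₂ (≤₂ m≥) ; 1≤n = ℕ.≤-trans 1≤N₂ (≤₂ n≥)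
        near : abs (xn - 1ℚ) ≤ D
        near = ℚ.≤-trans (ℚ.∣p-q∣≤∣p∣+∣q∣ xn 1ℚ) (ℚ.+-monoˡ-≤ 1ℚ (bx n (≤₁ n≥)))
    in begin
    abs (logSum xm m - logSum xn n)
      ≡⟨ cong₂ (λ s t → abs (s - t)) (logSum≡Sum xm m 1≤m δ≤1 (δ≤x m (≤₀ m≥)))
                                     (logSum≡Sum xn n 1≤n δ≤1 (δ≤x n (≤₀ n≥))) ⟩
    abs (Sum xm m - Sum xn n)
      ≤⟨ abs-triangle (Sum xm m) (Sum xn m) (Sum xn n) ⟩
    abs (Sum xm m - Sum xn m) + abs (Sum xn m - Sum xn n)
      ≤⟨ ℚ.+-mono-≤ (sum-move xm xn D m 1≤m near) (sum-step xn D m n 1≤m 1≤n near) ⟩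
    (K + D * (K * K)) * abs (xm - xn) + (D * (K * K * D) * ιℚ m ⁻¹ + D * (K * K * D) * ιℚ n ⁻¹)
      ≤⟨ ℚ.+-mono-≤
           (ℚ.≤-trans (*-monoˡ 0≤M
             (cx m n (≤₃ m≥) (≤₃ n≥))) Mη)
           (ℚ.+-mono-≤ (small m (≤₂ m≥)) (small n (≤₂ n≥))) ⟩
    ½ * ε + (½ * (½ * ε) + ½ * (½ * ε))
      ≡⟨ cong (½ * ε +_) (halves (½ * ε)) ⟩
    ½ * ε + ½ * ε
      ≡⟨ halves ε ⟩
    ε ∎
    where
    bddX = bounded x ; B = proj₁ bddX ; 0≤B = proj₁ (proj₂ bddX)
    N₁ = proj₁ (proj₂ (proj₂ bddX)) ; bx = proj₂ (proj₂ (proj₂ bddX))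
    D : ℚ
    D = B + 1ℚ
    0≤D : 0ℚ ≤ D
    0≤D = +-nonNeg 0≤B 0≤1
    0≤M : 0ℚ ≤ K + D * (K * K)
    0≤M = +-nonNeg 0≤K (*-nonNeg 0≤D (*-nonNeg 0≤K 0≤K))
    smallM = shrink (K + D * (K * K)) (½ * ε) 0≤M (*-pos 0<½ 0<ε)
    η = proj₁ smallM ; 0<η = proj₁ (proj₂ smallM) ; Mη = proj₂ (proj₂ smallM)
    tail = vanish (D * (K * K * D)) (½ * (½ * ε))
      (*-nonNeg 0≤D (*-nonNeg (*-nonNeg 0≤K 0≤K) 0≤D)) (*-pos 0<½ (*-pos 0<½ 0<ε))
    N₂ = proj₁ tail ; 1≤N₂ = proj₁ (proj₂ tail) ; small = proj₂ (proj₂ tail)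
    N₃ = proj₁ (cauchy x η 0<η) ; cx = proj₂ (cauchy x η 0<η)
    N = N₀ ℕ.+ N₁ ℕ.+ N₂ ℕ.+ N₃
    ≤₃ : ∀ {k} → N ℕ.≤ k → N₃ ℕ.≤ k
    ≤₃ = ℕ.m+n≤o⇒n≤o (N₀ ℕ.+ N₁ ℕ.+ N₂)
    ≤₀₁₂ : ∀ {k} → N ℕ.≤ k → N₀ ℕ.+ N₁ ℕ.+ N₂ ℕ.≤ k
    ≤₀₁₂ = ℕ.m+n≤o⇒m≤o (N₀ ℕ.+ N₁ ℕ.+ N₂)
    ≤₂ : ∀ {k} → N ℕ.≤ k → N₂ ℕ.≤ k
    ≤₂ = ℕ.m+n≤o⇒n≤o (N₀ ℕ.+ N₁) ∘ ≤₀₁₂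
    ≤₀₁ : ∀ {k} → N ℕ.≤ k → N₀ ℕ.+ N₁ ℕ.≤ k
    ≤₀₁ = ℕ.m+n≤o⇒m≤o (N₀ ℕ.+ N₁) ∘ ≤₀₁₂
    ≤₁ : ∀ {k} → N ℕ.≤ k → N₁ ℕ.≤ k
    ≤₁ = ℕ.m+n≤o⇒n≤o N₀ ∘ ≤₀₁
    ≤₀ : ∀ {k} → N ℕ.≤ k → N₀ ℕ.≤ k
    ≤₀ = ℕ.m+n≤o⇒m≤o N₀ ∘ ≤₀₁

private
  riemann-lower : ∀ h b n a → 0ℚ ≤ h → 0ℚ < a → a + ιℚ n * h ≤ b →
                  ιℚ n * (h * b ⁻¹) ≤ riemann _⁻¹ a h n
  riemann-lower h b zero a _ _ _ = ℚ.≤-reflexive (ℚ.*-zeroˡ (h * b ⁻¹))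
  riemann-lower h b (suc n) a 0≤h 0<a end≤b = begin
    ιℚ (suc n) * (h * b ⁻¹)        ≡⟨ cong (_* (h * b ⁻¹)) (ι-suc n) ⟩
    (1ℚ + ιℚ n) * (h * b ⁻¹)       ≡⟨ solve 2 (λ n p → (con 1ℚ :+ n) :* p := p :+ n :* p) refl (ιℚ n) (h * b ⁻¹) ⟩
    h * b ⁻¹ + ιℚ n * (h * b ⁻¹)   ≤⟨ ℚ.+-mono-≤
                                        (*-monoˡ 0≤h (⁻¹-antitone 0<a+h (ℚ.≤-trans (≤-+ʳ (*-nonNeg (ι-nonNeg n) 0≤h)) end≤b′)))
                                        (riemann-lower h b n (a + h) 0≤h 0<a+h end≤b′) ⟩
    h * (a + h) ⁻¹ + riemann _⁻¹ (a + h) h n ∎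
    where
    open ℚ.≤-Reasoning
    0<a+h : 0ℚ < a + h
    0<a+h = ℚ.<-≤-trans 0<a (≤-+ʳ 0≤h)
    end≤b′ : a + h + ιℚ n * h ≤ b
    end≤b′ = subst (_≤ b) (trans (cong (λ s → a + s * h) (ι-suc n))
      (solve 3 (λ a n h → a :+ (con 1ℚ :+ n) :* h := a :+ h :+ n :* h) refl a (ιℚ n) h)) end≤b

fromℕ-pos : ∀ {n} → 1 ℕ.< n → 0ᴿ <ᴿ fromℕ n
fromℕ-pos {n} 1<n = ιℚ n , ι-pos (ℕ.<⇒≤ 1<n) , 0 , λ _ _ → ℚ.≤-reflexive (ℚ.+-identityˡ (ιℚ n))

logℕ : (n : ℕ) → 1 ℕ.< n → ℝ
logℕ n 1<n = log (fromℕ n) (fromℕ-pos 1<n)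

logℕ-pos : ∀ {n} (1<n : 1 ℕ.< n) → 0ᴿ <ᴿ logℕ n 1<n
logℕ-pos {n} 1<n = q ⁻¹ , ⁻¹-pos 0<q , 1 , λ k 1≤k →
  let i = ιℚ k ⁻¹
      h = (q - 1ℚ) * i
      kh≡ : ιℚ k * h ≡ q - 1ℚ
      kh≡ = trans (solve 3 (λ k d i → k :* (d :* i) := d :* (k :* i)) refl (ιℚ k) (q - 1ℚ) i)
        (trans (cong ((q - 1ℚ) *_) (p*p⁻¹≡1 (ι-pos 1≤k))) (ℚ.*-identityʳ (q - 1ℚ)))
  in begin
  0ℚ + q ⁻¹               ≡⟨ solve 1 (λ j → con 0ℚ :+ j := con 1ℚ :* j) refl (q ⁻¹) ⟩
  1ℚ * q ⁻¹               ≤⟨ *-monoʳ (⁻¹-nonNeg 0<q) 1≤q-1 ⟩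
  (q - 1ℚ) * q ⁻¹         ≡⟨ cong (_* q ⁻¹) kh≡ ⟨
  ιℚ k * h * q ⁻¹         ≡⟨ ℚ.*-assoc (ιℚ k) h (q ⁻¹) ⟩
  ιℚ k * (h * q ⁻¹)       ≤⟨ riemann-lower h q k 1ℚ
                               (*-nonNeg (ℚ.≤-trans 0≤1 1≤q-1) (⁻¹-nonNeg (ι-pos 1≤k))) 0<1
                               (ℚ.≤-reflexive (trans (cong (1ℚ +_) kh≡)
                                 (solve 1 (λ q → con 1ℚ :+ (q :- con 1ℚ) := q) refl q))) ⟩
  logSum q k              ∎
  where
  open ℚ.≤-Reasoning
  q : ℚ
  q = ιℚ n
  0<q : 0ℚ < q
  0<q = ι-pos (ℕ.<⇒≤ 1<n)
  1≤q-1 : 1ℚ ≤ q - 1ℚ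
  1≤q-1 = ℚ.+-monoˡ-≤ (- 1ℚ) (ι-mono 1<n)

loglogℕ : (n : ℕ) → 1 ℕ.< n → ℝ
loglogℕ n 1<n = log (logℕ n 1<n) (logℕ-pos 1<n)

Least : ∀ {p} → Pred ℕ p → Pred ℕ p
Least P n = P n × (∀ k → P k → n ℕ.≤ k)

least : ∀ {p} {P : Pred ℕ p} → Decidable P → ∃ P → ∃ (Least P)
least {P = P} P? (n , Pn) = search n Pn (<-wellFounded n)
  where
  search : ∀ n → P n → Acc ℕ._<_ n → ∃ (Least P)
  search n Pn (acc below) with ℕ.anyUpTo? P? n
  ... | yes (k , k<n , Pk) = search k Pk (below k<n)
  ... | no none            = n , Pn , λ k Pk → ℕ.≮⇒≥ λ k<n → none (k , k<n , Pk)

record FiniteAbelianGroup (c ℓ : Level) : Set (lsuc (c ⊔ ℓ)) where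
  field
    abelianGroup : AbelianGroup c ℓ

  open AbelianGroup abelianGroup public using (Carrier; _≈_; _∙_; ε; setoid)

  field
    order       : ℕ
    enumeration : Inverse setoid (≡-setoid (Fin order))

  index : Carrier → Fin order
  index = Inverse.to enumeration

open FiniteAbelianGroup using (order)

private
  variable
    c ℓ : Level

PrimeDivisor : ℕ → Pred ℕ _
PrimeDivisor n p = Prime p × p ∣ n

primeDivisor : ∀ n → 1 ℕ.< n → ∃ (PrimeDivisor n)
primeDivisor n 1<n with factorise n {{ℕ.>-nonZero (ℕ.<-trans (s≤s z≤n) 1<n)}}
... | record { factors = [] ; isFactorisation = eq } = ⊥-elim (ℕ.<⇒≢ 1<n (sym eq))
... | record { factors = p ∷ ps ; isFactorisation = eq ; factorsPrime = prime-p ∷ _ } =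
  p , prime-p , divides (product ps) (trans eq (ℕ.*-comm p (product ps)))

module _ (G : FiniteAbelianGroup c ℓ) (1<∣G∣ : 1 ℕ.< order G) where

  private
    leastPrimeDivisor : ∃ (Least (PrimeDivisor (order G)))
    leastPrimeDivisor = least (λ p → prime? p ×-dec p ∣? order G) (primeDivisor (order G) 1<∣G∣)

  q : ℕ
  q = proj₁ leastPrimeDivisor

  q-least : Least (PrimeDivisor (order G)) q
  q-least = proj₂ leastPrimeDivisor

  1<q : 1 ℕ.< q
  1<q = ℕ.nonTrivial⇒n>1 q {{prime⇒nonTrivial (proj₁ (proj₁ q-least))}}

  log-q : ℝ
  log-q = logℕ q 1<q

  loglog-q : ℝ
  loglog-q = loglogℕ q 1<q

-- A subset of G is a set of indices in the enumeration of G; its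
-- cardinality ∣ A ∣ is then that of Data.Fin.Subset.
FinSubset : FiniteAbelianGroup c ℓ → Set
FinSubset G = Subset (order G)

module _ (G : FiniteAbelianGroup c ℓ) where
  open FiniteAbelianGroup G hiding (order)

  infix 4 _∈_

  _∈_ : Carrier → FinSubset G → Set
  x ∈ A = index x ∈ˢ A

  NoUniqueSum : FinSubset G → Set (c ⊔ ℓ)
  NoUniqueSum A = ∀ a b → a ∈ A → b ∈ A →
    ∃ λ c → ∃ λ d → c ∈ A × d ∈ A × a ∙ b ≈ c ∙ d × ¬ ((a ≈ c × b ≈ d) ⊎ (a ≈ d × b ≈ c))

  SizeWithoutUniqueSum : Pred ℕ (c ⊔ ℓ)
  SizeWithoutUniqueSum k = ∃ λ (A : FinSubset G) → ∣ A ∣ ≡ k × 2 ℕ.≤ ∣ A ∣ × NoUniqueSum A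

  private
    element : Fin (order G) → Carrier
    element = Inverse.from enumeration

    element-index : ∀ x → element (index x) ≈ x
    element-index = Inverse.strictlyInverseʳ enumeration

    index-element : ∀ i → index (element i) ≡ i
    index-element = Inverse.strictlyInverseˡ enumeration

    index-injective : ∀ {x y} → index x ≡ index y → x ≈ y
    index-injective {x} {y} eq = ≈-trans (≈-sym (element-index x))
      (≈-trans (Inverse.from-cong enumeration eq) (element-index y))
      where open AbelianGroup abelianGroup renaming (trans to ≈-trans; sym to ≈-sym)

    _≈?_ : ∀ x y → Dec (x ≈ y)
    x ≈? y = map′ index-injective (Inverse.to-cong enumeration) (index x Fin.≟ index y)

    any-element? : ∀ {p} {P : Pred Carrier p} → (∀ {x y} → x ≈ y → P x → P y) → Decidable P → Dec (∃ P)
    any-element? resp P? = map′ (λ (i , p) → element i , p)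
      (λ (x , p) → index x , resp (AbelianGroup.sym abelianGroup (element-index x)) p)
      (Fin.any? (P? ∘ element))

    all-elements? : ∀ {p} {P : Pred Carrier p} → (∀ {x y} → x ≈ y → P x → P y) → Decidable P → Dec (∀ x → P x)
    all-elements? resp P? = map′ (λ all x → resp (element-index x) (all (index x)))
      (λ all i → all (element i)) (Fin.all? (P? ∘ element))

    module _ (A : FinSubset G) where
      open AbelianGroup abelianGroup using () renaming (trans to ≈-trans; sym to ≈-sym; ∙-cong to cong∙; refl to ≈-refl)

      ∈-resp : ∀ {x y} → x ≈ y → x ∈ A → y ∈ A
      ∈-resp x≈y = subst (_∈ˢ A) (Inverse.to-cong enumeration x≈y)

      Alternative : Carrier → Carrier → Carrier → Carrier → Set ℓ
      Alternative a b c d = c ∈ A × d ∈ A × a ∙ b ≈ c ∙ d × ¬ ((a ≈ c × b ≈ d) ⊎ (a ≈ d × b ≈ c))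

      alternative-resp : ∀ {a a′ b b′ c c′ d d′} → a ≈ a′ → b ≈ b′ → c ≈ c′ → d ≈ d′ →
                         Alternative a b c d → Alternative a′ b′ c′ d′
      alternative-resp a b c d (c∈ , d∈ , eq , ne) =
        ∈-resp c c∈ , ∈-resp d d∈ ,
        ≈-trans (cong∙ (≈-sym a) (≈-sym b)) (≈-trans eq (cong∙ c d)) ,
        λ { (inj₁ (p , r)) → ne (inj₁ (≈-trans a (≈-trans p (≈-sym c)) , ≈-trans b (≈-trans r (≈-sym d))))
          ; (inj₂ (p , r)) → ne (inj₂ (≈-trans a (≈-trans p (≈-sym d)) , ≈-trans b (≈-trans r (≈-sym c)))) }

      alternative? : ∀ a b c d → Dec (Alternative a b c d)
      alternative? a b c d = index c ∈? A ×-dec index d ∈? A ×-dec (a ∙ b) ≈? (c ∙ d)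
        ×-dec ¬? (((a ≈? c) ×-dec (b ≈? d)) ⊎-dec ((a ≈? d) ×-dec (b ≈? c)))

      noUniqueSum? : Dec (NoUniqueSum A)
      noUniqueSum? = all-elements?
        (λ a≈a′ h b a∈ b∈ → let (c , d , alt) = h b (∈-resp (≈-sym a≈a′) a∈) b∈
                            in c , d , alternative-resp a≈a′ ≈-refl ≈-refl ≈-refl alt)
        λ a → all-elements?
        (λ b≈b′ h a∈ b∈ → let (c , d , alt) = h a∈ (∈-resp (≈-sym b≈b′) b∈)
                          in c , d , alternative-resp ≈-refl b≈b′ ≈-refl ≈-refl alt)
        λ b → (index a ∈? A) →-dec ((index b ∈? A) →-dec any-element?
          (λ c≈c′ (d , alt) → d , alternative-resp ≈-refl ≈-refl c≈c′ ≈-refl alt)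
          λ c → any-element?
          (λ d≈d′ → alternative-resp ≈-refl ≈-refl ≈-refl d≈d′)
          (alternative? a b c))

    -- Among three distinct elements one avoids any two given values.
    avoid : 3 ℕ.≤ order G → ∀ u v → ∃ λ g → ¬ (g ≈ u) × ¬ (g ≈ v)
    avoid 3≤n u v = pick (¬both i₀) (¬both i₁) (¬both i₂)
      where
      0<n = ℕ.≤-trans (s≤s z≤n) 3≤n
      1<n = ℕ.≤-trans (s≤s (s≤s z≤n)) 3≤n
      i₀ = fromℕ< {0} 0<n
      i₁ = fromℕ< {1} 1<n
      i₂ = fromℕ< {2} 3≤n
      Good : Fin (order G) → Set _
      Good i = ¬ (element i ≈ u) × ¬ (element i ≈ v)
      ¬both : ∀ i → Good i ⊎ (i ≡ index u ⊎ i ≡ index v)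
      ¬both i with element i ≈? u | element i ≈? v
      ... | yes p | _     = inj₂ (inj₁ (trans (sym (index-element i)) (Inverse.to-cong enumeration p)))
      ... | no _  | yes p = inj₂ (inj₂ (trans (sym (index-element i)) (Inverse.to-cong enumeration p)))
      ... | no p  | no r  = inj₁ (p , r)
      differ : ∀ {j k w} (j<n : j ℕ.< order G) (k<n : k ℕ.< order G) → j ≢ k →
               fromℕ< j<n ≡ w → fromℕ< k<n ≡ w → ⊥
      differ j<n k<n j≢k p r = j≢k (Fin.fromℕ<-injective _ _ j<n k<n (trans p (sym r)))
      0≢1 : 0 ≢ 1
      0≢1 ()
      0≢2 : 0 ≢ 2
      0≢2 ()
      1≢2 : 1 ≢ 2
      1≢2 ()
      pick : Good i₀ ⊎ (i₀ ≡ index u ⊎ i₀ ≡ index v) →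
             Good i₁ ⊎ (i₁ ≡ index u ⊎ i₁ ≡ index v) →
             Good i₂ ⊎ (i₂ ≡ index u ⊎ i₂ ≡ index v) → ∃ λ g → ¬ (g ≈ u) × ¬ (g ≈ v)
      pick (inj₁ good) _ _ = element i₀ , good
      pick _ (inj₁ good) _ = element i₁ , good
      pick _ _ (inj₁ good) = element i₂ , good
      pick (inj₂ (inj₁ p)) (inj₂ (inj₁ r)) _ = ⊥-elim (differ 0<n 1<n 0≢1 p r)
      pick (inj₂ (inj₂ p)) (inj₂ (inj₂ r)) _ = ⊥-elim (differ 0<n 1<n 0≢1 p r)
      pick (inj₂ (inj₁ p)) _ (inj₂ (inj₁ r)) = ⊥-elim (differ 0<n 3≤n 0≢2 p r)
      pick (inj₂ (inj₂ p)) _ (inj₂ (inj₂ r)) = ⊥-elim (differ 0<n 3≤n 0≢2 p r)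
      pick _ (inj₂ (inj₁ p)) (inj₂ (inj₁ r)) = ⊥-elim (differ 1<n 3≤n 1≢2 p r)
      pick _ (inj₂ (inj₂ p)) (inj₂ (inj₂ r)) = ⊥-elim (differ 1<n 3≤n 1≢2 p r)

    whole-group : 3 ℕ.≤ order G → NoUniqueSum ⊤
    whole-group 3≤n a b _ _ = a ∙ g , i g ∙ b , ∈⊤ , ∈⊤ , eq ,
      λ { (inj₁ (a≈ag , _)) → g≉ε (∙-cancelˡ a g ε (≈-trans (≈-sym a≈ag) (≈-sym (identityʳ a))))
        ; (inj₂ (_ , b≈ag)) → g≉b-a (≈-trans (≈-sym (≈-trans (≈-sym (assoc (i a) a g))
              (≈-trans (∙-congʳ (inverseˡ a)) (identityˡ g)))) (∙-congˡ (≈-sym b≈ag))) }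
      where
      open AbelianGroup abelianGroup using (identityʳ; identityˡ; assoc; inverseˡ; inverseʳ; ∙-congʳ; ∙-congˡ)
        renaming (_⁻¹ to i; trans to ≈-trans; sym to ≈-sym)
      open GroupProperties (AbelianGroup.group abelianGroup) using (∙-cancelˡ)
      avoided = avoid 3≤n ε (i a ∙ b)
      g = proj₁ avoided
      g≉ε = proj₁ (proj₂ avoided)
      g≉b-a = proj₂ (proj₂ avoided)
      eq : a ∙ b ≈ (a ∙ g) ∙ (i g ∙ b)
      eq = ≈-sym (≈-trans (assoc a g (i g ∙ b)) (∙-congˡ (≈-trans (≈-sym (assoc g (i g) b))
        (≈-trans (∙-congʳ (inverseʳ g)) (identityˡ b)))))

    minimalSize : 3 ℕ.≤ order G → ∃ (Least SizeWithoutUniqueSum)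
    minimalSize 3≤n = least
      (λ k → anySubset? λ A → (∣ A ∣ ℕ.≟ k) ×-dec (2 ℕ.≤? ∣ A ∣) ×-dec noUniqueSum? A)
      (order G , ⊤ , ∣⊤∣≡n (order G) ,
        subst (2 ℕ.≤_) (sym (∣⊤∣≡n (order G))) (ℕ.≤-trans (s≤s (s≤s z≤n)) 3≤n) , whole-group 3≤n)

  m : 3 ℕ.≤ order G → ℕ
  m 3≤∣G∣ = proj₁ (minimalSize 3≤∣G∣)

  m-least : (3≤∣G∣ : 3 ℕ.≤ order G) → Least SizeWithoutUniqueSum (m 3≤∣G∣)
  m-least 3≤∣G∣ = proj₂ (minimalSize 3≤∣G∣)

c* : ℚ
c* = ℤ.+ 1 ℚ./ 40000000010006048640

{-# OPTIONS --safe #-}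
-- Let A have n elements and no unique sum, so that for all x, b ∈ A there are c, d ∈ A with x + b = c + d
-- and c, d ≠ x. Call x - c popular if it is b - d for at least T pairs b, d ∈ A. A greedy argument
-- with T = n^(3/7) yields a set S ⊆ A of O(n^(6/7) log n) seeds such that every popular difference is a
-- difference of seeds, and such that every x ∈ A with at least 2T² exceptions (those b for which no
-- x - c above is popular) is itself c + d - b for seeds b, c, d.
--
-- If C ⊆ A consists of signed sums of at most L elements of a set of k seeds and q(G) > (2RL + 1)ᵏ, then
-- C has an extreme point x: a sum of at most R terms x - c with c ∈ C vanishes only if all terms do. Indeed,
-- by the pigeonhole principle a multiple of a character of G takes small values on the seeds, which lifts
-- it to integer values on C respecting short relations; now pass to the elements where it is maximal and
-- iterate. For C = A and R = 2 an extreme point x would have the unique sum x + x.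
--
-- Let C be the closure of some y ∈ A under steps by popular differences, and x an extreme point of C. Walking
-- from any b ∈ A by b ↦ b + (x - c), with x - c popular, never closes up, so it ends in an exception of x.
-- Were there few of these, then S and the exceptions of x would generate A, which is impossible. So x, and
-- with it y, is generated by S. As y was arbitrary, S generates A, which is again impossible, unless log q(G)
-- is O(n^(6/7) (log n)²), which is more than enough.
module Submission where

open import Defs
open import Data.Fin.Subset using (∣_∣)
open import Data.Nat.Base using (ℕ; _≤_; _<_)
open import Data.Nat.Properties using (<⇒≤)
open import Data.Product using (Σ; _×_)
open FiniteAbelianGroup using (order)

open import Level using (_⊔_; Lift; lift) renaming (suc to lsuc)
open import Algebra.Bundles using (AbelianGroup)
import Algebra.Properties.AbelianGroup as AbelianGroupProperties
import Algebra.Properties.CommutativeMonoid.Mult as Mult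
import Algebra.Properties.CommutativeMonoid.Sum as Sum
import Algebra.Properties.Group as GroupProperties
import Algebra.Solver.CommutativeMonoid as CommutativeMonoidSolver
open import Data.Empty using (⊥; ⊥-elim)
open import Data.Fin.Base using (Fin; zero; suc; combine; finToFun; fromℕ<; funToFin; inject≤; toℕ)
open import Data.Fin.Permutation using (permutation)
import Data.Fin.Properties as Fin
open import Data.Fin.Subset using (Subset; inside; outside) renaming (_∈_ to _∈ˢ_)
open import Data.Integer.Base as ℤ using (ℤ; 0ℤ) renaming (+_ to pos)
import Data.Integer.Divisibility.Signed as ℤ
open import Data.Integer.DivMod using (_%ℕ_; _/ℕ_; n%ℕd<d; a≡a%ℕn+[a/ℕn]*n)
import Data.Integer.Properties as ℤ
import Data.Integer.Solver
open import Data.List.Base as List using (List; []; _∷_; _++_; length; map; filter; allFin; cartesianProduct)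
open import Data.List.Extrema ℤ.≤-totalOrder using (argmax; f[xs]≤f[argmax]; argmax-sel)
open import Data.List.Membership.Propositional using (find; lose) renaming (_∈_ to _∈ˡ_)
import Data.List.Membership.Propositional.Properties as ∈ˡ
import Data.List.Properties as List
open import Data.List.Relation.Unary.All as All using (All; []; _∷_)
open import Data.List.Relation.Unary.AllPairs as AllPairs using (AllPairs; []; _∷_)
open import Data.List.Relation.Unary.Any as Any using (here; there)
import Data.List.Relation.Unary.Any.Properties as Any
open import Data.List.Relation.Unary.Any.Properties using (¬Any[])
open import Data.List.Relation.Unary.Unique.Propositional using (Unique)
import Data.List.Relation.Unary.Unique.Propositional.Properties as Unique
open import Data.Nat.Base as ℕ using (zero; suc; z≤n; s≤s; _+_; _*_; _^_)
open import Data.Nat.Coprimality using (Coprime; coprime-Bézout)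
import Data.Nat.Divisibility as ℕ
open import Data.Nat.DivMod using (_divMod_; result; _/_; _%_; m≡m%n+[m/n]*n; m%n<n; m<n*o⇒m/o<n)
open import Data.Nat.GCD using (module Bézout)
open import Data.Nat.ListAction using (sum)
import Data.Nat.Properties as ℕ
open import Data.Nat.Solver using (module +-*-Solver)
open import Data.Product using (∃; _,_; proj₁; proj₂)
open import Data.Rational.Base as ℚ using (ℚ; 0ℚ; 1ℚ; ½)
  renaming (_+_ to _+ℚ_; _*_ to _*ℚ_; _-_ to _-ℚ_; _≤_ to _≤ℚ_; _<_ to _<ℚ_)
import Data.Rational.Properties as ℚ
import Data.Rational.Solver
import Data.Rational.Unnormalised.Base as ℚᵘ
import Data.Rational.Unnormalised.Properties as ℚᵘ
open import Data.Sum.Base using (_⊎_; inj₁; inj₂; [_,_]′)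
open import Data.Unit.Base using (tt)
open import Data.Vec.Base using (_∷_; here; there)
open import Function.Base using (_∘_; id)
open import Function.Bundles using (Inverse)
open import Function.Definitions using (Injective)
open import Relation.Binary.PropositionalEquality as ≡ using (_≡_; _≢_; cong; cong₂; subst; subst₂)
open import Relation.Nullary using (¬_; Dec; yes; no)
open import Relation.Nullary.Decidable using (¬?; _⊎-dec_; _×-dec_; map′; decidable-stable)
open import Relation.Unary using (Pred; Decidable)
open import Algebra.Properties.CommutativeSemigroup ℕ.+-commutativeSemigroup using (x∙yz≈y∙xz)
open GroupProperties (AbelianGroup.group ℤ.+-0-abelianGroup) using () renaming (∙-cancelʳ to +ᶻ-cancelʳ)

-- Counting in finite lists.

module _ {a} {A : Set a} where

  injective⇒≤length : ∀ {U} (f : Fin U → A) → Injective _≡_ _≡_ f →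
                      (ys : List A) → (∀ j → f j ∈ˡ ys) → U ≤ length ys
  injective⇒≤length f inj ys f∈ = Fin.injective⇒≤ {f = λ j → Any.index (f∈ j)} λ {i} {j} eq →
    inj (≡.trans (Any.lookup-index (f∈ i)) (≡.trans (cong (List.lookup ys) eq) (≡.sym (Any.lookup-index (f∈ j)))))

  average≤max : (g : A → ℕ) (x₀ : A) (xs : List A) → ∃ λ v → sum (map g xs) ≤ length xs * g v
  average≤max g x₀ [] = x₀ , z≤n
  average≤max g x₀ (x ∷ xs) with average≤max g x₀ xs
  ... | v , le with ℕ.≤-total (g v) (g x)
  ...   | inj₁ v≤x = x , ℕ.+-monoʳ-≤ (g x) (ℕ.≤-trans le (ℕ.*-monoʳ-≤ (length xs) v≤x))
  ...   | inj₂ x≤v = v , ℕ.+-mono-≤ x≤v le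

  module _ {p} {P : Pred A p} (P? : Decidable P) where

    length-filter-¬ : ∀ xs → length xs ≡ length (filter P? xs) + length (filter (¬? ∘ P?) xs)
    length-filter-¬ [] = ≡.refl
    length-filter-¬ (x ∷ xs) with P? x
    ... | yes _ = cong suc (length-filter-¬ xs)
    ... | no _  = ≡.trans (cong suc (length-filter-¬ xs)) (≡.sym (ℕ.+-suc (length (filter P? xs)) _))

    module _ {q} {Q : Pred A q} (Q? : Decidable Q) where

      length-filter-filter : ∀ xs → length (filter P? (filter Q? xs)) ≤ length (filter P? xs)
      length-filter-filter [] = z≤n
      length-filter-filter (x ∷ xs) with Q? x
      length-filter-filter (x ∷ xs) | no _ with P? x
      ... | yes _ = ℕ.m≤n⇒m≤1+n (length-filter-filter xs)
      ... | no _  = length-filter-filter xs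
      length-filter-filter (x ∷ xs) | yes _ with P? x
      ... | yes _ = s≤s (length-filter-filter xs)
      ... | no _  = length-filter-filter xs

      length-filter-⊎ : ∀ xs → length (filter (λ x → P? x ⊎-dec Q? x) xs) ≤
                               length (filter P? xs) + length (filter Q? xs)
      length-filter-⊎ [] = z≤n
      length-filter-⊎ (x ∷ xs) with P? x | Q? x
      ... | yes _ | yes _ = s≤s (ℕ.≤-trans (length-filter-⊎ xs) (ℕ.+-monoʳ-≤ _ (ℕ.n≤1+n _)))
      ... | yes _ | no _  = s≤s (length-filter-⊎ xs)
      ... | no _  | yes _ = ℕ.≤-trans (s≤s (length-filter-⊎ xs)) (ℕ.≤-reflexive (≡.sym (ℕ.+-suc _ _)))
      ... | no _  | no _  = length-filter-⊎ xs

      length-filter-mono : (∀ {x} → P x → Q x) → ∀ xs → length (filter P? xs) ≤ length (filter Q? xs)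
      length-filter-mono P⇒Q [] = z≤n
      length-filter-mono P⇒Q (x ∷ xs) with P? x | Q? x
      ... | yes _ | yes _ = s≤s (length-filter-mono P⇒Q xs)
      ... | yes p | no ¬q = ⊥-elim (¬q (P⇒Q p))
      ... | no _  | yes _ = ℕ.m≤n⇒m≤1+n (length-filter-mono P⇒Q xs)
      ... | no _  | no _  = length-filter-mono P⇒Q xs

AllPairs⇒lookup-injective : ∀ {a b} {A : Set a} {B : Set b} (f : A → B) {xs : List A} →
  AllPairs (λ x y → f x ≢ f y) xs → Injective _≡_ _≡_ (f ∘ List.lookup xs)
AllPairs⇒lookup-injective f (x≢ ∷ _) {zero} {zero} _ = ≡.refl
AllPairs⇒lookup-injective f (x≢ ∷ _) {zero} {suc j} eq = ⊥-elim (All.lookup x≢ (∈ˡ.∈-lookup j) eq)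
AllPairs⇒lookup-injective f (x≢ ∷ _) {suc i} {zero} eq = ⊥-elim (All.lookup x≢ (∈ˡ.∈-lookup i) (≡.sym eq))
AllPairs⇒lookup-injective f (_ ∷ ps) {suc i} {suc j} eq = cong suc (AllPairs⇒lookup-injective f ps eq)

-- Greedy transversal: every choice of b rules out at most w + w candidates.
select : ∀ {n} (c d : Fin n → Fin n) w → 1 ≤ w → ∀ t (xs : List (Fin n)) →
  (∀ {b} → b ∈ˡ xs → length (filter (λ x → c x Fin.≟ c b) xs) ≤ w) →
  (∀ {b} → b ∈ˡ xs → length (filter (λ x → d x Fin.≟ d b) xs) ≤ w) →
  t * (w + w) ≤ length xs →
  ∃ λ ys → length ys ≡ t × (∀ {b} → b ∈ˡ ys → b ∈ˡ xs) ×
           AllPairs (λ x y → c x ≢ c y × d x ≢ d y) ys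
select c d w 1≤w zero xs _ _ _ = [] , ≡.refl , (λ ()) , []
select c d w 1≤w (suc t) [] _ _ le =
  ⊥-elim (ℕ.<⇒≱ 1≤w (ℕ.≤-trans (ℕ.m≤m+n w w) (ℕ.≤-trans (ℕ.m≤m+n (w + w) _) le)))
select c d w 1≤w (suc t) xs@(b ∷ _) wc wd le
  with select c d w 1≤w t xs′
         (λ b∈ → ℕ.≤-trans (length-filter-filter (λ x → c x Fin.≟ c _) (¬? ∘ conflict?) xs)
           (wc (proj₁ (∈ˡ.∈-filter⁻ (¬? ∘ conflict?) b∈))))
         (λ b∈ → ℕ.≤-trans (length-filter-filter (λ x → d x Fin.≟ d _) (¬? ∘ conflict?) xs)
           (wd (proj₁ (∈ˡ.∈-filter⁻ (¬? ∘ conflict?) b∈))))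
         le′
  where
  conflict? : Decidable (λ x → c x ≡ c b ⊎ d x ≡ d b)
  conflict? x = c x Fin.≟ c b ⊎-dec d x Fin.≟ d b
  xs′ = filter (¬? ∘ conflict?) xs
  le′ : t * (w + w) ≤ length xs′
  le′ = ℕ.+-cancelˡ-≤ (w + w) _ _ (ℕ.≤-trans le (ℕ.≤-trans
    (ℕ.≤-reflexive (length-filter-¬ conflict? xs))
    (ℕ.+-monoˡ-≤ (length xs′) (ℕ.≤-trans (length-filter-⊎ (λ x → c x Fin.≟ c b) (λ x → d x Fin.≟ d b) xs)
      (ℕ.+-mono-≤ (wc (here ≡.refl)) (wd (here ≡.refl)))))))
... | ys , ∣ys∣ , ys⊆ , apart = b ∷ ys , cong suc ∣ys∣ ,
  (λ { (here ≡.refl) → here ≡.refl ; (there y∈) → proj₁ (∈ˡ.∈-filter⁻ (¬? ∘ conflict?) (ys⊆ y∈)) }) ,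
  All.tabulate (λ y∈ → let ¬cf = proj₂ (∈ˡ.∈-filter⁻ (¬? ∘ conflict?) {xs = xs} (ys⊆ y∈)) in
    (λ eq → ¬cf (inj₁ (≡.sym eq))) , (λ eq → ¬cf (inj₂ (≡.sym eq)))) ∷ apart
  where
  conflict? : Decidable (λ x → c x ≡ c b ⊎ d x ≡ d b)
  conflict? x = c x Fin.≟ c b ⊎-dec d x Fin.≟ d b

-- Hitting sets by greedy choice.

module Hitting {X : Set} {n U : ℕ} (0<n : 0 < n)
  (f : X → Fin U → Fin n) (f-inj : ∀ x → Injective _≡_ _≡_ (f x)) where

  Hit : Fin n → X → Set
  Hit v x = ∃ λ j → f x j ≡ v

  hit? : ∀ v → Decidable (Hit v)
  hit? v x = Fin.any? λ j → f x j Fin.≟ v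

  hits : Fin n → List X → ℕ
  hits v xs = length (filter (hit? v) xs)

  hits-∷ : ∀ x xs vs → sum (map (λ v → hits v (x ∷ xs)) vs) ≡
           length (filter (λ v → hit? v x) vs) + sum (map (λ v → hits v xs) vs)
  hits-∷ x xs [] = ≡.refl
  hits-∷ x xs (v ∷ vs) with hit? v x
  ... | yes _ = cong suc (≡.trans (cong (hits v xs +_) (hits-∷ x xs vs))
    (x∙yz≈y∙xz (hits v xs) (length (filter (λ v → hit? v x) vs)) _))
  ... | no _ = ≡.trans (cong (hits v xs +_) (hits-∷ x xs vs))
    (x∙yz≈y∙xz (hits v xs) (length (filter (λ v → hit? v x) vs)) _)

  -- Double counting of the pairs of an `x` and a value that hits it: each `f x` takes `U` distinct
  -- values.
  total-hits : ∀ xs → length xs * U ≤ sum (map (λ v → hits v xs) (allFin n))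
  total-hits [] = z≤n
  total-hits (x ∷ xs) = ℕ.≤-trans
    (ℕ.+-mono-≤
      (injective⇒≤length (f x) (f-inj x) (filter (λ v → hit? v x) (allFin n))
        λ j → ∈ˡ.∈-filter⁺ (λ v → hit? v x) (∈ˡ.∈-allFin (f x j)) (j , ≡.refl))
      (total-hits xs))
    (ℕ.≤-reflexive (≡.sym (hits-∷ x xs (allFin n))))

  HitBy : List (Fin n) → X → Set
  HitBy S x = ∃ λ j → f x j ∈ˡ S

  -- By averaging, some value hits at least a fraction `U / n` of the survivors `ys`. Their bound is
  -- an integer form of `(1 - U / n) ^ k ≤ 1 / (1 + k U / n)`, which suffices to halve them once
  -- `k * U ≥ n`.
  rounds : ∀ k xs → ∃ λ S → length S ≤ k × ∃ λ ys → (∀ {x} → x ∈ˡ xs → HitBy S x ⊎ x ∈ˡ ys) ×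
           length ys * (n + k * U) ≤ length xs * n
  rounds zero xs = [] , z≤n , xs , inj₂ , ℕ.≤-reflexive (cong (length xs *_) (ℕ.+-identityʳ n))
  rounds (suc k) xs with rounds k xs
  ... | S , ∣S∣ , ys , cover , le with average≤max (λ v → hits v ys) (fromℕ< 0<n) (allFin n)
  ... | v , average = v ∷ S , s≤s ∣S∣ , zs , cover′ , ℕ.≤-trans (begin
    r′ * (n + suc k * U)             ≡⟨ solve 4 (λ r n k u → r :* (n :+ (con 1 :+ k) :* u) := r :* n :+ (r :* u :+ r :* (k :* u))) ≡.refl r′ n k U ⟩
    r′ * n + (r′ * U + r′ * (k * U)) ≤⟨ ℕ.+-monoʳ-≤ (r′ * n) (ℕ.+-mono-≤ (ℕ.*-monoˡ-≤ U r′≤r) (ℕ.*-monoˡ-≤ (k * U) r′≤r)) ⟩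
    r′ * n + (r * U + r * (k * U))   ≤⟨ ℕ.+-monoʳ-≤ (r′ * n) (ℕ.+-monoˡ-≤ (r * (k * U)) many) ⟩
    r′ * n + (n * hits v ys + r * (k * U)) ≡⟨ solve 4 (λ r n h w → r :* n :+ (n :* h :+ w) := (h :+ r) :* n :+ w) ≡.refl r′ n (hits v ys) (r * (k * U)) ⟩
    (hits v ys + r′) * n + r * (k * U) ≡⟨ cong (λ s → s * n + r * (k * U)) (length-filter-¬ (hit? v) ys) ⟨
    r * n + r * (k * U)              ≡⟨ ℕ.*-distribˡ-+ r n (k * U) ⟨
    r * (n + k * U)                  ∎) le
    where
    open ℕ.≤-Reasoning
    open +-*-Solver
    zs = filter (¬? ∘ hit? v) ys
    r = length ys
    r′ = length zs
    r′≤r : r′ ≤ r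
    r′≤r = List.length-filter (¬? ∘ hit? v) ys
    many : r * U ≤ n * hits v ys
    many = ℕ.≤-trans (total-hits ys) (subst (λ l → sum (map (λ v → hits v ys) (allFin n)) ≤ l * hits v ys) (List.length-tabulate {n = n} id) average)
    cover′ : ∀ {x} → x ∈ˡ xs → HitBy (v ∷ S) x ⊎ x ∈ˡ zs
    cover′ {x} x∈ with cover x∈
    ... | inj₁ (j , j∈) = inj₁ (j , there j∈)
    ... | inj₂ x∈ys with hit? v x
    ...   | yes (j , eq) = inj₁ (j , here eq)
    ...   | no ¬hit = inj₂ (∈ˡ.∈-filter⁺ (¬? ∘ hit? v) x∈ys ¬hit)

  -- Every block of `D` rounds halves the list, so after `e` blocks fewer than one element remains.
  hittingSet : ∀ D → n ≤ D * U → ∀ e xs → length xs < 2 ^ e →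
               ∃ λ S → length S ≤ e * D × (∀ {x} → x ∈ˡ xs → HitBy S x)
  hittingSet D n≤DU zero [] _ = [] , z≤n , λ ()
  hittingSet D n≤DU zero (_ ∷ _) (s≤s ())
  hittingSet D n≤DU (suc e) xs small with rounds D xs
  ... | S , ∣S∣ , ys , cover , le with hittingSet D n≤DU e ys (ℕ.*-cancelˡ-< 2 _ _ (ℕ.≤-<-trans halved small))
    where
    open ℕ.≤-Reasoning
    open +-*-Solver
    halved : 2 * length ys ≤ length xs
    halved = ℕ.*-cancelʳ-≤ _ _ n {{ℕ.>-nonZero 0<n}} (begin
      2 * length ys * n       ≡⟨ solve 2 (λ y n → con 2 :* y :* n := y :* (n :+ n)) ≡.refl (length ys) n ⟩
      length ys * (n + n)     ≤⟨ ℕ.*-monoʳ-≤ (length ys) (ℕ.+-monoʳ-≤ n n≤DU) ⟩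
      length ys * (n + D * U) ≤⟨ le ⟩
      length xs * n           ∎)
  ... | S′ , ∣S′∣ , cover′ = S ++ S′ ,
    ℕ.≤-trans (ℕ.≤-reflexive (List.length-++ S)) (ℕ.+-mono-≤ ∣S∣ ∣S′∣) ,
    λ x∈ → [ (λ (j , j∈) → j , ∈ˡ.∈-++⁺ˡ j∈)
           , (λ x∈ys → let (j , j∈) = cover′ x∈ys in j , ∈ˡ.∈-++⁺ʳ S j∈) ]′ (cover x∈)

length-cartesianProduct : ∀ {a b} {A : Set a} {B : Set b} (xs : List A) (ys : List B) →
                          length (cartesianProduct xs ys) ≡ length xs * length ys
length-cartesianProduct [] ys = ≡.refl
length-cartesianProduct (x ∷ xs) ys =
  ≡.trans (List.length-++ (map (x ,_) ys)) (cong₂ _+_ (List.length-map (x ,_) ys) (length-cartesianProduct xs ys))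

-- Three rounds of hitting sets, each fixing one of the three coordinates of the index of a triple.
hittingTriples : ∀ {I : Set} {n} → 0 < n → ∀ U D e → n ≤ D * U →
  (is : List I) → (∀ i → i ∈ˡ is) → length is * (U * U) < 2 ^ e → 1 ≤ U →
  (t₁ t₂ t₃ : I → Fin (U * (U * U)) → Fin n) →
  (∀ i → Injective _≡_ _≡_ (t₁ i)) → (∀ i → Injective _≡_ _≡_ (t₂ i)) → (∀ i → Injective _≡_ _≡_ (t₃ i)) →
  ∃ λ S → length S ≤ 3 * (e * D) × ∀ i → ∃ λ j → t₁ i j ∈ˡ S × t₂ i j ∈ˡ S × t₃ i j ∈ˡ S
hittingTriples {I} {n} 0<n U D e n≤DU is complete small 1≤U t₁ t₂ t₃ inj₁′ inj₂′ inj₃′ =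
  S₁ ++ S₂ ++ S₃ , bound ,
  λ i → j i , ∈ˡ.∈-++⁺ˡ (proj₂ (hit₁ (i , j₂ i , j₃ i))) ,
        ∈ˡ.∈-++⁺ʳ S₁ (∈ˡ.∈-++⁺ˡ (proj₂ (hit₂ (i , j₃ i)))) ,
        ∈ˡ.∈-++⁺ʳ S₁ (∈ˡ.∈-++⁺ʳ S₂ (proj₂ (hit₃ i)))
  where
  us = allFin U
  ∣us∣ : length us ≡ U
  ∣us∣ = List.length-tabulate id
  triple : Fin U → Fin U → Fin U → Fin (U * (U * U))
  triple j₁ j₂ j₃ = combine j₁ (combine j₂ j₃)
  triple-inj : ∀ {j₁ j₂ j₃ k₁ k₂ k₃} → triple j₁ j₂ j₃ ≡ triple k₁ k₂ k₃ → j₁ ≡ k₁ × j₂ ≡ k₂ × j₃ ≡ k₃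
  triple-inj {j₁} {j₂} {j₃} {k₁} {k₂} {k₃} eq =
    let (p , r) = Fin.combine-injective j₁ (combine j₂ j₃) k₁ (combine k₂ k₃) eq
    in p , Fin.combine-injective j₂ j₃ k₂ k₃ r

  -- The first coordinate is chosen as a function of the other two, which are still free; hence the
  -- factor `U * U` in the number of instances.
  s₁ : ∃ λ S → length S ≤ e * D × ∀ x → ∃ λ j₁ → t₁ (proj₁ x) (triple j₁ (proj₁ (proj₂ x)) (proj₂ (proj₂ x))) ∈ˡ S
  s₁ with Hitting.hittingSet 0<n (λ (i , j₂ , j₃) j₁ → t₁ i (triple j₁ j₂ j₃))
            (λ (i , _) eq → proj₁ (triple-inj (inj₁′ i eq))) D n≤DU e
            (cartesianProduct is (cartesianProduct us us))
            (subst (_< 2 ^ e) (≡.sym (≡.trans (length-cartesianProduct is (cartesianProduct us us))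
              (cong (length is *_) (≡.trans (length-cartesianProduct us us) (cong₂ _*_ ∣us∣ ∣us∣))))) small)
  ... | S , ∣S∣ , hit = S , ∣S∣ , λ (i , j₂ , j₃) →
    hit (∈ˡ.∈-cartesianProduct⁺ (complete i) (∈ˡ.∈-cartesianProduct⁺ (∈ˡ.∈-allFin j₂) (∈ˡ.∈-allFin j₃)))
  S₁ = proj₁ s₁
  hit₁ = proj₂ (proj₂ s₁)
  j₁ : I → Fin U → Fin U → Fin U
  j₁ i j₂ j₃ = proj₁ (hit₁ (i , j₂ , j₃))

  U≤UU : U ≤ U * U
  U≤UU = ℕ.m≤m*n U U {{ℕ.>-nonZero 1≤U}}

  -- The first coordinate now varies with `j₂`, but the combined index still determines `j₂`, so the
  -- values of `t₂ i` remain distinct.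
  s₂ : ∃ λ S → length S ≤ e * D × ∀ x → ∃ λ j₂ → t₂ (proj₁ x) (triple (j₁ (proj₁ x) j₂ (proj₂ x)) j₂ (proj₂ x)) ∈ˡ S
  s₂ with Hitting.hittingSet 0<n (λ (i , j₃) j₂ → t₂ i (triple (j₁ i j₂ j₃) j₂ j₃))
            (λ (i , _) eq → proj₁ (proj₂ (triple-inj (inj₂′ i eq)))) D n≤DU e (cartesianProduct is us)
            (ℕ.≤-<-trans (ℕ.≤-trans (ℕ.≤-reflexive (≡.trans (length-cartesianProduct is us) (cong (length is *_) ∣us∣)))
              (ℕ.*-monoʳ-≤ (length is) U≤UU)) small)
  ... | S , ∣S∣ , hit = S , ∣S∣ , λ (i , j₃) → hit (∈ˡ.∈-cartesianProduct⁺ (complete i) (∈ˡ.∈-allFin j₃))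
  S₂ = proj₁ s₂
  hit₂ = proj₂ (proj₂ s₂)
  j₂′ : I → Fin U → Fin U
  j₂′ i j₃ = proj₁ (hit₂ (i , j₃))

  s₃ : ∃ λ S → length S ≤ e * D × ∀ i → ∃ λ j₃ → t₃ i (triple (j₁ i (j₂′ i j₃) j₃) (j₂′ i j₃) j₃) ∈ˡ S
  s₃ with Hitting.hittingSet 0<n (λ i j₃ → t₃ i (triple (j₁ i (j₂′ i j₃) j₃) (j₂′ i j₃) j₃))
            (λ i eq → proj₂ (proj₂ (triple-inj (inj₃′ i eq)))) D n≤DU e is
            (ℕ.≤-<-trans (ℕ.m≤m*n (length is) (U * U) {{ℕ.>-nonZero (ℕ.≤-trans 1≤U U≤UU)}}) small)
  ... | S , ∣S∣ , hit = S , ∣S∣ , λ i → hit (complete i)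
  S₃ = proj₁ s₃
  hit₃ = proj₂ (proj₂ s₃)
  j₃ : I → Fin U
  j₃ i = proj₁ (hit₃ i)
  j₂ : I → Fin U
  j₂ i = j₂′ i (j₃ i)
  j : I → Fin (U * (U * U))
  j i = triple (j₁ i (j₂ i) (j₃ i)) (j₂ i) (j₃ i)
  bound : length (S₁ ++ S₂ ++ S₃) ≤ 3 * (e * D)
  bound = ℕ.≤-trans (ℕ.≤-reflexive (≡.trans (List.length-++ S₁) (cong (length S₁ +_) (List.length-++ S₂))))
    (ℕ.+-mono-≤ (proj₁ (proj₂ s₁)) (ℕ.+-mono-≤ (proj₁ (proj₂ s₂))
      (ℕ.≤-trans (proj₁ (proj₂ s₃)) (ℕ.≤-reflexive (≡.sym (ℕ.+-identityʳ (e * D)))))))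

-- Multiples and torsion in finite abelian groups.

module GroupFacts {c ℓ} (G : FiniteAbelianGroup c ℓ) where

  open FiniteAbelianGroup G using (abelianGroup; enumeration; index)
  open AbelianGroup abelianGroup public
    using (Carrier; _≈_; _∙_; ε; setoid; refl; reflexive; sym; trans; ∙-cong; ∙-congˡ; ∙-congʳ; assoc; comm
          ; identityˡ; identityʳ; inverseˡ; inverseʳ; commutativeMonoid; group)
    renaming (_⁻¹ to inv; ⁻¹-cong to inv-cong)
  open GroupProperties group public using (∙-cancelˡ; ∙-cancelʳ; inverseˡ-unique; x∙y⁻¹≈ε⇒x≈y; x≈y⇒x∙y⁻¹≈ε)
  open AbelianGroupProperties abelianGroup public using (⁻¹-∙-comm)
  open Mult commutativeMonoid public using (×-congʳ; ×-congˡ; ×-homo-+; ×-assocˡ; ×-distrib-+) renaming (_×_ to infixr 8 _·_)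
  open Sum commutativeMonoid using (sum-permute; ∑-distrib-+; sum-replicate; sum-cong-≋) renaming (sum to ∑)
  open CommutativeMonoidSolver commutativeMonoid public using (solve; _⊜_; _⊕_)
  open import Relation.Binary.Reasoning.Setoid setoid

  N : ℕ
  N = order G

  element : Fin N → Carrier
  element = Inverse.from enumeration

  element-index : ∀ x → element (index x) ≈ x
  element-index = Inverse.strictlyInverseʳ enumeration

  index-cong : ∀ {x y} → x ≈ y → index x ≡ index y
  index-cong = Inverse.to-cong enumeration

  index-injective : ∀ {x y} → index x ≡ index y → x ≈ y
  index-injective {x} {y} eq = trans (sym (element-index x)) (trans (Inverse.from-cong enumeration eq) (element-index y))

  infix 4 _≈?_
  _≈?_ : ∀ x y → Dec (x ≈ y)
  x ≈? y = map′ index-injective index-cong (index x Fin.≟ index y)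

  cancel : ∀ g x → inv g ∙ (g ∙ x) ≈ x
  cancel g x = trans (sym (assoc (inv g) g x)) (trans (∙-congʳ (inverseˡ g)) (identityˡ x))

  cancel′ : ∀ g x → g ∙ (inv g ∙ x) ≈ x
  cancel′ g x = trans (sym (assoc g (inv g) x)) (trans (∙-congʳ (inverseʳ g)) (identityˡ x))

  -- Translation by `g` permutes the elements of the group, so adding `N · g` to their total does
  -- not change it.
  order·g≈ε : ∀ g → N · g ≈ ε
  order·g≈ε g = sym (∙-cancelʳ (∑ element) ε (N · g) (begin
    ε ∙ ∑ element                        ≈⟨ identityˡ (∑ element) ⟩
    ∑ element                            ≈⟨ sum-permute element π ⟩
    ∑ (λ i → element (index (g ∙ element i))) ≈⟨ sum-cong-≋ (λ i → element-index (g ∙ element i)) ⟩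
    ∑ (λ i → g ∙ element i)              ≈⟨ ∑-distrib-+ {N} (λ _ → g) element ⟩
    ∑ {N} (λ _ → g) ∙ ∑ element          ≈⟨ ∙-congʳ (sum-replicate N) ⟩
    N · g ∙ ∑ element                    ∎))
    where
    shift : ∀ h k → (∀ x → h ∙ (k ∙ x) ≈ x) → ∀ i → index (h ∙ element (index (k ∙ element i))) ≡ i
    shift h k inverse i = ≡.trans (index-cong (trans (∙-congˡ (element-index (k ∙ element i))) (inverse (element i))))
      (Inverse.strictlyInverseˡ enumeration i)
    π = permutation (λ i → index (g ∙ element i)) (λ i → index (inv g ∙ element i))
      (shift g (inv g) (cancel′ g)) (shift (inv g) g (cancel g))

  InjectiveFamily : ∀ {n} → (Fin n → Carrier) → Set ℓ
  InjectiveFamily a = ∀ {i j} → a i ≈ a j → i ≡ j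

  -- For injective `a`, conditions on `c` alone exclude the trivial representations: by
  -- cancellation, `d = x` would force `c = b`, and `d = b` would force `c = x`.
  NoUniqueSumFamily : ∀ {n} → (Fin n → Carrier) → Set ℓ
  NoUniqueSumFamily a = ∀ x b → ∃ λ c → ∃ λ d → a x ∙ a b ≈ a c ∙ a d × c ≢ x × c ≢ b

  -- A prime factor of a common divisor of `l` and `N` would be a prime divisor of `N` below `q`. So
  -- `l` and `N` are coprime, and Bézout expresses `g` through `l · g` and `N · g`, both trivial.
  coprime-torsion-free : ∀ (1<N : 1 < N) l g → 0 < l → l < q G 1<N → l · g ≈ ε → g ≈ ε
  coprime-torsion-free 1<N l g 0<l l<q lg≈ε = bézout (coprime-Bézout coprime)
    where
    q-divides = proj₁ (q-least G 1<N)
    q-minimal = proj₂ (q-least G 1<N)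
    coprime : Coprime l N
    coprime {zero} (0∣l , _) = ⊥-elim (ℕ.<⇒≢ 0<l (≡.sym (ℕ.0∣⇒≡0 0∣l)))
    coprime {suc zero} _ = ≡.refl
    coprime {d@(suc (suc _))} (d∣l , d∣N) with primeDivisor d (s≤s (s≤s z≤n))
    ... | p , p-prime , p∣d = ⊥-elim (ℕ.<⇒≱ l<q (ℕ.≤-trans (q-minimal p (p-prime , ℕ.∣-trans p∣d d∣N))
      (ℕ.≤-trans (ℕ.∣⇒≤ p∣d) (ℕ.∣⇒≤ {{ℕ.>-nonZero 0<l}} d∣l))))
    vanish : ∀ x k → k · g ≈ ε → (x * k) · g ≈ ε
    vanish x k kg≈ε = trans (sym (×-assocˡ g x k)) (trans (×-congʳ x kg≈ε) (ε-mult x))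
      where
      ε-mult : ∀ x → x · ε ≈ ε
      ε-mult zero = refl
      ε-mult (suc x) = trans (identityˡ _) (ε-mult x)
    combine-Bézout : ∀ {a b} → a · g ≈ ε → b · g ≈ ε → 1 + b ≡ a → g ≈ ε
    combine-Bézout {a} {b} ag≈ε bg≈ε eq = begin
      g           ≈⟨ identityʳ g ⟨
      g ∙ ε       ≈⟨ ∙-congˡ bg≈ε ⟨
      (1 + b) · g ≈⟨ ×-congˡ eq ⟩
      a · g       ≈⟨ ag≈ε ⟩
      ε           ∎
    bézout : Bézout.Identity 1 l N → g ≈ ε
    bézout (Bézout.+- x y eq) = combine-Bézout (vanish x l lg≈ε) (vanish y N (order·g≈ε g)) eq
    bézout (Bézout.-+ x y eq) = combine-Bézout (vanish y N (order·g≈ε g)) (vanish x l lg≈ε) eq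

-- Characters and their extension to larger subgroups.

-- A character of a subgroup of G with values in ℤ / modulus, given by its graph:
-- Value g z says that g lies in the domain and is sent to the class of z.
record Character {c ℓ} (G : FiniteAbelianGroup c ℓ) : Set (lsuc (c ⊔ ℓ)) where
  open GroupFacts G
  field
    modulus    : ℕ
    modulus≢0  : 0 < modulus
    Value      : Carrier → ℤ → Set (c ⊔ ℓ)
    value-resp : ∀ {g h z} → g ≈ h → Value g z → Value h z
    value-ε    : Value ε 0ℤ
    value-∙    : ∀ {g h z w} → Value g z → Value h w → Value (g ∙ h) (z ℤ.+ w)
    value-inv  : ∀ {g z} → Value g z → Value (inv g) (ℤ.- z)
    -- Two values of the same `g` differ by a value of `ε`, so this makes the value unique modulo
    -- `modulus`.
    value-zero : ∀ {z} → Value ε z → pos modulus ℤ.∣ z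
    domain?    : ∀ g → Dec (∃ λ z → Value g z)

  value-· : ∀ k {g z} → Value g z → Value (k · g) (pos k ℤ.* z)
  value-· zero    v = value-ε
  value-· (suc k) {g} {z} v = subst (Value (suc k · g)) (≡.sym (ℤ.suc-* (pos k) z)) (value-∙ v (value-· k v))

-- If e is least with e · g in the domain of χ, then χ extends to g, once all its values are multiplied by e.
module Extension {c ℓ} (G : FiniteAbelianGroup c ℓ) (χ : Character G) (g : FiniteAbelianGroup.Carrier G)
  (e′ : ℕ) (w₀ : ℤ) (Value-eg : Character.Value χ (GroupFacts._·_ G (suc e′) g) w₀)
  (e-least : ∀ k → (∃ λ z → Character.Value χ (GroupFacts._·_ G (suc k) g) z) → e′ ≤ k) where

  open GroupFacts G
  open Character χ
  open import Relation.Binary.Reasoning.Setoid setoid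

  e : ℕ
  e = suc e′

  -- An element `x = h + (i - j) g` gets the value `e w + (i - j) w₀`: on the old domain `e` times
  -- the old value, on `g` the old value of `e · g`. The two natural numbers `i` and `j` encode one
  -- integer multiple of `g`.
  Value′ : Carrier → ℤ → Set (c ⊔ ℓ)
  Value′ x z = ∃ λ h → ∃ λ w → ∃ λ i → ∃ λ j →
    Value h w × x ∙ j · g ≈ h ∙ i · g × z ℤ.+ pos j ℤ.* w₀ ≡ pos e ℤ.* w ℤ.+ pos i ℤ.* w₀

  private
    open Data.Integer.Solver.+-*-Solver renaming (solve to solveℤ)

    -- Otherwise `k · g`, being the inverse of `h`, would lie in the domain of `χ` with `0 < k < e`,
    -- against the minimality of `e`.
    remainder≡0 : ∀ {k h w} → k < e → Value h w → h ∙ k · g ≈ ε → k ≡ 0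
    remainder≡0 {zero} _ _ _ = ≡.refl
    remainder≡0 {suc k} (s≤s k<e′) v eq = ⊥-elim (ℕ.<⇒≱ k<e′ (e-least k (_ ,
      value-resp (sym (inverseˡ-unique _ _ (trans (comm _ _) eq))) (value-inv v))))

    -- The extension is well defined: write `i = r + u * e`. Minimality forces `r = 0`, so
    -- `w + u w₀` is an old value of `ε`, thus a multiple of the old modulus; then multiply by `e`.
    kernel : ∀ {h w} i → Value h w → h ∙ i · g ≈ ε → pos (e * modulus) ℤ.∣ pos e ℤ.* w ℤ.+ pos i ℤ.* w₀
    kernel {h} {w} i v eq with i divMod e
    ... | result u r i≡ = subst₂ ℤ._∣_ (≡.sym (ℤ.pos-* e modulus)) rhs
            (ℤ.*-monoʳ-∣ (pos e) (value-zero (value-resp hu≈ε vu)))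
      where
      vu : Value (h ∙ u · e · g) (w ℤ.+ pos u ℤ.* w₀)
      vu = value-∙ v (value-· u Value-eg)
      eq′ : (h ∙ u · e · g) ∙ toℕ r · g ≈ ε
      eq′ = begin
        (h ∙ u · e · g) ∙ toℕ r · g ≈⟨ solve 3 (λ a b c → (a ⊕ b) ⊕ c ⊜ a ⊕ (c ⊕ b)) refl h (u · e · g) (toℕ r · g) ⟩
        h ∙ (toℕ r · g ∙ u · e · g) ≈⟨ ∙-congˡ (∙-congˡ (×-assocˡ g u e)) ⟩
        h ∙ (toℕ r · g ∙ (u * e) · g) ≈⟨ ∙-congˡ (×-homo-+ g (toℕ r) (u * e)) ⟨
        h ∙ (toℕ r + u * e) · g     ≈⟨ ∙-congˡ (×-congˡ i≡) ⟨
        h ∙ i · g                   ≈⟨ eq ⟩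
        ε                           ∎
      r≡0 : toℕ r ≡ 0
      r≡0 = remainder≡0 (Fin.toℕ<n r) vu eq′
      hu≈ε : h ∙ u · e · g ≈ ε
      hu≈ε = trans (sym (identityʳ _)) (trans (∙-congˡ (×-congˡ (≡.sym r≡0))) eq′)
      rhs : pos e ℤ.* (w ℤ.+ pos u ℤ.* w₀) ≡ pos e ℤ.* w ℤ.+ pos i ℤ.* w₀
      rhs = ≡.trans (solveℤ 4 (λ e w u w₀ → e :* (w :+ u :* w₀) := e :* w :+ (u :* e) :* w₀) ≡.refl (pos e) w (pos u) w₀)
        (cong (λ s → pos e ℤ.* w ℤ.+ s ℤ.* w₀) (≡.trans (≡.sym (ℤ.pos-* u e))
          (cong pos (≡.sym (≡.trans i≡ (cong (_+ u * e) r≡0))))))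

    value-zero′ : ∀ {z} → Value′ ε z → pos (e * modulus) ℤ.∣ z
    value-zero′ {z} (h , w , i , j , v , eq , zw) with ℕ.≤-total j i
    ... | inj₁ j≤i = subst (pos (e * modulus) ℤ.∣_) z≡ (kernel (i ℕ.∸ j) v (∙-cancelʳ (j · g) _ _ (begin
      (h ∙ (i ℕ.∸ j) · g) ∙ j · g ≈⟨ assoc h _ _ ⟩
      h ∙ ((i ℕ.∸ j) · g ∙ j · g) ≈⟨ ∙-congˡ (×-homo-+ g (i ℕ.∸ j) j) ⟨
      h ∙ (i ℕ.∸ j + j) · g       ≈⟨ ∙-congˡ (×-congˡ (ℕ.m∸n+n≡m j≤i)) ⟩
      h ∙ i · g                   ≈⟨ eq ⟨
      ε ∙ j · g                   ∎)))
      where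
      z≡ : pos e ℤ.* w ℤ.+ pos (i ℕ.∸ j) ℤ.* w₀ ≡ z
      z≡ = +ᶻ-cancelʳ (pos j ℤ.* w₀) _ _ (≡.trans
        (solveℤ 5 (λ e w k j w₀ → e :* w :+ k :* w₀ :+ j :* w₀ := e :* w :+ (k :+ j) :* w₀) ≡.refl (pos e) w (pos (i ℕ.∸ j)) (pos j) w₀)
        (≡.trans (cong (λ s → pos e ℤ.* w ℤ.+ s ℤ.* w₀) (≡.trans (≡.sym (ℤ.pos-+ (i ℕ.∸ j) j)) (cong pos (ℕ.m∸n+n≡m j≤i)))) (≡.sym zw)))
    -- Here `i - j` is not positive, so `kernel` is applied to the inverse of `h` and the sign is
    -- changed back.
    ... | inj₂ i≤j = subst (pos (e * modulus) ℤ.∣_) z≡ (ℤ.∣m⇒∣-m (kernel (j ℕ.∸ i) (value-inv v) (begin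
      inv h ∙ (j ℕ.∸ i) · g ≈⟨ ∙-congˡ eq′ ⟩
      inv h ∙ h             ≈⟨ inverseˡ h ⟩
      ε                     ∎)))
      where
      eq′ : (j ℕ.∸ i) · g ≈ h
      eq′ = ∙-cancelʳ (i · g) _ _ (begin
        (j ℕ.∸ i) · g ∙ i · g ≈⟨ ×-homo-+ g (j ℕ.∸ i) i ⟨
        (j ℕ.∸ i + i) · g     ≈⟨ ×-congˡ (ℕ.m∸n+n≡m i≤j) ⟩
        j · g                 ≈⟨ identityˡ _ ⟨
        ε ∙ j · g             ≈⟨ eq ⟩
        h ∙ i · g             ∎)
      z≡ : ℤ.- (pos e ℤ.* ℤ.- w ℤ.+ pos (j ℕ.∸ i) ℤ.* w₀) ≡ z
      z≡ = +ᶻ-cancelʳ (pos j ℤ.* w₀) _ _ (≡.trans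
        (cong (λ s → ℤ.- (pos e ℤ.* ℤ.- w ℤ.+ pos (j ℕ.∸ i) ℤ.* w₀) ℤ.+ s ℤ.* w₀)
          (≡.trans (cong pos (≡.sym (ℕ.m∸n+n≡m i≤j))) (ℤ.pos-+ (j ℕ.∸ i) i)))
        (≡.trans (solveℤ 5 (λ e w k i w₀ → :- (e :* :- w :+ k :* w₀) :+ (k :+ i) :* w₀ := e :* w :+ i :* w₀) ≡.refl
          (pos e) w (pos (j ℕ.∸ i)) (pos i) w₀) (≡.sym zw)))

    value-∙′ : ∀ {x y z t} → Value′ x z → Value′ y t → Value′ (x ∙ y) (z ℤ.+ t)
    value-∙′ {x} {y} {z} {t} (h , w , i , j , v , eq , zw) (h′ , w′ , i′ , j′ , v′ , eq′ , zw′) =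
      h ∙ h′ , w ℤ.+ w′ , i + i′ , j + j′ , value-∙ v v′ , (begin
        (x ∙ y) ∙ (j + j′) · g       ≈⟨ ∙-congˡ (×-homo-+ g j j′) ⟩
        (x ∙ y) ∙ (j · g ∙ j′ · g)   ≈⟨ swap4 x y _ _ ⟩
        (x ∙ j · g) ∙ (y ∙ j′ · g)   ≈⟨ ∙-cong eq eq′ ⟩
        (h ∙ i · g) ∙ (h′ ∙ i′ · g)  ≈⟨ swap4 h _ h′ _ ⟩
        (h ∙ h′) ∙ (i · g ∙ i′ · g)  ≈⟨ ∙-congˡ (×-homo-+ g i i′) ⟨
        (h ∙ h′) ∙ (i + i′) · g      ∎) ,
      ≡.trans (cong (λ s → z ℤ.+ t ℤ.+ s ℤ.* w₀) (ℤ.pos-+ j j′))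
        (≡.trans (solveℤ 5 (λ z t j j′ w₀ → z :+ t :+ (j :+ j′) :* w₀ := (z :+ j :* w₀) :+ (t :+ j′ :* w₀)) ≡.refl z t (pos j) (pos j′) w₀)
        (≡.trans (cong₂ ℤ._+_ zw zw′)
        (≡.trans (solveℤ 6 (λ e w w′ i i′ w₀ → (e :* w :+ i :* w₀) :+ (e :* w′ :+ i′ :* w₀) := e :* (w :+ w′) :+ (i :+ i′) :* w₀) ≡.refl
          (pos e) w w′ (pos i) (pos i′) w₀)
        (cong (λ s → pos e ℤ.* (w ℤ.+ w′) ℤ.+ s ℤ.* w₀) (≡.sym (ℤ.pos-+ i i′))))))
      where
      swap4 : ∀ a b c d → (a ∙ b) ∙ (c ∙ d) ≈ (a ∙ c) ∙ (b ∙ d)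
      swap4 = solve 4 (λ a b c d → (a ⊕ b) ⊕ (c ⊕ d) ⊜ (a ⊕ c) ⊕ (b ⊕ d)) refl

    value-inv′ : ∀ {x z} → Value′ x z → Value′ (inv x) (ℤ.- z)
    value-inv′ {x} {z} (h , w , i , j , v , eq , zw) =
      inv h , ℤ.- w , j , i , value-inv v , ∙-cancelʳ (x ∙ h) _ _ (begin
        (inv x ∙ i · g) ∙ (x ∙ h)   ≈⟨ solve 4 (λ a b c d → (a ⊕ b) ⊕ (c ⊕ d) ⊜ a ⊕ (c ⊕ (d ⊕ b))) refl (inv x) (i · g) x h ⟩
        inv x ∙ (x ∙ (h ∙ i · g))   ≈⟨ cancel x _ ⟩
        h ∙ i · g                   ≈⟨ eq ⟨
        x ∙ j · g                   ≈⟨ cancel h _ ⟨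
        inv h ∙ (h ∙ (x ∙ j · g))   ≈⟨ solve 4 (λ a b c d → a ⊕ (d ⊕ (c ⊕ b)) ⊜ (a ⊕ b) ⊕ (c ⊕ d)) refl (inv h) (j · g) x h ⟩
        (inv h ∙ j · g) ∙ (x ∙ h)   ∎) ,
      ≡.trans (solveℤ 4 (λ z i j w₀ → :- z :+ i :* w₀ := :- (z :+ j :* w₀) :+ (i :+ j) :* w₀) ≡.refl z (pos i) (pos j) w₀)
        (≡.trans (cong (λ s → ℤ.- s ℤ.+ (pos i ℤ.+ pos j) ℤ.* w₀) zw)
          (solveℤ 5 (λ e w i j w₀ → :- (e :* w :+ i :* w₀) :+ (i :+ j) :* w₀ := e :* :- w :+ j :* w₀) ≡.refl (pos e) w (pos i) (pos j) w₀))

    domain?′ : ∀ x → Dec (∃ λ z → Value′ x z)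
    domain?′ x = map′ to from (Fin.any? {e} λ r → domain? (x ∙ toℕ r · g))
      where
      to : (∃ λ (r : Fin e) → ∃ λ w → Value (x ∙ toℕ r · g) w) → ∃ λ z → Value′ x z
      to (r , w , v) = pos e ℤ.* w ℤ.- pos (toℕ r) ℤ.* w₀ , _ , w , 0 , toℕ r , v , sym (identityʳ _) ,
        solveℤ 3 (λ a b w₀ → a :- b :+ b := a :+ con 0ℤ :* w₀) ≡.refl (pos e ℤ.* w) (pos (toℕ r) ℤ.* w₀) w₀
      from : (∃ λ z → Value′ x z) → ∃ λ (r : Fin e) → ∃ λ w → Value (x ∙ toℕ r · g) w
      -- Adding `(e′ * i) · g` to both sides turns the right side into `h ∙ i · e · g`, which lies
      -- in the old domain. Hence so does `x ∙ (j + e′ * i) · g`, and only the residue of the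
      -- multiplier modulo `e` matters.
      from (z , h , w , i , j , v , eq , _) with (j + e′ * i) divMod e
      ... | result u r k≡ = r , _ , value-resp (∙-cancelʳ (u · e · g) _ _ (begin
        (h ∙ (i · e · g ∙ inv (u · e · g))) ∙ u · e · g  ≈⟨ solve 4 (λ a b c d → (a ⊕ (b ⊕ c)) ⊕ d ⊜ c ⊕ (d ⊕ (a ⊕ b))) refl h (i · e · g) (inv (u · e · g)) (u · e · g) ⟩
        inv (u · e · g) ∙ (u · e · g ∙ (h ∙ i · e · g)) ≈⟨ cancel _ _ ⟩
        h ∙ i · e · g              ≈⟨ ∙-congˡ (×-assocˡ g i e) ⟩
        h ∙ (i * e) · g            ≈⟨ ∙-congˡ (×-congˡ (≡.trans (ℕ.*-suc i e′) (cong (i +_) (ℕ.*-comm i e′)))) ⟩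
        h ∙ (i + e′ * i) · g       ≈⟨ ∙-congˡ (×-homo-+ g i (e′ * i)) ⟩
        h ∙ (i · g ∙ (e′ * i) · g) ≈⟨ assoc h _ _ ⟨
        (h ∙ i · g) ∙ (e′ * i) · g ≈⟨ ∙-congʳ eq ⟨
        (x ∙ j · g) ∙ (e′ * i) · g ≈⟨ assoc x _ _ ⟩
        x ∙ (j · g ∙ (e′ * i) · g) ≈⟨ ∙-congˡ (×-homo-+ g j (e′ * i)) ⟨
        x ∙ (j + e′ * i) · g       ≈⟨ ∙-congˡ (×-congˡ k≡) ⟩
        x ∙ (toℕ r + u * e) · g    ≈⟨ ∙-congˡ (×-homo-+ g (toℕ r) (u * e)) ⟩
        x ∙ (toℕ r · g ∙ (u * e) · g) ≈⟨ assoc x _ _ ⟨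
        (x ∙ toℕ r · g) ∙ (u * e) · g ≈⟨ ∙-congˡ (×-assocˡ g u e) ⟨
        (x ∙ toℕ r · g) ∙ u · e · g ∎))
        (value-∙ v (value-∙ (value-· i Value-eg) (value-inv (value-· u Value-eg))))

  extended : Character G
  extended = record
    { modulus    = e * modulus
    ; modulus≢0  = ℕ.*-mono-≤ (s≤s (z≤n {e′})) modulus≢0
    ; Value      = Value′
    ; value-resp = λ x≈y (h , w , i , j , v , eq , zw) → h , w , i , j , v , trans (∙-congʳ (sym x≈y)) eq , zw
    ; value-ε    = ε , 0ℤ , 0 , 0 , value-ε , refl ,
        solveℤ 2 (λ e w₀ → con 0ℤ :+ con 0ℤ :* w₀ := e :* con 0ℤ :+ con 0ℤ :* w₀) ≡.refl (pos e) w₀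
    ; value-∙    = λ {_} {_} {z} {t} → value-∙′ {z = z} {t}
    ; value-inv  = λ {_} {z} → value-inv′ {z = z}
    ; value-zero = value-zero′
    ; domain?    = domain?′
    }

  value⇒value′ : ∀ {x z} → Value x z → Value′ x (pos e ℤ.* z)
  value⇒value′ {x} {z} v = x , z , 0 , 0 , v , refl , ≡.refl

  value′-g : Value′ g w₀
  value′-g = ε , 0ℤ , 1 , 0 , value-ε , trans (identityʳ g) (sym (trans (identityˡ _) (identityʳ g))) ,
    solveℤ 2 (λ e w₀ → w₀ :+ con 0ℤ :* w₀ := e :* con 0ℤ :+ con (pos 1) :* w₀) ≡.refl (pos e) w₀

-- Integers in a common box.

∣a-b∣≡a∸b : ∀ {a b} → b ≤ a → ℤ.∣ pos a ℤ.- pos b ∣ ≡ a ℕ.∸ b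
∣a-b∣≡a∸b {a} {b} b≤a = cong ℤ.∣_∣ (≡.trans (ℤ.m-n≡m⊖n a b) (ℤ.⊖-≥ b≤a))

-- Equal quotients put `a * B` and `b * B` into the same interval of length `M`.
same-box-ordered : ∀ {M} B a b .{{_ : ℕ.NonZero M}} → b ≤ a → a * B / M ≡ b * B / M →
                   B * ℤ.∣ pos a ℤ.- pos b ∣ < M
same-box-ordered {M} B a b b≤a eq = ℕ.≤-<-trans (ℕ.+-cancelʳ-≤ (b * B / M * M) _ _ (begin
  B * ℤ.∣ pos a ℤ.- pos b ∣ + b * B / M * M
    ≤⟨ ℕ.+-monoʳ-≤ _ (ℕ.≤-trans (ℕ.m≤n+m _ (b * B % M)) (ℕ.≤-reflexive (≡.sym (m≡m%n+[m/n]*n (b * B) M)))) ⟩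
  B * ℤ.∣ pos a ℤ.- pos b ∣ + b * B         ≡⟨ cong (λ d → B * d + b * B) (∣a-b∣≡a∸b b≤a) ⟩
  B * (a ℕ.∸ b) + b * B                     ≡⟨ cong (_+ b * B) (ℕ.*-comm B _) ⟩
  (a ℕ.∸ b) * B + b * B                     ≡⟨ ℕ.*-distribʳ-+ B (a ℕ.∸ b) b ⟨
  (a ℕ.∸ b + b) * B                         ≡⟨ cong (_* B) (ℕ.m∸n+n≡m b≤a) ⟩
  a * B                                     ≡⟨ m≡m%n+[m/n]*n (a * B) M ⟩
  a * B % M + a * B / M * M                 ≡⟨ cong (λ d → a * B % M + d * M) eq ⟩
  a * B % M + b * B / M * M                 ∎)) (m%n<n (a * B) M)
  where open ℕ.≤-Reasoning

same-box : ∀ {M} B a b .{{_ : ℕ.NonZero M}} → a * B / M ≡ b * B / M → B * ℤ.∣ pos a ℤ.- pos b ∣ < M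
same-box {M} B a b eq with ℕ.≤-total b a
... | inj₁ b≤a = same-box-ordered B a b b≤a eq
... | inj₂ a≤b = subst (λ d → B * d < M) (ℤ.∣i-j∣≡∣j-i∣ (pos b) (pos a)) (same-box-ordered B b a a≤b (≡.sym eq))

-- Characters of the whole group, their dilations, and signed sums of seeds.

module Spanning {c ℓ} (G : FiniteAbelianGroup c ℓ) where

  open GroupFacts G

  -- Injectivity of `χ` on the multiples of `g₀`. Multiplied by any `l` with `0 < l < q`, such a `χ`
  -- still does not kill a nontrivial `g₀`.
  Faithful : Carrier → Character G → Set (c ⊔ ℓ)
  Faithful g₀ χ = ∃ λ z → Value g₀ z × (∀ l → pos modulus ℤ.∣ pos l ℤ.* z → l · g₀ ≈ ε)
    where open Character χ

  -- The search ends because `N · g = ε` lies in every domain; it runs over predecessors to leave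
  -- out the multiple 0.
  leastMultiple : (χ : Character G) (g : Carrier) →
    ∃ (Least λ k → ∃ λ z → Character.Value χ (suc k · g) z)
  leastMultiple χ g = least (λ k → domain? (suc k · g)) (ℕ.pred N , 0ℤ ,
    value-resp (sym (trans (×-congˡ suc-pred-N) (order·g≈ε g))) value-ε)
    where
    open Character χ
    suc-pred-N : suc (ℕ.pred N) ≡ N
    suc-pred-N = ℕ.suc-pred N {{Fin.nonZeroIndex (FiniteAbelianGroup.index G g)}}

  trivialCharacter : Character G
  trivialCharacter = record
    { modulus    = 1
    ; modulus≢0  = s≤s z≤n
    ; Value      = λ g _ → Lift c (g ≈ ε)
    ; value-resp = λ g≈h (lift g≈ε) → lift (trans (sym g≈h) g≈ε)
    ; value-ε    = lift refl
    ; value-∙    = λ (lift g≈ε) (lift h≈ε) → lift (trans (∙-cong g≈ε h≈ε) (identityˡ ε))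
    ; value-inv  = λ (lift g≈ε) → lift (trans (inv-cong g≈ε) (trans (sym (identityˡ _)) (inverseʳ ε)))
    ; value-zero = λ {z} _ → ℤ.divides z (≡.sym (ℤ.*-identityʳ z))
    ; domain?    = λ g → map′ (λ g≈ε → 0ℤ , lift g≈ε) (λ (_ , lift g≈ε) → g≈ε) (g ≈? ε)
    }

  -- In `trivialCharacter` every integer is a value of `ε`, so `w₀ = 1` is admissible: the extension
  -- sends `g₀` to 1 modulo its order.
  cyclicCharacter : ∀ g₀ → ∃ (Faithful g₀)
  cyclicCharacter g₀ with leastMultiple trivialCharacter g₀
  ... | k , (_ , lift kg≈ε) , k-least = extended , pos 1 , value′-g , faithful
    where
    open Extension G trivialCharacter g₀ k (pos 1) (lift kg≈ε) k-least
    ·-ε : ∀ l → l · ε ≈ ε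
    ·-ε zero = refl
    ·-ε (suc l) = trans (identityˡ _) (·-ε l)
    faithful : ∀ l → pos (suc k * 1) ℤ.∣ pos l ℤ.* pos 1 → l · g₀ ≈ ε
    faithful l k∣l with subst₂ ℕ._∣_ (ℕ.*-identityʳ (suc k)) (cong ℤ.∣_∣ (ℤ.*-identityʳ (pos l))) (ℤ.∣⇒∣ᵤ k∣l)
    ... | ℕ.divides r l≡ = trans (×-congˡ l≡) (trans (sym (×-assocˡ g₀ r (suc k)))
      (trans (×-congʳ r kg≈ε) (·-ε r)))

  -- Each adjunction multiplies the modulus and the value of `g₀` by the same factor, which
  -- preserves faithfulness.
  extendTo : ∀ {g₀} (xs : List Carrier) → ∃ λ χ → Faithful g₀ χ × (∀ {x} → x ∈ˡ xs → ∃ (Character.Value χ x))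
  extendTo {g₀} [] = let (χ , χ-faithful) = cyclicCharacter g₀ in χ , χ-faithful , λ ()
  extendTo {g₀} (x ∷ xs) with extendTo {g₀} xs
  ... | χ , (z₀ , v₀ , faithful) , domain with leastMultiple χ x
  ...   | k , (w , v) , k-least = extended , (_ , value⇒value′ v₀ , faithful′) ,
    λ { (here ≡.refl) → w , value′-g ; (there y∈) → pos (suc k) ℤ.* proj₁ (domain y∈) , value⇒value′ (proj₂ (domain y∈)) }
    where
    open Character χ using (modulus)
    open Extension G χ x k w v k-least
    open Data.Integer.Solver.+-*-Solver renaming (solve to solveℤ)
    faithful′ : ∀ l → pos (suc k * modulus) ℤ.∣ pos l ℤ.* (pos (suc k) ℤ.* z₀) → l · g₀ ≈ ε
    faithful′ l div = faithful l (ℤ.*-cancelˡ-∣ (pos (suc k)) (subst₂ ℤ._∣_ (ℤ.pos-* (suc k) modulus)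
      (solveℤ 3 (λ l k z → l :* (k :* z) := k :* (l :* z)) ≡.refl (pos l) (pos (suc k)) z₀) div))

  totalCharacter : ∀ g₀ → ∃ λ χ → Faithful g₀ χ × (∀ x → ∃ (Character.Value χ x))
  totalCharacter g₀ with extendTo {g₀} (map element (allFin N))
  ... | χ , χ-faithful , domain = χ , χ-faithful , λ x →
    let (z , v) = domain (∈ˡ.∈-map⁺ element (∈ˡ.∈-allFin (FiniteAbelianGroup.index G x)))
    in z , Character.value-resp χ (element-index x) v

  -- A multiple of a character under which the seeds σ i are small, while g₀ is not in the kernel.
  record Dilation {k} (σ : Fin k → Carrier) (B : ℕ) (g₀ : Carrier) : Set (lsuc (c ⊔ ℓ)) where
    field
      modulus    : ℕ
      modulus≢0  : 0 < modulus
      Value      : Carrier → ℤ → Set (c ⊔ ℓ)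
      value-resp : ∀ {g h z} → g ≈ h → Value g z → Value h z
      value-ε    : Value ε 0ℤ
      value-∙    : ∀ {g h z w} → Value g z → Value h w → Value (g ∙ h) (z ℤ.+ w)
      value-inv  : ∀ {g z} → Value g z → Value (inv g) (ℤ.- z)
      value-zero : ∀ {z} → Value ε z → pos modulus ℤ.∣ z
      seed-small : ∀ i → ∃ λ z → Value (σ i) z × B * ℤ.∣ z ∣ < modulus
      nonzero    : ¬ Value g₀ 0ℤ


  -- Dirichlet's simultaneous approximation. The residues are cut into `B` boxes; as `B ^ k < q`,
  -- two of the `q` multiples of a faithful character share the box at every seed. Their difference
  -- is the multiple by some `l` with `0 < l < q`, so it does not kill `g₀`.
  dilation : ∀ (1<N : 1 < N) {k} (σ : Fin k → Carrier) B → 0 < B → B ^ k < q G 1<N → ∀ g₀ → ¬ g₀ ≈ ε →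
             Dilation σ B g₀
  dilation 1<N {k} σ B 0<B Bᵏ<q g₀ g₀≉ε with totalCharacter g₀
  ... | χ , (z₀ , v₀ , faithful) , total = fromCollision (Fin.pigeonhole Bᵏ<q (funToFin ∘ box))
    where
    open Character χ
    open Data.Integer.Solver.+-*-Solver renaming (solve to solveℤ)
    instance
      modulus-nonZero : ℕ.NonZero modulus
      modulus-nonZero = ℕ.>-nonZero modulus≢0

    t : Fin k → ℤ
    t i = proj₁ (total (σ i))
    residue : Fin (q G 1<N) → Fin k → ℕ
    residue l i = (pos (toℕ l) ℤ.* t i) %ℕ modulus
    box<B : ∀ l i → residue l i * B / modulus < B
    box<B l i = m<n*o⇒m/o<n (ℕ.<-≤-trans (ℕ.*-monoˡ-< B {{ℕ.>-nonZero 0<B}} (n%ℕd<d (pos (toℕ l) ℤ.* t i) modulus))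
      (ℕ.≤-reflexive (ℕ.*-comm modulus B)))
    box : Fin (q G 1<N) → Fin k → Fin B
    box l i = fromℕ< (box<B l i)

    fromCollision : (∃ λ l₁ → ∃ λ l₂ → toℕ l₁ < toℕ l₂ × funToFin (box l₁) ≡ funToFin (box l₂)) → Dilation σ B g₀
    fromCollision (l₁ , l₂ , l₁<l₂ , eq) = record
      { modulus    = modulus
      ; modulus≢0  = modulus≢0
      ; Value      = λ g z → ∃ λ w → Value g w × pos modulus ℤ.∣ z ℤ.- l ℤ.* w
      ; value-resp = λ g≈h (w , v , div) → w , value-resp g≈h v , div
      ; value-ε    = 0ℤ , value-ε , subst (pos modulus ℤ.∣_)
          (solveℤ 1 (λ l → con 0ℤ := con 0ℤ :- l :* con 0ℤ) ≡.refl l) (ℤ.divides 0ℤ ≡.refl)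
      ; value-∙    = λ {_} {_} {z} {z′} (w , v , div) (w′ , v′ , div′) → w ℤ.+ w′ , value-∙ v v′ ,
          subst (pos modulus ℤ.∣_) (solveℤ 5 (λ z z′ w w′ l → (z :- l :* w) :+ (z′ :- l :* w′) := (z :+ z′) :- l :* (w :+ w′))
            ≡.refl z z′ w w′ l) (ℤ.∣m∣n⇒∣m+n div div′)
      ; value-inv  = λ {_} {z} (w , v , div) → ℤ.- w , value-inv v ,
          subst (pos modulus ℤ.∣_) (solveℤ 3 (λ z w l → :- (z :- l :* w) := :- z :- l :* :- w) ≡.refl z w l) (ℤ.∣m⇒∣-m div)
      ; value-zero = λ {z} (w , v , div) →
          subst (pos modulus ℤ.∣_) (solveℤ 2 (λ z u → z :- u :+ u := z) ≡.refl z (l ℤ.* w))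
            (ℤ.∣m∣n⇒∣m+n div (ℤ.∣n⇒∣m*n l (value-zero v)))
      ; seed-small = λ i → pos (residue l₂ i) ℤ.- pos (residue l₁ i) , (t i , proj₂ (total (σ i)) , seed-divides i) ,
          same-box B (residue l₂ i) (residue l₁ i) (box≡ i)
      ; nonzero    = λ (w , v , div) → g₀≉ε (coprime-torsion-free 1<N (toℕ l₂ ℕ.∸ toℕ l₁) g₀
          (ℕ.m<n⇒0<n∸m l₁<l₂) (ℕ.≤-<-trans (ℕ.m∸n≤m (toℕ l₂) (toℕ l₁)) (Fin.toℕ<n l₂))
          (faithful (toℕ l₂ ℕ.∸ toℕ l₁) (subst (pos modulus ℤ.∣_)
            (solveℤ 3 (λ z₀ w l → l :* (z₀ :- w) :- (con 0ℤ :- l :* w) := l :* z₀) ≡.refl z₀ w l)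
            (ℤ.∣m∣n⇒∣m-n (ℤ.∣n⇒∣m*n l (value-zero (value-resp (inverseʳ g₀) (value-∙ v₀ (value-inv v))))) div))))
      }
      where
      l : ℤ
      l = pos (toℕ l₂ ℕ.∸ toℕ l₁)
      l≡ : l ≡ pos (toℕ l₂) ℤ.- pos (toℕ l₁)
      l≡ = ≡.sym (≡.trans (ℤ.m-n≡m⊖n (toℕ l₂) (toℕ l₁)) (ℤ.⊖-≥ (ℕ.<⇒≤ l₁<l₂)))
      box≡ : ∀ i → residue l₂ i * B / modulus ≡ residue l₁ i * B / modulus
      box≡ i = Fin.fromℕ<-injective _ _ (box<B l₂ i) (box<B l₁ i) (≡.trans (≡.sym (Fin.finToFun-funToFin (box l₂) i))
        (≡.trans (cong (λ f → finToFun f i) (≡.sym eq)) (Fin.finToFun-funToFin (box l₁) i)))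
      seed-divides : ∀ i → pos modulus ℤ.∣ pos (residue l₂ i) ℤ.- pos (residue l₁ i) ℤ.- l ℤ.* t i
      seed-divides i = ℤ.divides (Q₁ ℤ.- Q₂) (≡.trans
        (cong (λ r → pos (residue l₂ i) ℤ.- pos (residue l₁ i) ℤ.- r)
          (≡.trans (cong (ℤ._* t i) l≡) (≡.trans
            (solveℤ 3 (λ a b t → (a :- b) :* t := a :* t :- b :* t) ≡.refl (pos (toℕ l₂)) (pos (toℕ l₁)) (t i))
            (cong₂ ℤ._-_ (a≡a%ℕn+[a/ℕn]*n (pos (toℕ l₂) ℤ.* t i) modulus) (a≡a%ℕn+[a/ℕn]*n (pos (toℕ l₁) ℤ.* t i) modulus)))))
        (solveℤ 5 (λ r₂ r₁ Q₂ Q₁ M → r₂ :- r₁ :- ((r₂ :+ Q₂ :* M) :- (r₁ :+ Q₁ :* M)) := (Q₁ :- Q₂) :* M) ≡.refl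
          (pos (residue l₂ i)) (pos (residue l₁ i)) Q₂ Q₁ (pos modulus)))
        where
        Q₁ = (pos (toℕ l₁) ℤ.* t i) /ℕ modulus
        Q₂ = (pos (toℕ l₂) ℤ.* t i) /ℕ modulus

  -- The index is an upper bound for the number of signed seeds, with multiplicity, and so controls
  -- the size of values under a dilation; `conv` allows it to be weakened.
  data Span {k} (σ : Fin k → Carrier) : ℕ → Carrier → Set (c ⊔ ℓ) where
    unit : Span σ 0 ε
    seed : ∀ i → Span σ 1 (σ i)
    _⊞_  : ∀ {l l′ g h} → Span σ l g → Span σ l′ h → Span σ (l + l′) (g ∙ h)
    neg  : ∀ {l g} → Span σ l g → Span σ l (inv g)
    conv : ∀ {l l′ g h} → l ≤ l′ → g ≈ h → Span σ l g → Span σ l′ h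

  Span-mono : ∀ {k k′} {σ : Fin k → Carrier} {σ′ : Fin k′ → Carrier} → (∀ i → ∃ λ j → σ i ≈ σ′ j) →
              ∀ {l g} → Span σ l g → Span σ′ l g
  Span-mono σ⊆σ′ unit = unit
  Span-mono σ⊆σ′ (seed i) = conv ℕ.≤-refl (sym (proj₂ (σ⊆σ′ i))) (seed (proj₁ (σ⊆σ′ i)))
  Span-mono σ⊆σ′ (s ⊞ t) = Span-mono σ⊆σ′ s ⊞ Span-mono σ⊆σ′ t
  Span-mono σ⊆σ′ (neg s) = neg (Span-mono σ⊆σ′ s)
  Span-mono σ⊆σ′ (conv l≤l′ g≈h s) = conv l≤l′ g≈h (Span-mono σ⊆σ′ s)

  ⨁ : List Carrier → Carrier
  ⨁ = List.foldr _∙_ ε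

  module _ {k} {σ : Fin k → Carrier} {B g₀} (φ : Dilation σ B g₀) where
    open Dilation φ

    span-small : ∀ {l g} → Span σ l g → ∃ λ z → Value g z × B * ℤ.∣ z ∣ ≤ l * modulus
    span-small unit = 0ℤ , value-ε , ℕ.≤-reflexive (ℕ.*-zeroʳ B)
    span-small (seed i) = let (z , v , small) = seed-small i in
      z , v , ℕ.≤-trans (ℕ.<⇒≤ small) (ℕ.≤-reflexive (≡.sym (ℕ.*-identityˡ modulus)))
    span-small (_⊞_ {l} {l′} s s′) with span-small s | span-small s′
    ... | z , v , small | z′ , v′ , small′ = z ℤ.+ z′ , value-∙ v v′ ,
      ℕ.≤-trans (ℕ.*-monoʳ-≤ B (ℤ.∣i+j∣≤∣i∣+∣j∣ z z′)) (ℕ.≤-trans (ℕ.≤-reflexive (ℕ.*-distribˡ-+ B ℤ.∣ z ∣ ℤ.∣ z′ ∣))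
        (ℕ.≤-trans (ℕ.+-mono-≤ small small′) (ℕ.≤-reflexive (≡.sym (ℕ.*-distribʳ-+ modulus l l′)))))
    span-small (neg s) with span-small s
    ... | z , v , small = ℤ.- z , value-inv v , subst (λ a → B * a ≤ _) (≡.sym (ℤ.∣-i∣≡∣i∣ z)) small
    span-small (conv l≤l′ g≈h s) with span-small s
    ... | z , v , small = z , value-resp g≈h v , ℕ.≤-trans small (ℕ.*-monoˡ-≤ modulus l≤l′)

-- Extreme points.

module Extremes {c ℓ} (G : FiniteAbelianGroup c ℓ) where

  open GroupFacts G
  open Spanning G
  -- A substitute for a vertex of a convex hull: `e i` is not an average of at most `R` points of
  -- the list in a nontrivial way, stated without division.
  Extreme : ∀ {n} → (Fin n → Carrier) → ℕ → List (Fin n) → Fin n → Set ℓ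
  Extreme e R xs i = ∀ js → (∀ {j} → j ∈ˡ js → j ∈ˡ xs) → length js ≤ R →
    length js · e i ≈ ⨁ (map e js) → ∀ {j} → j ∈ˡ js → e j ≈ e i

  -- The members on which `φ` is largest form a face. It is proper because `φ` separates `x` from
  -- `y`, and a point extreme in it is extreme in the whole list because short relations at a point
  -- of the face stay inside the face.
  module MaximalFace {k n} {σ : Fin k → Carrier} (L R : ℕ) (e : Fin n → Carrier)
    (x y : Fin n) (xs : List (Fin n)) (y∈xs : y ∈ˡ xs)
    (dilated : Dilation σ (suc (2 * (R * L))) (e y ∙ inv (e x))) (φ : Fin n → ℤ)
    (φ-value : ∀ i → Dilation.Value dilated (e i) (φ i))
    (φ-small : ∀ i → suc (2 * (R * L)) * ℤ.∣ φ i ∣ ≤ L * Dilation.modulus dilated) where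

    open +-*-Solver renaming (solve to solveℕ)
    open Dilation dilated

    private
      B : ℕ
      B = suc (2 * (R * L))

    top : Fin n
    top = argmax φ x (x ∷ xs)
    face? : Decidable (λ j → φ j ≡ φ top)
    face? j = φ j ℤ.≟ φ top
    face : List (Fin n)
    face = filter face? (x ∷ xs)

    top∈face : top ∈ˡ face
    top∈face = ∈ˡ.∈-filter⁺ face? ([ (λ eq → subst (_∈ˡ x ∷ xs) (≡.sym eq) (here ≡.refl)) , id ]′ (argmax-sel φ x (x ∷ xs))) ≡.refl

    φy≢φx : φ y ≢ φ x
    φy≢φx eq = nonzero (subst (Value (e y ∙ inv (e x))) (≡.trans (cong (ℤ._- φ x) eq) (ℤ.+-inverseʳ (φ x)))
      (value-∙ (φ-value y) (value-inv (φ-value x))))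

    face-smaller : length face < length (x ∷ xs)
    face-smaller = x-in-or-out (face? x)
      where
      x-in-or-out : Dec (φ x ≡ φ top) → length face < length (x ∷ xs)
      x-in-or-out (no x∉)  = List.filter-notAll face? (x ∷ xs) (here x∉)
      x-in-or-out (yes x∈) = List.filter-notAll face? (x ∷ xs)
        (there (Any.map (λ { ≡.refl φy → φy≢φx (≡.trans φy (≡.sym x∈)) }) y∈xs))

    gap : Fin n → ℕ
    gap j = ℤ.∣ φ top ℤ.- φ j ∣

    gap-value : ∀ {i j} → i ∈ˡ face → j ∈ˡ x ∷ xs → Value (e i ∙ inv (e j)) (pos (gap j))
    gap-value {i} {j} i∈ j∈ = subst (Value _) (≡.sym (≡.trans
      (ℤ.0≤i⇒+∣i∣≡i (ℤ.i≤j⇒0≤j-i (All.lookup (f[xs]≤f[argmax] {f = φ} x (x ∷ xs)) j∈)))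
      (cong (ℤ._- φ j) (≡.sym (proj₂ (∈ˡ.∈-filter⁻ face? {xs = x ∷ xs} i∈))))))
      (value-∙ (φ-value i) (value-inv (φ-value j)))

    gap-small : ∀ j → B * gap j ≤ 2 * L * modulus
    gap-small j = ℕ.≤-trans (ℕ.*-monoʳ-≤ B (ℤ.∣i-j∣≤∣i∣+∣j∣ (φ top) (φ j)))
      (ℕ.≤-trans (ℕ.≤-reflexive (ℕ.*-distribˡ-+ B ℤ.∣ φ top ∣ ℤ.∣ φ j ∣))
        (ℕ.≤-trans (ℕ.+-mono-≤ (φ-small top) (φ-small j))
          (ℕ.≤-reflexive (solveℕ 2 (λ l m → l :* m :+ l :* m := con 2 :* l :* m) ≡.refl L modulus))))

    sum-gaps-value : ∀ {i} js → i ∈ˡ face → (∀ {j} → j ∈ˡ js → j ∈ˡ x ∷ xs) →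
      Value (length js · e i ∙ inv (⨁ (map e js))) (pos (sum (map gap js)))
    sum-gaps-value {i} [] i∈ _ = value-resp (trans (inverseʳ (e i)) (sym (inverseʳ ε)))
      (subst (Value _) (ℤ.+-inverseʳ (φ i)) (value-∙ (φ-value i) (value-inv (φ-value i))))
    sum-gaps-value {i} (j ∷ js) i∈ js⊆ = value-resp
      (trans (solve 4 (λ a b c d → (a ⊕ b) ⊕ (c ⊕ d) ⊜ (a ⊕ c) ⊕ (b ⊕ d)) refl (e i) (inv (e j)) _ _)
        (∙-congˡ (⁻¹-∙-comm (e j) (⨁ (map e js)))))
      (subst (Value _) (≡.sym (ℤ.pos-+ (gap j) (sum (map gap js))))
        (value-∙ (gap-value i∈ (js⊆ (here ≡.refl))) (sum-gaps-value js i∈ (js⊆ ∘ there))))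

    sum-gaps-small : ∀ js → B * sum (map gap js) ≤ length js * (2 * L * modulus)
    sum-gaps-small [] = ℕ.≤-reflexive (ℕ.*-zeroʳ B)
    sum-gaps-small (j ∷ js) = ℕ.≤-trans (ℕ.≤-reflexive (ℕ.*-distribˡ-+ B (gap j) _))
      (ℕ.+-mono-≤ (gap-small j) (sum-gaps-small js))

    -- The gaps of the terms add up to a value of `ε`, hence to a multiple of the modulus. They are
    -- natural numbers with a sum below the modulus, so all of them vanish.
    in-face : ∀ {i} js → i ∈ˡ face → (∀ {j} → j ∈ˡ js → j ∈ˡ x ∷ xs) → length js ≤ R →
      length js · e i ≈ ⨁ (map e js) → ∀ {j} → j ∈ˡ js → j ∈ˡ face
    in-face {i} js i∈ js⊆ short eq {j} j∈ = ∈ˡ.∈-filter⁺ face? (js⊆ j∈)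
      (≡.sym (ℤ.i-j≡0⇒i≡j _ _ (ℤ.∣i∣≡0⇒i≡0 (zero-gap js (multiple-small (sum (map gap js)) divides small) j∈))))
      where
      open ℕ.≤-Reasoning
      divides : modulus ℕ.∣ sum (map gap js)
      divides = ℤ.∣⇒∣ᵤ (value-zero (value-resp (x≈y⇒x∙y⁻¹≈ε eq) (sum-gaps-value js i∈ js⊆)))
      -- At most `R` gaps of size at most `2 L modulus / B` stay below `modulus` in total; this
      -- dictates `B = 2 R L + 1`.
      small : sum (map gap js) < modulus
      small = ℕ.*-cancelˡ-< B _ _ (begin-strict
        B * sum (map gap js)          ≤⟨ sum-gaps-small js ⟩
        length js * (2 * L * modulus) ≤⟨ ℕ.*-monoˡ-≤ _ short ⟩
        R * (2 * L * modulus)         ≡⟨ solveℕ 3 (λ r l m → r :* (con 2 :* l :* m) := con 2 :* (r :* l) :* m) ≡.refl R L modulus ⟩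
        2 * (R * L) * modulus         <⟨ ℕ.m<n+m _ modulus≢0 ⟩
        B * modulus                   ∎)
      multiple-small : ∀ s → modulus ℕ.∣ s → s < modulus → s ≡ 0
      multiple-small zero _ _ = ≡.refl
      multiple-small (suc s) M∣s s<M = ⊥-elim (ℕ.<⇒≱ s<M (ℕ.∣⇒≤ M∣s))
      zero-gap : ∀ js → sum (map gap js) ≡ 0 → ∀ {j} → j ∈ˡ js → gap j ≡ 0
      zero-gap (j ∷ js) eq (here ≡.refl) = ℕ.m+n≡0⇒m≡0 (gap j) eq
      zero-gap (j ∷ js) eq (there j∈) = zero-gap js (ℕ.m+n≡0⇒n≡0 (gap j) eq) j∈

    smaller-face : ∃ λ z → ∃ λ zs → length zs < length xs ×
      (∀ i → i ∈ˡ z ∷ zs → Extreme e R (z ∷ zs) i → i ∈ˡ x ∷ xs × Extreme e R (x ∷ xs) i)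
    smaller-face = uncons face ≡.refl
      where
      uncons : ∀ zs → zs ≡ face → ∃ λ z → ∃ λ zs → length zs < length xs ×
        (∀ i → i ∈ˡ z ∷ zs → Extreme e R (z ∷ zs) i → i ∈ˡ x ∷ xs × Extreme e R (x ∷ xs) i)
      uncons [] eq = ⊥-elim (¬Any[] (subst (top ∈ˡ_) (≡.sym eq) top∈face))
      uncons (z ∷ zs) eq = z , zs , ℕ.s≤s⁻¹ (subst (λ f → length f < suc (length xs)) (≡.sym eq) face-smaller) ,
        λ i i∈ extreme → proj₁ (∈ˡ.∈-filter⁻ face? (subst (i ∈ˡ_) eq i∈)) , λ js js⊆ short sum≈ →
          extreme js (λ {j} j∈ → subst (j ∈ˡ_) (≡.sym eq) (in-face js (subst (i ∈ˡ_) eq i∈) js⊆ short sum≈ j∈)) short sum≈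

  -- As long as two members differ, a dilation separating them gives a smaller face; once all agree,
  -- any of them is extreme, and extremality lifts back through the faces.
  extreme-point : ∀ (1<N : 1 < N) {k n} (σ : Fin k → Carrier) L R (e : Fin n → Carrier) →
    (∀ i → Span σ L (e i)) → suc (2 * (R * L)) ^ k < q G 1<N →
    ∀ x xs → ∃ λ i → i ∈ˡ x ∷ xs × Extreme e R (x ∷ xs) i
  extreme-point 1<N {k} {n} σ L R e spans bound x₀ xs₀ = search (suc (length xs₀)) x₀ xs₀ ℕ.≤-refl
    where
    search : ∀ size x xs → length xs < size → ∃ λ i → i ∈ˡ x ∷ xs × Extreme e R (x ∷ xs) i
    search (suc size) x xs (s≤s ∣xs∣) with Any.any? (λ y → ¬? (e y ≈? e x)) xs
    ... | no none = x , here ≡.refl , λ js js⊆ _ _ j∈ → constant (js⊆ j∈)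
      where
      constant : ∀ {j} → j ∈ˡ x ∷ xs → e j ≈ e x
      constant (here ≡.refl) = refl
      constant {j} (there j∈) = decidable-stable (e j ≈? e x) λ j≉x → none (Any.map (λ { ≡.refl → j≉x }) j∈)
    ... | yes some = descend (find some)
      where
      descend : (∃ λ y → y ∈ˡ xs × ¬ e y ≈ e x) → ∃ λ i → i ∈ˡ x ∷ xs × Extreme e R (x ∷ xs) i
      descend (y , y∈ , y≉x)
        = continue (MaximalFace.smaller-face L R e x y xs y∈ dilated
               (λ i → proj₁ (small i)) (λ i → proj₁ (proj₂ (small i))) (λ i → proj₂ (proj₂ (small i))))
        where
        dilated : Dilation σ (suc (2 * (R * L))) (e y ∙ inv (e x))
        dilated = dilation 1<N σ (suc (2 * (R * L))) (s≤s z≤n) bound (e y ∙ inv (e x))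
          λ eq → y≉x (x∙y⁻¹≈ε⇒x≈y _ _ eq)
        small : ∀ i → ∃ λ z → Dilation.Value dilated (e i) z × suc (2 * (R * L)) * ℤ.∣ z ∣ ≤ L * Dilation.modulus dilated
        small i = span-small dilated (spans i)
        continue : (∃ λ z → ∃ λ zs → length zs < length xs ×
          (∀ i → i ∈ˡ z ∷ zs → Extreme e R (z ∷ zs) i → i ∈ˡ x ∷ xs × Extreme e R (x ∷ xs) i)) →
          ∃ λ i → i ∈ˡ x ∷ xs × Extreme e R (x ∷ xs) i
        continue (z , zs , ∣zs∣ , lift-extreme) =
          let (i , i∈ , extreme) = search size z zs (ℕ.<-≤-trans ∣zs∣ ∣xs∣) in i , lift-extreme i i∈ extreme

-- Popular steps, clusters and walks in a set without unique sums.

infix 4 _∈?_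
_∈?_ : ∀ {n} (x : Fin n) xs → Dec (x ∈ˡ xs)
x ∈? xs = Any.any? (x Fin.≟_) xs

enumerate : ∀ {a} {A : Set a} {t} (xs : List A) → t ≤ length xs → Fin t → A
enumerate xs t≤ j = List.lookup xs (inject≤ j t≤)

enumerate-injective : ∀ {a b} {A : Set a} {B : Set b} (f : A → B) {t} (xs : List A) (t≤ : t ≤ length xs) →
  AllPairs (λ x y → f x ≢ f y) xs → Injective _≡_ _≡_ (f ∘ enumerate xs t≤)
enumerate-injective f xs t≤ apart {i} {j} eq = Fin.inject≤-injective t≤ t≤ i j (AllPairs⇒lookup-injective f apart eq)

unique⇒length≤ : ∀ {n} {xs : List (Fin n)} → Unique xs → length xs ≤ n
unique⇒length≤ unique = Fin.injective⇒≤ (AllPairs⇒lookup-injective id unique)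

preimages : ∀ {a} {A : Set a} (xs js : List A) → (∀ {j} → j ∈ˡ js → j ∈ˡ xs) → ∃ λ is → map (List.lookup xs) is ≡ js
preimages xs [] _ = [] , ≡.refl
preimages xs (j ∷ js) js⊆ with preimages xs js (js⊆ ∘ there)
... | is , eq = Any.index (js⊆ (here ≡.refl)) ∷ is , cong₂ _∷_ (≡.sym (Any.lookup-index (js⊆ (here ≡.refl)))) eq

-- `large` is the hypothesis of `extreme-point` in the worst case: relations of length `n`, signed
-- sums of `2 * n + 3` seeds, and `K` seeds.
module Family {c ℓ} (G : FiniteAbelianGroup c ℓ) (1<N : 1 < order G)
  {n : ℕ} (2≤n : 2 ≤ n) (a : Fin n → FiniteAbelianGroup.Carrier G)
  (a-injective : GroupFacts.InjectiveFamily G a) (another : GroupFacts.NoUniqueSumFamily G a)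
  (K : ℕ) (large : suc (2 * (n * (2 * n + 3))) ^ K < q G 1<N) where

  open GroupFacts G
  open Spanning G
  open Extremes G

  private
    small-exponent : ∀ {R L k} → R ≤ n → L ≤ 2 * n + 3 → k ≤ K → suc (2 * (R * L)) ^ k < q G 1<N
    small-exponent {R} {L} {k} R≤n L≤ k≤K = ℕ.≤-<-trans (ℕ.≤-trans
      (ℕ.^-monoˡ-≤ k (s≤s (ℕ.*-monoʳ-≤ 2 (ℕ.*-mono-≤ R≤n L≤))))
      (ℕ.^-monoʳ-≤ (suc (2 * (n * (2 * n + 3)))) k≤K)) large

  left right : Fin n → Fin n → Fin n
  left x b = proj₁ (another x b)
  right x b = proj₁ (proj₂ (another x b))

  another-sum : ∀ x b → a x ∙ a b ≈ a (left x b) ∙ a (right x b)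
  another-sum x b = proj₁ (proj₂ (proj₂ (another x b)))

  left≢ : ∀ x b → left x b ≢ x
  left≢ x b = proj₁ (proj₂ (proj₂ (proj₂ (another x b))))

  right≢ : ∀ x b → right x b ≢ x
  right≢ x b eq = proj₂ (proj₂ (proj₂ (proj₂ (another x b)))) (≡.sym (a-injective (∙-cancelˡ (a x) _ _
    (trans (another-sum x b) (trans (comm _ _) (∙-congʳ (reflexive (cong a eq))))))))

  sum-injective : ∀ {x c b b′ d d′} → a x ∙ a b ≈ a c ∙ a d → a x ∙ a b′ ≈ a c ∙ a d′ → d ≡ d′ → b ≡ b′
  sum-injective {x} p r ≡.refl = a-injective (∙-cancelˡ (a x) _ _ (trans p (sym r)))

  seeds : (S : List (Fin n)) → Fin (length S) → Carrier
  seeds S i = a (List.lookup S i)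

  seeds-⊆ : ∀ {S S′} → (∀ {s} → s ∈ˡ S → s ∈ˡ S′) → ∀ i → ∃ λ j → seeds S i ≈ seeds S′ j
  seeds-⊆ S⊆S′ i = Any.index (S⊆S′ (∈ˡ.∈-lookup i)) ,
    reflexive (cong a (Any.lookup-index (S⊆S′ (∈ˡ.∈-lookup i))))

  seed∈ : ∀ {S s} → s ∈ˡ S → Span (seeds S) 1 (a s)
  seed∈ s∈ = conv ℕ.≤-refl (reflexive (cong a (≡.sym (Any.lookup-index s∈)))) (seed (Any.index s∈))

  -- A second representation of `a i ∙ a i` is a relation of length 2 at `i`; at an extreme point
  -- both of its terms would be `i` again.
  spanned-impossible : ∀ S → length S ≤ K → ∀ L → L ≤ 2 * n + 3 → ¬ (∀ i → Span (seeds S) L (a i))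
  spanned-impossible S ∣S∣≤K L L≤ spans
    with i , _ , extreme ← extreme-point 1<N (seeds S) L 2 a spans (small-exponent 2≤n L≤ ∣S∣≤K)
           (fromℕ< (ℕ.<⇒≤ 2≤n)) (allFin n)
    = left≢ i i (a-injective (extreme (left i i ∷ right i i ∷ []) (λ {j} _ → there (∈ˡ.∈-allFin j)) ℕ.≤-refl
        (trans (∙-congˡ (identityʳ _)) (trans (another-sum i i) (∙-congˡ (sym (identityʳ _))))) (here ≡.refl)))

  -- Popular x c stands for: the difference a x - a c has many representations a d - a b.
  module Steps (Popular : Fin n → Fin n → Set) (popular? : ∀ x c → Dec (Popular x c)) where

    Step : Fin n → Fin n → Set ℓ
    Step x b = ∃ λ c → ∃ λ d → a x ∙ a b ≈ a c ∙ a d × c ≢ x × Popular x c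

    step? : ∀ x b → Dec (Step x b)
    step? x b = Fin.any? λ c → Fin.any? λ d → (a x ∙ a b) ≈? (a c ∙ a d) ×-dec ¬? (c Fin.≟ x) ×-dec popular? x c

    exceptions : Fin n → List (Fin n)
    exceptions x = filter (λ b → ¬? (step? x b)) (allFin n)

  module Walks (Popular : Fin n → Fin n → Set) (popular? : ∀ x c → Dec (Popular x c)) (S : List (Fin n))
    (popular-hit : ∀ {x c} → Popular x c → ∃ λ b → ∃ λ d → b ∈ˡ S × d ∈ˡ S × a x ∙ a b ≈ a c ∙ a d)
    where

    open Steps Popular popular?

    -- It equals `a b ∙ inv (a d)` for the seeds `b` and `d` that represent the popular pair.
    difference : ∀ {x c} → Popular x c → Span (seeds S) 2 (a c ∙ inv (a x))
    difference {x} {c} p with popular-hit p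
    ... | b , d , b∈ , d∈ , eq = conv ℕ.≤-refl
      (∙-cancelʳ (a x ∙ a d) _ _ (begin
        (a b ∙ inv (a d)) ∙ (a x ∙ a d) ≈⟨ solve 4 (λ b i x d → (b ⊕ i) ⊕ (x ⊕ d) ⊜ i ⊕ (d ⊕ (x ⊕ b))) refl (a b) (inv (a d)) (a x) (a d) ⟩
        inv (a d) ∙ (a d ∙ (a x ∙ a b)) ≈⟨ cancel _ _ ⟩
        a x ∙ a b                       ≈⟨ eq ⟩
        a c ∙ a d                       ≈⟨ cancel (a x) _ ⟨
        inv (a x) ∙ (a x ∙ (a c ∙ a d)) ≈⟨ solve 4 (λ i x c d → i ⊕ (x ⊕ (c ⊕ d)) ⊜ (c ⊕ i) ⊕ (x ⊕ d)) refl (inv (a x)) (a x) (a c) (a d) ⟩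
        (a c ∙ inv (a x)) ∙ (a x ∙ a d) ∎))
      (seed∈ b∈ ⊞ neg (seed∈ d∈))
      where open import Relation.Binary.Reasoning.Setoid setoid

    record Cluster (y : Fin n) : Set (c ⊔ ℓ) where
      field
        members : List (Fin n)
        y∈      : y ∈ˡ members
        closed  : ∀ {x c} → x ∈ˡ members → Popular x c → c ∈ˡ members
        spans   : ∀ {x} → x ∈ˡ members → Span (seeds S) (2 * n) (a x ∙ inv (a y))

    -- The closure of `y`, built one element at a time. Each new element costs one popular
    -- difference, that is two seeds, and there are at most `n` elements.
    cluster : ∀ y → Cluster y
    cluster y = grow n (y ∷ []) ([] ∷ []) (here ≡.refl)
      (λ { (here ≡.refl) → conv z≤n (sym (inverseʳ (a y))) unit }) (ℕ.m≤n+m n 1)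
      where
      grow : ∀ fuel X → Unique X → y ∈ˡ X →
        (∀ {x} → x ∈ˡ X → Span (seeds S) (2 * length X) (a x ∙ inv (a y))) → n ≤ length X + fuel → Cluster y
      grow fuel X unique y∈ spans enough
        with Any.any? (λ x → Fin.any? λ c → popular? x c ×-dec ¬? (c ∈? X)) X
      ... | no none = record
        { members = X ; y∈ = y∈
        ; closed  = λ {x} {c} x∈ p → decidable-stable (c ∈? X) λ c∉ → none (lose x∈ (c , p , c∉))
        ; spans   = λ x∈ → conv (ℕ.*-monoʳ-≤ 2 (unique⇒length≤ unique)) refl (spans x∈) }
      ... | yes some = adjoin fuel (find some) enough
        where
        adjoin : ∀ fuel → (∃ λ x → x ∈ˡ X × ∃ λ v → Popular x v × ¬ v ∈ˡ X) → n ≤ length X + fuel → Cluster y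
        adjoin zero (x , x∈ , v , p , v∉) enough =
          ⊥-elim (ℕ.<⇒≱ (unique⇒length≤ (All.tabulate (λ u∈ → λ { ≡.refl → v∉ u∈ }) ∷ unique))
            (ℕ.≤-trans enough (ℕ.≤-reflexive (ℕ.+-identityʳ (length X)))))
        adjoin (suc fuel) (x , x∈ , v , p , v∉) enough =
          grow fuel (v ∷ X) (All.tabulate (λ u∈ → λ { ≡.refl → v∉ u∈ }) ∷ unique) (there y∈)
            (λ { (here ≡.refl) → conv (ℕ.≤-reflexive (≡.sym (ℕ.*-suc 2 (length X))))
                   (trans (solve 4 (λ v i x k → (v ⊕ i) ⊕ (x ⊕ k) ⊜ i ⊕ (x ⊕ (v ⊕ k))) refl (a v) (inv (a x)) (a x) (inv (a y))) (cancel _ _))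
                   (difference p ⊞ spans x∈)
               ; (there u∈) → conv (ℕ.*-monoʳ-≤ 2 (ℕ.n≤1+n (length X))) refl (spans u∈) })
            (ℕ.≤-trans enough (ℕ.≤-reflexive (ℕ.+-suc (length X) fuel)))

    module _ (∣S∣<K : length S < K) {y} (C : Cluster y) where
      open Cluster C

      -- With `y` itself as one more seed, every member is a signed sum of `2 * n + 1` seeds.
      -- Relations up to length `n` are covered, the length of the longest cycle of a walk.
      cluster-extreme : ∃ λ x → x ∈ˡ members × (∀ js → (∀ {j} → j ∈ˡ js → j ∈ˡ members) → length js ≤ n →
        length js · a x ≈ ⨁ (map a js) → ∀ {j} → j ∈ˡ js → j ≡ x)
      cluster-extreme = transport (extreme-point 1<N (seeds (y ∷ S)) (2 * n + 1) n (seeds members) spans′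
        (small-exponent ℕ.≤-refl (ℕ.+-monoʳ-≤ (2 * n) (s≤s z≤n)) ∣S∣<K) (Any.index y∈) (allFin (length members)))
        where
        spans′ : ∀ i → Span (seeds (y ∷ S)) (2 * n + 1) (seeds members i)
        spans′ i = conv ℕ.≤-refl (trans (assoc _ _ _) (trans (∙-congˡ (inverseˡ _)) (identityʳ _)))
          (Span-mono (seeds-⊆ there) (spans (∈ˡ.∈-lookup i)) ⊞ seed∈ (here ≡.refl))
        pull : ∀ {i} → Extreme (seeds members) n (Any.index y∈ ∷ allFin (length members)) i →
          ∀ js → (∃ λ is → map (List.lookup members) is ≡ js) → length js ≤ n →
          length js · a (List.lookup members i) ≈ ⨁ (map a js) → ∀ {j} → j ∈ˡ js → j ≡ List.lookup members i
        pull {i} extreme _ (is , ≡.refl) short sum≈ j∈ with ∈ˡ.∈-map⁻ (List.lookup members) j∈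
        ... | k , k∈ , ≡.refl = a-injective (extreme is (λ {j} _ → there (∈ˡ.∈-allFin j))
          (subst (_≤ n) ∣is∣ short)
          (trans (×-congˡ (≡.sym ∣is∣)) (trans sum≈ (reflexive (cong ⨁ (≡.sym (List.map-∘ is)))))) k∈)
          where
          ∣is∣ : length (map (List.lookup members) is) ≡ length is
          ∣is∣ = List.length-map (List.lookup members) is
        transport : (∃ λ i → i ∈ˡ Any.index y∈ ∷ allFin (length members) ×
                     Extreme (seeds members) n (Any.index y∈ ∷ allFin (length members)) i) →
          ∃ λ x → x ∈ˡ members × (∀ js → (∀ {j} → j ∈ˡ js → j ∈ˡ members) → length js ≤ n →
            length js · a x ≈ ⨁ (map a js) → ∀ {j} → j ∈ˡ js → j ≡ x)
        transport (i , _ , extreme) = List.lookup members i , ∈ˡ.∈-lookup i ,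
          λ js js⊆ short sum≈ j∈ → pull extreme js (preimages members js js⊆) short sum≈ j∈

      module Walk (x : Fin n) (x∈ : x ∈ˡ members)
        (extreme : ∀ js → (∀ {j} → j ∈ˡ js → j ∈ˡ members) → length js ≤ n →
          length js · a x ≈ ⨁ (map a js) → ∀ {j} → j ∈ˡ js → j ≡ x) where

        next : Fin n → Fin n
        next b with step? x b
        ... | yes (_ , d , _) = d
        -- At an exception the walk stays put; a safe walk takes no such step.
        ... | no _ = b

        next-step : ∀ {b} → ¬ (b ∈ˡ exceptions x) → ∃ λ c → a x ∙ a b ≈ a c ∙ a (next b) × c ≢ x × Popular x c
        next-step {b} b∉ with step? x b
        ... | yes (c , d , step) = c , step
        ... | no ¬step = ⊥-elim (b∉ (∈ˡ.∈-filter⁺ (λ b → ¬? (step? x b)) (∈ˡ.∈-allFin b) ¬step))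

        iter : ℕ → Fin n → Fin n
        iter zero b = b
        iter (suc k) b = iter k (next b)

        iter-+ : ∀ i k b → iter (i + k) b ≡ iter k (iter i b)
        iter-+ zero k b = ≡.refl
        iter-+ (suc i) k b = iter-+ i k (next b)

        Safe : ℕ → Fin n → Set
        Safe k b = ∀ i → i < k → ¬ (iter i b ∈ˡ exceptions x)

        -- The equations of the successive steps telescope. Each `c` belongs to the cluster, which
        -- contains `x` and is closed under popular steps.
        walk-sum : ∀ k b → Safe k b → ∃ λ cs → length cs ≡ k × (∀ {c} → c ∈ˡ cs → c ∈ˡ members × c ≢ x) ×
                   k · a x ∙ a b ≈ ⨁ (map a cs) ∙ a (iter k b)
        walk-sum zero b _ = [] , ≡.refl , (λ ()) , refl
        walk-sum (suc k) b safe with next-step (safe 0 (s≤s z≤n)) | walk-sum k (next b) (λ i i<k → safe (suc i) (s≤s i<k))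
        ... | c , eq , c≢x , p | cs , ∣cs∣ , cs⊆ , eqs = c ∷ cs , cong suc ∣cs∣ ,
          (λ { (here ≡.refl) → closed x∈ p , c≢x ; (there c∈) → cs⊆ c∈ }) , (begin
            (a x ∙ k · a x) ∙ a b                      ≈⟨ solve 3 (λ x k b → (x ⊕ k) ⊕ b ⊜ k ⊕ (x ⊕ b)) refl (a x) (k · a x) (a b) ⟩
            k · a x ∙ (a x ∙ a b)                      ≈⟨ ∙-congˡ eq ⟩
            k · a x ∙ (a c ∙ a (next b))               ≈⟨ solve 3 (λ k c d → k ⊕ (c ⊕ d) ⊜ c ⊕ (k ⊕ d)) refl (k · a x) (a c) (a (next b)) ⟩
            a c ∙ (k · a x ∙ a (next b))               ≈⟨ ∙-congˡ eqs ⟩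
            a c ∙ (⨁ (map a cs) ∙ a (iter k (next b))) ≈⟨ assoc _ _ _ ⟨
            (a c ∙ ⨁ (map a cs)) ∙ a (iter k (next b)) ∎)
          where open import Relation.Binary.Reasoning.Setoid setoid

        -- On a closed walk the two ends cancel in `walk-sum`, leaving a relation at the extreme
        -- point `x` whose terms differ from `x`.
        no-cycle : ∀ k b → 1 ≤ k → k ≤ n → Safe k b → iter k b ≢ b
        no-cycle k b 1≤k k≤n safe eq with walk-sum k b safe
        ... | [] , ≡.refl , _ = ⊥-elim (ℕ.<⇒≱ 1≤k z≤n)
        ... | cs@(_ ∷ _) , ≡.refl , cs⊆ , eqs = proj₂ (cs⊆ (here ≡.refl)) (extreme cs (proj₁ ∘ cs⊆) k≤n
          (∙-cancelʳ (a b) _ _ (trans eqs (∙-congˡ (reflexive (cong a eq))))) (here ≡.refl))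

        -- Two of the `n + 1` positions at times 0 to `n` coincide, and the walk between them is a
        -- cycle of length at most `n`.
        unsafe : ∀ b → ¬ Safe (suc n) b
        unsafe b safe with i , j , i<j , eq ← Fin.pigeonhole (ℕ.n<1+n n) (λ i → iter (toℕ i) b) =
          no-cycle (toℕ j ℕ.∸ toℕ i) (iter (toℕ i) b) (ℕ.m<n⇒0<n∸m i<j)
            (ℕ.≤-trans (ℕ.m∸n≤m (toℕ j) (toℕ i)) (ℕ.s≤s⁻¹ (Fin.toℕ<n j)))
            (λ k k< k∈ → safe (toℕ i + k)
              (ℕ.<-trans (ℕ.<-≤-trans (ℕ.+-monoʳ-< (toℕ i) k<) (ℕ.≤-reflexive (ℕ.m+[n∸m]≡n (ℕ.<⇒≤ i<j)))) (Fin.toℕ<n j))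
              (subst (_∈ˡ exceptions x) (≡.sym (iter-+ (toℕ i) k b)) k∈))
            (≡.trans (≡.sym (iter-+ (toℕ i) (toℕ j ℕ.∸ toℕ i) b))
              (≡.trans (cong (λ k → iter k b) (ℕ.m+[n∸m]≡n (ℕ.<⇒≤ i<j))) (≡.sym eq)))

        -- Traced back from the first exception it meets, the walk writes `a b` as that exception
        -- plus one popular difference, two seeds, per step.
        walk-span : ∀ k b → Span (seeds (exceptions x ++ S)) (1 + 2 * k) (a b) ⊎ Safe (suc k) b
        walk-span k b with b ∈? exceptions x
        ... | yes b∈ = inj₁ (conv (s≤s z≤n) refl (seed∈ (∈ˡ.∈-++⁺ˡ b∈)))
        walk-span zero b | no b∉ = inj₂ λ { zero _ → b∉ ; (suc _) (s≤s ()) }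
        walk-span (suc k) b | no b∉ with walk-span k (next b)
        ... | inj₂ safe = inj₂ λ { zero _ → b∉ ; (suc i) (s≤s i<) → safe i i< }
        ... | inj₁ span with next-step b∉
        ...   | c , eq , _ , p = inj₁ (conv (ℕ.≤-reflexive (cong suc (≡.trans (ℕ.+-comm (2 * k) 2) (≡.sym (ℕ.*-suc 2 k)))))
          (∙-cancelˡ (a x) _ _ (begin
            a x ∙ (a (next b) ∙ (a c ∙ inv (a x))) ≈⟨ solve 4 (λ x d c i → x ⊕ (d ⊕ (c ⊕ i)) ⊜ i ⊕ (x ⊕ (c ⊕ d))) refl (a x) (a (next b)) (a c) (inv (a x)) ⟩
            inv (a x) ∙ (a x ∙ (a c ∙ a (next b))) ≈⟨ cancel _ _ ⟩
            a c ∙ a (next b)                       ≈⟨ eq ⟨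
            a x ∙ a b                              ∎))
          (span ⊞ Span-mono (seeds-⊆ (∈ˡ.∈-++⁺ʳ (exceptions x))) (difference p)))
          where open import Relation.Binary.Reasoning.Setoid setoid

        many-exceptions : ¬ (length (exceptions x) + length S ≤ K)
        many-exceptions few = spanned-impossible (exceptions x ++ S)
          (ℕ.≤-trans (ℕ.≤-reflexive (List.length-++ (exceptions x))) few) (1 + 2 * n)
          (ℕ.≤-trans (ℕ.≤-reflexive (ℕ.+-comm 1 (2 * n))) (ℕ.+-monoʳ-≤ (2 * n) (s≤s z≤n)))
          λ b → [ id , (λ safe → ⊥-elim (unsafe b safe)) ]′ (walk-span n b)

    -- For each `y` the extreme point `x` of its cluster must have more than `K` elements in its
    -- exceptions and `S` together, so `good` applies. Then `a y` is `a c ∙ a d ∙ inv (a b)`, three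
    -- seeds, corrected by a difference inside the cluster of `2 * n` seeds.
    impossible : ∀ t → t + length S < K →
      (∀ {x} → t ≤ length (exceptions x) → ∃ λ b → ∃ λ c → ∃ λ d → b ∈ˡ S × c ∈ˡ S × d ∈ˡ S × a x ∙ a b ≈ a c ∙ a d) → ⊥
    impossible t t+S<K good = spanned-impossible S (ℕ.≤-trans (ℕ.m≤n+m _ t) (ℕ.<⇒≤ t+S<K)) (2 * n + 3) ℕ.≤-refl spanned
      where
      spanned : ∀ y → Span (seeds S) (2 * n + 3) (a y)
      spanned y with cluster-extreme (ℕ.≤-<-trans (ℕ.m≤n+m _ t) t+S<K) (cluster y)
      ... | x , x∈ , extreme with ℕ.≤-total t (length (exceptions x))
      ...   | inj₂ few = ⊥-elim (Walk.many-exceptions (ℕ.≤-<-trans (ℕ.m≤n+m _ t) t+S<K) (cluster y) x x∈ extreme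
                (ℕ.≤-trans (ℕ.+-monoˡ-≤ (length S) few) (ℕ.<⇒≤ t+S<K)))
      ...   | inj₁ many with good many
      ...     | b , c , d , b∈ , c∈ , d∈ , eq = conv ℕ.≤-refl
        (∙-cancelˡ (a x ∙ a b) _ _ (begin
          (a x ∙ a b) ∙ (inv (a x ∙ inv (a y)) ∙ ((a c ∙ a d) ∙ inv (a b)))
            ≈⟨ ∙-congˡ (∙-congˡ (∙-congʳ (sym eq))) ⟩
          (a x ∙ a b) ∙ (inv (a x ∙ inv (a y)) ∙ ((a x ∙ a b) ∙ inv (a b)))
            ≈⟨ ∙-congˡ (∙-congˡ (trans (assoc _ _ _) (trans (∙-congˡ (inverseʳ (a b))) (trans (identityʳ _) (sym (x≈xiyy (a x) (a y))))))) ⟩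
          (a x ∙ a b) ∙ (inv (a x ∙ inv (a y)) ∙ ((a x ∙ inv (a y)) ∙ a y))
            ≈⟨ ∙-congˡ (cancel _ _) ⟩
          (a x ∙ a b) ∙ a y ∎))
        (neg (Cluster.spans (cluster y) x∈) ⊞ ((seed∈ c∈ ⊞ seed∈ d∈) ⊞ neg (seed∈ b∈)))
        where
        open import Relation.Binary.Reasoning.Setoid setoid
        x≈xiyy : ∀ g h → (g ∙ inv h) ∙ h ≈ g
        x≈xiyy g h = trans (assoc _ _ _) (trans (∙-congˡ (inverseˡ h)) (identityʳ g))

-- Seeds that hit the popular differences and the points with many exceptions.

module Counting {c ℓ} (G : FiniteAbelianGroup c ℓ) (1<N : 1 < order G)
  {n : ℕ} (2≤n : 2 ≤ n) (a : Fin n → FiniteAbelianGroup.Carrier G)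
  (a-injective : GroupFacts.InjectiveFamily G a) (another : GroupFacts.NoUniqueSumFamily G a)
  (K : ℕ) (large : suc (2 * (n * (2 * n + 3))) ^ K < q G 1<N) where

  open GroupFacts G
  open Family G 1<N 2≤n a a-injective another K large

  -- The threshold for popularity is the cube `U ^ 3`, one factor per round of `hittingTriples`. `D`
  -- values halve the remaining instances, and `2 ^ E` exceeds the number of instances, at most
  -- `n * n` pairs times two free coordinates.
  module Hits (U D E : ℕ) (1≤U : 1 ≤ U) (U³≤n : U * (U * U) ≤ n) (n≤DU : n ≤ D * U) (n²U²<2ᴱ : n * n * (U * U) < 2 ^ E) where

    T : ℕ
    T = U * (U * U)

    1≤T : 1 ≤ T
    1≤T = ℕ.*-mono-≤ 1≤U (ℕ.*-mono-≤ 1≤U 1≤U)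

    1≤n : 1 ≤ n
    1≤n = ℕ.<⇒≤ 2≤n

    representable? : ∀ x c b → Dec (∃ λ d → a x ∙ a b ≈ a c ∙ a d)
    representable? x c b = Fin.any? λ d → (a x ∙ a b) ≈? (a c ∙ a d)

    fibre : Fin n → Fin n → List (Fin n)
    fibre x c = filter (representable? x c) (allFin n)

    Popular : Fin n → Fin n → Set
    Popular x c = T ≤ length (fibre x c)

    popularPairs : ∀ ((x , c) : Fin n × Fin n) → ∃ λ (b : Fin T → Fin n) → ∃ λ (d : Fin T → Fin n) →
      Injective _≡_ _≡_ b × Injective _≡_ _≡_ d × (Popular x c → ∀ j → a x ∙ a (b j) ≈ a c ∙ a (d j))
    popularPairs (x , c) with T ℕ.≤? length (fibre x c)
    -- Hitting sets need an injective family for every pair, so unpopular pairs receive an arbitrary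
    -- one, with no equation attached.
    ... | no unpopular = fallback , fallback , fallback-injective , fallback-injective , λ p → ⊥-elim (unpopular p)
      where
      fallback : Fin T → Fin n
      fallback j = inject≤ j U³≤n
      fallback-injective : Injective _≡_ _≡_ fallback
      fallback-injective {i} {j} = Fin.inject≤-injective U³≤n U³≤n i j
    ... | yes T≤ = b , (λ j → proj₁ (partner j)) , b-injective ,
      (λ {i} {j} eq → b-injective (sum-injective (proj₂ (partner i)) (proj₂ (partner j)) eq)) , λ _ j → proj₂ (partner j)
      where
      b : Fin T → Fin n
      b = enumerate (fibre x c) T≤
      b-injective : Injective _≡_ _≡_ b
      b-injective = enumerate-injective id (fibre x c) T≤ (Unique.filter⁺ (representable? x c) (Unique.allFin⁺ n))
      partner : ∀ j → ∃ λ d → a x ∙ a (b j) ≈ a c ∙ a d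
      partner j = proj₂ (∈ˡ.∈-filter⁻ (representable? x c) {xs = allFin n} (∈ˡ.∈-lookup (inject≤ j T≤)))

    popularSeeds : ∃ λ S → length S ≤ 3 * (E * D) ×
      (∀ {x c} → Popular x c → ∃ λ b → ∃ λ d → b ∈ˡ S × d ∈ˡ S × a x ∙ a b ≈ a c ∙ a d)
    popularSeeds = let (S , ∣S∣ , hit) = triples in S , ∣S∣ , λ {x} {c} p →
      let (j , b∈ , d∈ , _) = hit (x , c)
      in first (x , c) j , second (x , c) j , b∈ , d∈ , proj₂ (proj₂ (proj₂ (proj₂ (popularPairs (x , c))))) p j
      where
      first second : Fin n × Fin n → Fin T → Fin n
      first xc = proj₁ (popularPairs xc)
      second xc = proj₁ (proj₂ (popularPairs xc))
      first-injective : ∀ xc → Injective _≡_ _≡_ (first xc)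
      first-injective xc = proj₁ (proj₂ (proj₂ (popularPairs xc)))
      second-injective : ∀ xc → Injective _≡_ _≡_ (second xc)
      second-injective xc = proj₁ (proj₂ (proj₂ (proj₂ (popularPairs xc))))
      triples : ∃ λ S → length S ≤ 3 * (E * D) × ∀ xc → ∃ λ j → first xc j ∈ˡ S × second xc j ∈ˡ S × second xc j ∈ˡ S
      -- A pair is treated as a triple whose third entry repeats the second.
      triples = hittingTriples 1≤n U D E n≤DU (cartesianProduct (allFin n) (allFin n))
        (λ (x , c) → ∈ˡ.∈-cartesianProduct⁺ (∈ˡ.∈-allFin x) (∈ˡ.∈-allFin c))
        (subst (λ l → l * (U * U) < 2 ^ E) (≡.sym (≡.trans (length-cartesianProduct (allFin n) (allFin n))
          (cong₂ _*_ (List.length-tabulate {n = n} id) (List.length-tabulate {n = n} id)))) n²U²<2ᴱ)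
        1≤U first second second first-injective second-injective second-injective

    open Steps Popular (λ x c → T ℕ.≤? length (fibre x c))

    -- If `c` were popular for `x`, the given representation would be a step at `b`.
    exception⇒unpopular : ∀ {x b} → b ∈ˡ exceptions x → ∀ {c d} → a x ∙ a b ≈ a c ∙ a d → c ≢ x → length (fibre x c) ≤ T
    exception⇒unpopular {x} b∈ {c} {d} eq c≢x = ℕ.<⇒≤ (ℕ.≰⇒> λ popular →
      proj₂ (∈ˡ.∈-filter⁻ (λ b → ¬? (step? x b)) {xs = allFin n} b∈)
        (c , d , eq , c≢x , popular))

    -- Bounds the conflicts in the greedy choice: all `y` with `f y = f b` are represented with the
    -- same first term, so they lie in one fibre.
    fibre-exceptions : ∀ x (f : Fin n → Fin n) → (∀ b → ∃ λ d → a x ∙ a b ≈ a (f b) ∙ a d) → ∀ b →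
      length (filter (λ y → f y Fin.≟ f b) (exceptions x)) ≤ length (fibre x (f b))
    fibre-exceptions x f sums b = ℕ.≤-trans
      (length-filter-filter (λ y → f y Fin.≟ f b) _ (allFin n))
      (length-filter-mono (λ y → f y Fin.≟ f b) (representable? x (f b))
        (λ {y} eq → proj₁ (sums y) , trans (proj₂ (sums y)) (∙-congʳ (reflexive (cong a eq)))) (allFin n))

    -- Each value of `left x` or of `right x` is shared by at most `T` exceptions, since those
    -- values are unpopular. So among `2 T ^ 2` exceptions `select` finds `T` with distinct left and
    -- distinct right terms.
    exceptionalTriples : ∀ x → ∃ λ (b : Fin T → Fin n) → ∃ λ (c : Fin T → Fin n) → ∃ λ (d : Fin T → Fin n) →
      Injective _≡_ _≡_ b × Injective _≡_ _≡_ c × Injective _≡_ _≡_ d ×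
      (T * (T + T) ≤ length (exceptions x) → ∀ j → a x ∙ a (b j) ≈ a (c j) ∙ a (d j))
    exceptionalTriples x with T * (T + T) ℕ.≤? length (exceptions x)
    ... | no few = fallback , fallback , fallback , fallback-injective , fallback-injective , fallback-injective , λ many → ⊥-elim (few many)
      where
      fallback : Fin T → Fin n
      fallback j = inject≤ j U³≤n
      fallback-injective : Injective _≡_ _≡_ fallback
      fallback-injective {i} {j} = Fin.inject≤-injective U³≤n U³≤n i j
    ... | yes many with select (left x) (right x) T 1≤T T (exceptions x)
          (λ {b} b∈ → ℕ.≤-trans (fibre-exceptions x (left x) (λ b → right x b , another-sum x b) b)
            (exception⇒unpopular b∈ (another-sum x b) (left≢ x b)))
          (λ {b} b∈ → ℕ.≤-trans (fibre-exceptions x (right x) (λ b → left x b , trans (another-sum x b) (comm _ _)) b)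
            (exception⇒unpopular b∈ (trans (another-sum x b) (comm _ _)) (right≢ x b)))
          many
    ...   | ys , ∣ys∣ , _ , apart = b , left x ∘ b , right x ∘ b ,
      (λ eq → left-injective (cong (left x) eq)) , left-injective ,
      enumerate-injective (right x) ys T≤ (AllPairs.map proj₂ apart) , λ _ j → another-sum x (b j)
      where
      T≤ : T ≤ length ys
      T≤ = ℕ.≤-reflexive (≡.sym ∣ys∣)
      b : Fin T → Fin n
      b = enumerate ys T≤
      left-injective : Injective _≡_ _≡_ (left x ∘ b)
      left-injective = enumerate-injective (left x) ys T≤ (AllPairs.map proj₁ apart)

    exceptionalSeeds : ∃ λ S → length S ≤ 3 * (E * D) × (∀ {x} → T * (T + T) ≤ length (exceptions x) →
      ∃ λ b → ∃ λ c → ∃ λ d → b ∈ˡ S × c ∈ˡ S × d ∈ˡ S × a x ∙ a b ≈ a c ∙ a d)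
    exceptionalSeeds = let (S , ∣S∣ , hit) = triples in S , ∣S∣ , λ {x} many →
      let (j , b∈ , c∈ , d∈) = hit x
      in first x j , second x j , third x j , b∈ , c∈ , d∈ ,
         proj₂ (proj₂ (proj₂ (proj₂ (proj₂ (proj₂ (exceptionalTriples x)))))) many j
      where
      first second third : Fin n → Fin T → Fin n
      first x = proj₁ (exceptionalTriples x)
      second x = proj₁ (proj₂ (exceptionalTriples x))
      third x = proj₁ (proj₂ (proj₂ (exceptionalTriples x)))
      triples : ∃ λ S → length S ≤ 3 * (E * D) × ∀ x → ∃ λ j → first x j ∈ˡ S × second x j ∈ˡ S × third x j ∈ˡ S
      triples = hittingTriples 1≤n U D E n≤DU (allFin n) ∈ˡ.∈-allFin
        (ℕ.≤-<-trans (ℕ.≤-trans (ℕ.≤-reflexive (cong (_* (U * U)) (List.length-tabulate {n = n} id)))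
          (ℕ.*-monoˡ-≤ (U * U) (ℕ.m≤m*n n n {{ℕ.>-nonZero 1≤n}}))) n²U²<2ᴱ)
        1≤U first second third
        (λ x → proj₁ (proj₂ (proj₂ (proj₂ (exceptionalTriples x)))))
        (λ x → proj₁ (proj₂ (proj₂ (proj₂ (proj₂ (exceptionalTriples x))))))
        (λ x → proj₁ (proj₂ (proj₂ (proj₂ (proj₂ (proj₂ (exceptionalTriples x)))))))

    contradictory : T * (T + T) + (3 * (E * D) + 3 * (E * D)) < K → ⊥
    contradictory room = conclude popularSeeds exceptionalSeeds
      where
      conclude : (∃ λ S → length S ≤ 3 * (E * D) ×
          (∀ {x c} → Popular x c → ∃ λ b → ∃ λ d → b ∈ˡ S × d ∈ˡ S × a x ∙ a b ≈ a c ∙ a d)) →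
        (∃ λ S → length S ≤ 3 * (E * D) × (∀ {x} → T * (T + T) ≤ length (exceptions x) →
          ∃ λ b → ∃ λ c → ∃ λ d → b ∈ˡ S × c ∈ˡ S × d ∈ˡ S × a x ∙ a b ≈ a c ∙ a d)) → ⊥
      conclude (S₁ , ∣S₁∣ , hit₁) (S₂ , ∣S₂∣ , hit₂) =
        Walks.impossible Popular (λ x c → T ℕ.≤? length (fibre x c)) (S₁ ++ S₂)
          (λ p → let (b , d , b∈ , d∈ , eq) = hit₁ p in b , d , ∈ˡ.∈-++⁺ˡ b∈ , ∈ˡ.∈-++⁺ˡ d∈ , eq)
          (T * (T + T))
          (ℕ.≤-<-trans (ℕ.+-monoʳ-≤ (T * (T + T)) (ℕ.≤-trans (ℕ.≤-reflexive (List.length-++ S₁))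
            (ℕ.+-mono-≤ ∣S₁∣ ∣S₂∣))) room)
          (λ many → let (b , c , d , b∈ , c∈ , d∈ , eq) = hit₂ many in
            b , c , d , ∈ˡ.∈-++⁺ʳ S₁ b∈ , ∈ˡ.∈-++⁺ʳ S₁ c∈ , ∈ˡ.∈-++⁺ʳ S₁ d∈ , eq)

-- Subsets as injective families.

members : ∀ {N} (p : Subset N) → Fin ∣ p ∣ → Fin N
members (inside ∷ p) zero = zero
members (inside ∷ p) (suc i) = suc (members p i)
members (outside ∷ p) i = suc (members p i)

members-∈ : ∀ {N} (p : Subset N) i → members p i ∈ˢ p
members-∈ (inside ∷ p) zero = here
members-∈ (inside ∷ p) (suc i) = there (members-∈ p i)
members-∈ (outside ∷ p) i = there (members-∈ p i)

members-injective : ∀ {N} (p : Subset N) → Injective _≡_ _≡_ (members p)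
members-injective (inside ∷ p) {zero} {zero} _ = ≡.refl
members-injective (inside ∷ p) {suc i} {suc j} eq = cong suc (members-injective p (Fin.suc-injective eq))
members-injective (outside ∷ p) eq = members-injective p (Fin.suc-injective eq)

members-surjective : ∀ {N} (p : Subset N) {x} → x ∈ˢ p → ∃ λ i → members p i ≡ x
members-surjective (inside ∷ p) here = zero , ≡.refl
members-surjective (inside ∷ p) (there x∈) = let (i , eq) = members-surjective p x∈ in suc i , cong suc eq
members-surjective (outside ∷ p) (there x∈) = let (i , eq) = members-surjective p x∈ in i , cong suc eq

module _ {c ℓ} (G : FiniteAbelianGroup c ℓ) (1<N : 1 < order G)
  (A : FinSubset G) (2≤∣A∣ : 2 ≤ ∣ A ∣) (noUniqueSum : NoUniqueSum G A) where

  open GroupFacts G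
  open FiniteAbelianGroup G using (index; enumeration)

  private
    n : ℕ
    n = ∣ A ∣

    a : Fin n → Carrier
    a i = element (members A i)

    index-element : ∀ i → index (element i) ≡ i
    index-element = Inverse.strictlyInverseˡ enumeration

    a-injective : ∀ {i j} → a i ≈ a j → i ≡ j
    a-injective {i} {j} eq = members-injective A (≡.trans (≡.sym (index-element _)) (≡.trans (index-cong eq) (index-element _)))

    a-∈ : ∀ i → index (a i) ∈ˢ A
    a-∈ i = subst (_∈ˢ A) (≡.sym (index-element _)) (members-∈ A i)

    a-surjective : ∀ {x} → index x ∈ˢ A → ∃ λ i → a i ≈ x
    a-surjective {x} x∈ = let (i , eq) = members-surjective A x∈ in i , trans (reflexive (cong element eq)) (element-index x)

    another : ∀ x b → ∃ λ c → ∃ λ d → a x ∙ a b ≈ a c ∙ a d × c ≢ x × c ≢ b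
    another x b with noUniqueSum (a x) (a b) (a-∈ x) (a-∈ b)
    ... | u , v , u∈ , v∈ , eq , nontrivial with a-surjective u∈ | a-surjective v∈
    ...   | c , c≈u | d , d≈v = c , d , trans eq (∙-cong (sym c≈u) (sym d≈v)) ,
      (λ { ≡.refl → nontrivial (inj₁ (c≈u , ∙-cancelˡ (a x) _ _ (trans eq (∙-congʳ (sym c≈u))))) }) ,
      (λ { ≡.refl → nontrivial (inj₂ (∙-cancelʳ (a b) _ _ (trans eq (trans (comm u v) (∙-congˡ (sym c≈u)))) , c≈u)) })

  -- The exponent is the least `K` that exceeds the `2 T ^ 2` exceptions and both sets of seeds
  -- together; any larger `q` would satisfy `large`.
  q-upper-bound : ∀ U D E → 1 ≤ U → U * (U * U) ≤ n → n ≤ D * U → n * n * (U * U) < 2 ^ E →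
    q G 1<N ≤ suc (2 * (n * (2 * n + 3))) ^
      suc (U * (U * U) * (U * (U * U) + U * (U * U)) + (3 * (E * D) + 3 * (E * D)))
  q-upper-bound U D E 1≤U U³≤n n≤DU small = ℕ.≮⇒≥ λ large →
    Counting.Hits.contradictory G 1<N 2≤∣A∣ a a-injective another _ large U D E 1≤U U³≤n n≤DU small ℕ.≤-refl

-- Choice of the parameters.

n<2^n : ∀ n → n < 2 ^ n
n<2^n zero = s≤s z≤n
n<2^n (suc n) = ℕ.≤-trans (ℕ.+-mono-≤ (ℕ.m^n>0 2 n) (n<2^n n)) (ℕ.≤-reflexive (cong (2 ^ n +_) (≡.sym (ℕ.+-identityʳ (2 ^ n)))))

dyadic : ∀ w n → 1 ≤ w → 1 ≤ n → ∃ λ i → 2 ^ (i * w) ≤ n × n < 2 ^ (suc i * w)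
dyadic w n 1≤w 1≤n with least (λ i → n ℕ.<? 2 ^ (i * w))
  (n , ℕ.<-≤-trans (n<2^n n) (ℕ.^-monoʳ-≤ 2 (ℕ.m≤m*n n w {{ℕ.>-nonZero 1≤w}})))
... | zero , n<1 , _ = ⊥-elim (ℕ.<⇒≱ n<1 1≤n)
... | suc i , n<2ʷ , minimal = i , ℕ.≮⇒≥ (λ n< → ℕ.<⇒≱ (ℕ.n<1+n i) (minimal i n<)) , n<2ʷ

2^-+ : ∀ a b → 2 ^ a * 2 ^ b ≡ 2 ^ (a + b)
2^-+ a b = ≡.sym (ℕ.^-distribˡ-+-* 2 a b)

-- The parameters of the counting argument for 2 ^ 21i ≤ n < 2 ^ 21(i + 1): with U = 2 ^ 3i there are
-- O(i · n / U) = O(i · 2 ^ 18i) seeds. The constants w = 21, v = 35 and s = i + 1 are variables, lest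
-- the type checker unfold powers of two.
module DoubleLogBounds (w v i s : ℕ) (w≡ : w ≡ 21) (v≡ : v ≡ 35) (s≡ : s ≡ 1 + i)
  (c-small : 46 * (3 + 288 * 2 ^ w) ≤ 2 ^ v) (n : ℕ) (1≤n : 1 ≤ n)
  (lower : 2 ^ (i * 21) ≤ n) (upper : n < 2 ^ (w + i * 21)) where

  open +-*-Solver
  open ℕ.≤-Reasoning

  p u P c C K : ℕ
  p = 2 ^ i
  u = 2 ^ (i * 3)
  P = 2 ^ (i * 18)
  c = 2 ^ w
  -- Here 3 comes from `1 + 2 * P ≤ 3 * (s * P)`, where `2 * P` counts the exceptions, and
  -- `288 = 2 * 3 * 48` from two seed sets of size at most `3 * (E * D)` with `E = 48 * s` and
  -- `D = c * P`.
  C = 3 + 288 * c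
  K = C * (s * P)

  private
    1≤u : 1 ≤ u
    1≤u = ℕ.m^n>0 2 (i * 3)

    1≤s : 1 ≤ s
    1≤s = subst (1 ≤_) (≡.sym s≡) (s≤s z≤n)

    s≤p : s ≤ p
    s≤p = subst (_≤ p) (≡.sym s≡) (n<2^n i)

    ppp≡u : p * p * p ≡ u
    ppp≡u = ≡.trans (cong (_* p) (2^-+ i i)) (≡.trans (2^-+ (i + i) i) (cong (2 ^_) exponents))
      where
      exponents : i + i + i ≡ i * 3
      exponents = solve 1 (λ i → i :+ i :+ i := i :* con 3) ≡.refl i

    uuu≡ : u * (u * u) ≡ 2 ^ (i * 9)
    uuu≡ = ≡.trans (cong (u *_) (2^-+ (i * 3) (i * 3))) (≡.trans (2^-+ (i * 3) (i * 3 + i * 3)) (cong (2 ^_) exponents))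
      where
      exponents : i * 3 + (i * 3 + i * 3) ≡ i * 9
      exponents = solve 1 (λ i → i :* con 3 :+ (i :* con 3 :+ i :* con 3) := i :* con 9) ≡.refl i

    Pu≡ : P * u ≡ 2 ^ (i * 21)
    Pu≡ = ≡.trans (2^-+ (i * 18) (i * 3)) (cong (2 ^_) exponents)
      where
      exponents : i * 18 + i * 3 ≡ i * 21
      exponents = ≡.sym (ℕ.*-distribˡ-+ i 18 3)

    tripled : u * (u * u) * (u * (u * u)) ≡ P
    tripled = ≡.trans (cong₂ _*_ uuu≡ uuu≡) (≡.trans (2^-+ (i * 9) (i * 9)) (cong (2 ^_) exponents))
      where
      exponents : i * 9 + i * 9 ≡ i * 18
      exponents = ≡.sym (ℕ.*-distribˡ-+ i 9 9)

    nn≤ : n * n ≤ 2 ^ (42 * s)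
    nn≤ = begin
      n * n                               ≤⟨ ℕ.*-mono-≤ (ℕ.<⇒≤ upper) (ℕ.<⇒≤ upper) ⟩
      2 ^ (w + i * 21) * 2 ^ (w + i * 21) ≡⟨ 2^-+ (w + i * 21) (w + i * 21) ⟩
      2 ^ (w + i * 21 + (w + i * 21))     ≡⟨ cong (2 ^_) exponents ⟩
      2 ^ (42 * s)                        ∎
      where
      exponents : w + i * 21 + (w + i * 21) ≡ 42 * s
      exponents = ≡.trans (cong (λ w → w + i * 21 + (w + i * 21)) w≡) (≡.trans
        (solve 1 (λ i → con 21 :+ i :* con 21 :+ (con 21 :+ i :* con 21) := con 42 :* (con 1 :+ i)) ≡.refl i)
        (cong (42 *_) (≡.sym s≡)))

    small : n * n * (u * u) < 2 ^ (48 * s)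
    small = begin-strict
      n * n * (u * u)                    ≤⟨ ℕ.*-mono-≤ nn≤ (ℕ.≤-reflexive (2^-+ (i * 3) (i * 3))) ⟩
      2 ^ (42 * s) * 2 ^ (i * 3 + i * 3) ≡⟨ 2^-+ (42 * s) (i * 3 + i * 3) ⟩
      2 ^ (42 * s + (i * 3 + i * 3))     <⟨ ℕ.^-monoʳ-< 2 (s≤s (s≤s z≤n)) exponents ⟩
      2 ^ (48 * s)                       ∎
      where
      exponents : 42 * s + (i * 3 + i * 3) < 48 * s
      exponents = ℕ.≤-trans (ℕ.m≤m+n _ 5) (ℕ.≤-reflexive (≡.trans
        (cong (λ s → suc (42 * s + (i * 3 + i * 3)) + 5) s≡) (≡.trans
        (solve 1 (λ i → con 1 :+ (con 42 :* (con 1 :+ i) :+ (i :* con 3 :+ i :* con 3)) :+ con 5 := con 48 :* (con 1 :+ i)) ≡.refl i)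
        (cong (48 *_) (≡.sym s≡)))))

    base : suc (2 * (n * (2 * n + 3))) ≤ 2 ^ (46 * s)
    base = begin
      suc (2 * (n * (2 * n + 3)))          ≡⟨ solve 1 (λ n → con 1 :+ con 2 :* (n :* (con 2 :* n :+ con 3)) := con 1 :+ (con 6 :* n :+ con 4 :* (n :* n))) ≡.refl n ⟩
      1 + (6 * n + 4 * (n * n))            ≤⟨ ℕ.+-mono-≤ (ℕ.*-mono-≤ 1≤n 1≤n) (ℕ.+-monoˡ-≤ _ (ℕ.*-monoʳ-≤ 6 (ℕ.m≤m*n n n {{ℕ.>-nonZero 1≤n}}))) ⟩
      n * n + (6 * (n * n) + 4 * (n * n))  ≡⟨ solve 1 (λ m → m :+ (con 6 :* m :+ con 4 :* m) := con 11 :* m) ≡.refl (n * n) ⟩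
      11 * (n * n)                         ≤⟨ ℕ.*-mono-≤ (ℕ.m≤m+n 11 5) nn≤ ⟩
      2 ^ 4 * 2 ^ (42 * s)                 ≡⟨ 2^-+ 4 (42 * s) ⟩
      2 ^ (4 + 42 * s)                     ≤⟨ ℕ.^-monoʳ-≤ 2 exponents ⟩
      2 ^ (46 * s)                         ∎
      where
      exponents : 4 + 42 * s ≤ 46 * s
      exponents = ℕ.≤-trans (ℕ.+-monoˡ-≤ (42 * s) (ℕ.*-monoʳ-≤ 4 1≤s)) (ℕ.≤-reflexive (≡.sym (ℕ.*-distribʳ-+ s 4 42)))

    exponent : suc (u * (u * u) * (u * (u * u) + u * (u * u)) + (3 * (48 * s * (c * P)) + 3 * (48 * s * (c * P)))) ≤ K
    exponent = begin
      suc (u * (u * u) * (u * (u * u) + u * (u * u)) + (3 * (48 * s * (c * P)) + 3 * (48 * s * (c * P))))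
        ≡⟨ cong (λ t → suc (t + (3 * (48 * s * (c * P)) + 3 * (48 * s * (c * P)))))
             (≡.trans (ℕ.*-distribˡ-+ (u * (u * u)) (u * (u * u)) (u * (u * u))) (cong₂ _+_ tripled tripled)) ⟩
      suc (P + P + (3 * (48 * s * (c * P)) + 3 * (48 * s * (c * P))))
        ≡⟨ solve 3 (λ c s P → con 1 :+ (P :+ P :+ (con 3 :* (con 48 :* s :* (c :* P)) :+ con 3 :* (con 48 :* s :* (c :* P))))
             := con 1 :+ con 2 :* P :+ con 288 :* (c :* (s :* P))) ≡.refl c s P ⟩
      1 + 2 * P + 288 * (c * (s * P))             ≤⟨ ℕ.+-monoˡ-≤ (288 * (c * (s * P))) (ℕ.+-mono-≤ 1≤sP (ℕ.*-monoʳ-≤ 2 (ℕ.m≤n*m P s {{ℕ.>-nonZero 1≤s}}))) ⟩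
      s * P + 2 * (s * P) + 288 * (c * (s * P))   ≡⟨ solve 2 (λ c m → m :+ con 2 :* m :+ con 288 :* (c :* m) := (con 3 :+ con 288 :* c) :* m) ≡.refl c (s * P) ⟩
      K                                           ∎
      where
      1≤sP : 1 ≤ s * P
      1≤sP = ℕ.*-mono-≤ 1≤s (ℕ.m^n>0 2 (i * 18))

  -- Both factors `s` are at most `p = 2 ^ i`, so apart from constants the left side is at most
  -- `2 ^ (i * 20)`.
  K₁≤ : 46 * s * K ≤ 2 ^ (v * s)
  K₁≤ = begin
    46 * s * K                     ≡⟨ solve 3 (λ C s P → con 46 :* s :* (C :* (s :* P)) := con 46 :* C :* (s :* s :* P)) ≡.refl C s P ⟩
    46 * C * (s * s * P)           ≤⟨ ℕ.*-mono-≤ c-small (ℕ.*-monoˡ-≤ P (ℕ.*-mono-≤ s≤p s≤p)) ⟩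
    2 ^ v * (p * p * P)            ≡⟨ cong (2 ^ v *_) (≡.trans (cong (_* P) (2^-+ i i)) (2^-+ (i + i) (i * 18))) ⟩
    2 ^ v * 2 ^ (i + i + i * 18)   ≡⟨ 2^-+ v (i + i + i * 18) ⟩
    2 ^ (v + (i + i + i * 18))     ≤⟨ ℕ.^-monoʳ-≤ 2 exponents ⟩
    2 ^ (v * s)                    ∎
    where
    exponents : v + (i + i + i * 18) ≤ v * s
    exponents = begin
      v + (i + i + i * 18) ≡⟨ cong₂ _+_ v≡ (solve 1 (λ i → i :+ i :+ i :* con 18 := i :* con 20) ≡.refl i) ⟩
      35 + i * 20          ≤⟨ ℕ.+-monoʳ-≤ 35 (ℕ.*-monoʳ-≤ i (ℕ.m≤m+n 20 15)) ⟩
      35 + i * 35          ≡⟨ solve 1 (λ i → con 35 :+ i :* con 35 := con 35 :* (con 1 :+ i)) ≡.refl i ⟩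
      35 * (1 + i)         ≡⟨ cong₂ _*_ v≡ s≡ ⟨
      v * s                ∎

  -- The power saving pays for the logarithms: the three factors `s`, one each from the base, from
  -- `E` and from the outer logarithm, are together at most `u`, and `P * u` is at most `n`.
  K₁*K₂≤ : 46 * s * K * (v * s) ≤ 46 * C * v * n
  K₁*K₂≤ = begin
    46 * s * K * (v * s)           ≡⟨ solve 4 (λ C s P v → con 46 :* s :* (C :* (s :* P)) :* (v :* s) := con 46 :* C :* v :* (P :* (s :* s :* s))) ≡.refl C s P v ⟩
    46 * C * v * (P * (s * s * s)) ≤⟨ ℕ.*-monoʳ-≤ (46 * C * v) (ℕ.*-monoʳ-≤ P (ℕ.*-mono-≤ (ℕ.*-mono-≤ s≤p s≤p) s≤p)) ⟩
    46 * C * v * (P * (p * p * p)) ≡⟨ cong (λ t → 46 * C * v * (P * t)) ppp≡u ⟩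
    46 * C * v * (P * u)           ≡⟨ cong (46 * C * v *_) Pu≡ ⟩
    46 * C * v * 2 ^ (i * 21)      ≤⟨ ℕ.*-monoʳ-≤ (46 * C * v) lower ⟩
    46 * C * v * n                 ∎

  module _ (q : ℕ) (bound : ∀ U D E → 1 ≤ U → U * (U * U) ≤ n → n ≤ D * U → n * n * (U * U) < 2 ^ E →
    q ≤ suc (2 * (n * (2 * n + 3))) ^ suc (U * (U * U) * (U * (U * U) + U * (U * U)) + (3 * (E * D) + 3 * (E * D)))) where

    q≤ : q ≤ 2 ^ (46 * s * K)
    q≤ = ℕ.≤-trans
      -- `D = c * P` suffices because `n < c * 2 ^ (i * 21) = c * P * u`.
      (bound u (c * P) (48 * s) 1≤u
        (ℕ.≤-trans (ℕ.≤-reflexive uuu≡) (ℕ.≤-trans (ℕ.^-monoʳ-≤ 2 (ℕ.*-monoʳ-≤ i (ℕ.m≤m+n 9 12))) lower))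
        (ℕ.≤-trans (ℕ.<⇒≤ upper) (ℕ.≤-reflexive (≡.trans (≡.sym (2^-+ w (i * 21)))
          (≡.trans (cong (c *_) (≡.sym Pu≡)) (≡.sym (ℕ.*-assoc c P u))))))
        small)
      (ℕ.≤-trans (ℕ.^-monoʳ-≤ (suc (2 * (n * (2 * n + 3)))) exponent)
        (ℕ.≤-trans (ℕ.^-monoˡ-≤ K base) (ℕ.≤-reflexive (ℕ.^-*-assoc 2 (46 * s) K))))

-- The block length is `21 = 7 * 3`: with `U ^ 7` close to `n`, the `2 U ^ 6` exceptions balance the
-- `n / U` seeds up to logarithms, and the factor 3 makes `U = 2 ^ (i * 3)` dominate the cube of the
-- logarithm.
double-log-bounds : ∀ w v → w ≡ 21 → v ≡ 35 → 46 * (3 + 288 * 2 ^ w) ≤ 2 ^ v → ∀ n q → 1 ≤ n →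
  (∀ U D E → 1 ≤ U → U * (U * U) ≤ n → n ≤ D * U → n * n * (U * U) < 2 ^ E →
    q ≤ suc (2 * (n * (2 * n + 3))) ^ suc (U * (U * U) * (U * (U * U) + U * (U * U)) + (3 * (E * D) + 3 * (E * D)))) →
  ∃ λ K₁ → ∃ λ K₂ → q ≤ 2 ^ K₁ × K₁ ≤ 2 ^ K₂ × K₁ * K₂ ≤ 46 * (3 + 288 * 2 ^ w) * v * n
double-log-bounds w v w≡ v≡ c-small n q 1≤n bound = choose (dyadic w n (subst (1 ≤_) (≡.sym w≡) (s≤s z≤n)) 1≤n)
  where
  choose : (∃ λ i → 2 ^ (i * w) ≤ n × n < 2 ^ (suc i * w)) →
           ∃ λ K₁ → ∃ λ K₂ → q ≤ 2 ^ K₁ × K₁ ≤ 2 ^ K₂ × K₁ * K₂ ≤ 46 * (3 + 288 * 2 ^ w) * v * n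
  choose (i , lower , upper) = at (suc i) ≡.refl
    where
    lower′ : 2 ^ (i * 21) ≤ n
    lower′ = subst (λ w → 2 ^ (i * w) ≤ n) w≡ lower
    exponents : suc i * w ≡ w + i * 21
    exponents = cong (λ t → w + i * t) w≡
    upper′ : n < 2 ^ (w + i * 21)
    upper′ = subst (λ e → n < 2 ^ e) exponents upper
    at : ∀ s → s ≡ 1 + i → ∃ λ K₁ → ∃ λ K₂ → q ≤ 2 ^ K₁ × K₁ ≤ 2 ^ K₂ × K₁ * K₂ ≤ 46 * (3 + 288 * 2 ^ w) * v * n
    at s s≡ = 46 * s * K , v * s , q≤ q bound , K₁≤ , K₁*K₂≤
      where open DoubleLogBounds w v i s w≡ v≡ s≡ c-small n 1≤n lower′ upper′

-- Riemann sums of the logarithm compared with powers of 2.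

module LogBounds where
  open Data.Rational.Solver.+-*-Solver
  open ℚ.≤-Reasoning

  *-monoˡ : ∀ {a x y} → 0ℚ ≤ℚ a → x ≤ℚ y → a *ℚ x ≤ℚ a *ℚ y
  *-monoˡ {a} 0≤a = ℚ.*-monoˡ-≤-nonNeg a {{ℚ.nonNegative 0≤a}}

  *-monoʳ : ∀ {a x y} → 0ℚ ≤ℚ a → x ≤ℚ y → x *ℚ a ≤ℚ y *ℚ a
  *-monoʳ {a} 0≤a = ℚ.*-monoʳ-≤-nonNeg a {{ℚ.nonNegative 0≤a}}

  *-nonNeg : ∀ {a b} → 0ℚ ≤ℚ a → 0ℚ ≤ℚ b → 0ℚ ≤ℚ a *ℚ b
  *-nonNeg {a} {b} 0≤a 0≤b = subst (_≤ℚ a *ℚ b) (ℚ.*-zeroʳ a) (*-monoˡ 0≤a 0≤b)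

  ι-suc : ∀ n → ιℚ (suc n) ≡ 1ℚ +ℚ ιℚ n
  ι-suc n = ℚ.toℚᵘ-injective (ℚᵘ.≃-trans (ℚ.toℚᵘ-fromℚᵘ (ℚᵘ.mkℚᵘ (pos (suc n)) 0))
    (ℚᵘ.≃-trans (ℚᵘ.*≡* (cong (λ k → (pos 1 ℤ.+ k) ℤ.* pos 1) (≡.sym (ℤ.*-identityʳ (pos n)))))
    (ℚᵘ.≃-trans (ℚᵘ.+-cong (ℚᵘ.≃-refl {ℚᵘ.1ℚᵘ}) (ℚᵘ.≃-sym (ℚ.toℚᵘ-fromℚᵘ (ℚᵘ.mkℚᵘ (pos n) 0))))
      (ℚᵘ.≃-sym (ℚ.toℚᵘ-homo-+ 1ℚ (ιℚ n))))))

  ι-nonNeg : ∀ n → 0ℚ ≤ℚ ιℚ n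
  ι-nonNeg zero    = ℚ.≤-refl
  ι-nonNeg (suc n) = subst (0ℚ ≤ℚ_) (≡.sym (ι-suc n)) (ℚ.+-mono-≤ (ℚ.nonNegative⁻¹ 1ℚ) (ι-nonNeg n))

  ι-mono : ∀ {m n} → m ℕ.≤ n → ιℚ m ≤ℚ ιℚ n
  ι-mono {n = n} z≤n = ι-nonNeg n
  ι-mono {suc m} {suc n} (s≤s m≤n) = subst₂ _≤ℚ_ (≡.sym (ι-suc m)) (≡.sym (ι-suc n)) (ℚ.+-monoʳ-≤ 1ℚ (ι-mono m≤n))

  ι-+ : ∀ m n → ιℚ (m ℕ.+ n) ≡ ιℚ m +ℚ ιℚ n
  ι-+ zero n = ≡.sym (ℚ.+-identityˡ (ιℚ n))
  ι-+ (suc m) n = ≡.trans (ι-suc (m ℕ.+ n)) (≡.trans (cong (1ℚ +ℚ_) (ι-+ m n))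
    (≡.trans (≡.sym (ℚ.+-assoc 1ℚ (ιℚ m) (ιℚ n))) (cong (_+ℚ ιℚ n) (≡.sym (ι-suc m)))))

  ι-* : ∀ m n → ιℚ (m ℕ.* n) ≡ ιℚ m *ℚ ιℚ n
  ι-* zero n = ≡.sym (ℚ.*-zeroˡ (ιℚ n))
  ι-* (suc m) n = ≡.trans (ι-+ n (m ℕ.* n)) (≡.trans (cong (ιℚ n +ℚ_) (ι-* m n))
    (≡.trans (solve 2 (λ m n → n :+ m :* n := (con 1ℚ :+ m) :* n) ≡.refl (ιℚ m) (ιℚ n)) (cong (_*ℚ ιℚ n) (≡.sym (ι-suc m)))))

  p*p⁻¹≡1 : ∀ {p} → 0ℚ <ℚ p → p *ℚ p ⁻¹ ≡ 1ℚ
  p*p⁻¹≡1 {p} 0<p with p ℚ.≟ 0ℚ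
  ... | yes ≡.refl = ⊥-elim (ℚ.<-irrefl ≡.refl 0<p)
  ... | no p≢0 = ℚ.*-inverseʳ p {{ℚ.≢-nonZero p≢0}}

  ⁻¹-pos : ∀ {p} → 0ℚ <ℚ p → 0ℚ <ℚ p ⁻¹
  ⁻¹-pos {p} 0<p = ℚ.*-cancelˡ-<-nonNeg p {{ℚ.nonNegative (ℚ.<⇒≤ 0<p)}}
    (subst₂ _<ℚ_ (≡.sym (ℚ.*-zeroʳ p)) (≡.sym (p*p⁻¹≡1 0<p)) (ℚ.positive⁻¹ 1ℚ))

  ⁻¹-nonNeg : ∀ {p} → 0ℚ ≤ℚ p → 0ℚ ≤ℚ p ⁻¹
  ⁻¹-nonNeg {p} 0≤p with p ℚ.≤? 0ℚ
  ... | no p≰0  = ℚ.<⇒≤ (⁻¹-pos (ℚ.≰⇒> p≰0))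
  ... | yes p≤0 = subst (λ p → 0ℚ ≤ℚ p ⁻¹) (ℚ.≤-antisym 0≤p p≤0) ℚ.≤-refl

  -- The definition splits off the first step; induction on the right endpoint needs the last one.
  riemann-snoc : ∀ f a h n → riemann f a h (suc n) ≡ riemann f a h n +ℚ h *ℚ f (a +ℚ ιℚ (suc n) *ℚ h)
  riemann-snoc f a h zero = ≡.trans (ℚ.+-comm (h *ℚ f (a +ℚ h)) 0ℚ) (cong (λ b → 0ℚ +ℚ h *ℚ f b)
    (solve 2 (λ a h → a :+ h := a :+ con 1ℚ :* h) ≡.refl a h))
  riemann-snoc f a h (suc n) = ≡.trans (cong (h *ℚ f (a +ℚ h) +ℚ_) (riemann-snoc f (a +ℚ h) h n))
    (≡.trans (≡.sym (ℚ.+-assoc (h *ℚ f (a +ℚ h)) (riemann f (a +ℚ h) h n) _))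
      (cong (λ b → h *ℚ f (a +ℚ h) +ℚ riemann f (a +ℚ h) h n +ℚ h *ℚ f b)
        (≡.trans (solve 3 (λ a h n → a :+ h :+ n :* h := a :+ (con 1ℚ :+ n) :* h) ≡.refl a h (ιℚ (suc n)))
          (cong (λ s → a +ℚ s *ℚ h) (≡.sym (ι-suc (suc n)))))))

  riemann-nonNeg : ∀ h n a → 0ℚ ≤ℚ h → 0ℚ ≤ℚ a → 0ℚ ≤ℚ riemann _⁻¹ a h n
  riemann-nonNeg h zero a _ _ = ℚ.≤-refl
  riemann-nonNeg h (suc n) a 0≤h 0≤a = ℚ.+-mono-≤ (*-nonNeg 0≤h (⁻¹-nonNeg 0≤a+h)) (riemann-nonNeg h n (a +ℚ h) 0≤h 0≤a+h)
    where
    0≤a+h : 0ℚ ≤ℚ a +ℚ h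
    0≤a+h = ℚ.+-mono-≤ 0≤a 0≤h

  -- For arguments below 1, where the steps are negative. The outer logarithm needs this case, since
  -- the approximations to its argument are only bounded below by 0.
  riemann-nonPos : ∀ h n a → h ≤ℚ 0ℚ → 0ℚ ≤ℚ a +ℚ ιℚ n *ℚ h → riemann _⁻¹ a h n ≤ℚ 0ℚ
  riemann-nonPos h zero a _ _ = ℚ.≤-refl
  riemann-nonPos h (suc n) a h≤0 0≤end = ℚ.+-mono-≤
    (subst (h *ℚ (a +ℚ h) ⁻¹ ≤ℚ_) (ℚ.*-zeroˡ ((a +ℚ h) ⁻¹)) (*-monoʳ (⁻¹-nonNeg 0≤a+h) h≤0))
    (riemann-nonPos h n (a +ℚ h) h≤0 0≤end′)
    where
    0≤end′ : 0ℚ ≤ℚ a +ℚ h +ℚ ιℚ n *ℚ h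
    0≤end′ = subst (0ℚ ≤ℚ_) (≡.trans (cong (λ s → a +ℚ s *ℚ h) (ι-suc n))
      (solve 3 (λ a h n → a :+ (con 1ℚ :+ n) :* h := a :+ h :+ n :* h) ≡.refl a h (ιℚ n))) 0≤end
    0≤a+h : 0ℚ ≤ℚ a +ℚ h
    0≤a+h = ℚ.≤-trans 0≤end′ (subst (a +ℚ h +ℚ ιℚ n *ℚ h ≤ℚ_) (ℚ.+-identityʳ (a +ℚ h))
      (ℚ.+-monoʳ-≤ (a +ℚ h) (subst (ιℚ n *ℚ h ≤ℚ_) (ℚ.*-zeroʳ (ιℚ n)) (*-monoˡ (ι-nonNeg n) h≤0))))

  ½^_ : ℕ → ℚ
  ½^ zero = 1ℚ
  ½^ suc k = ½ *ℚ ½^ k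

  ½^-nonNeg : ∀ k → 0ℚ ≤ℚ ½^ k
  ½^-nonNeg zero = ℚ.nonNegative⁻¹ 1ℚ
  ½^-nonNeg (suc k) = *-nonNeg (ℚ.nonNegative⁻¹ ½) (½^-nonNeg k)

  2^k*½^k≡1 : ∀ k → ιℚ (2 ^ k) *ℚ ½^ k ≡ 1ℚ
  2^k*½^k≡1 zero = ≡.refl
  2^k*½^k≡1 (suc k) = ≡.trans (cong (_*ℚ (½ *ℚ ½^ k)) (ι-* 2 (2 ^ k)))
    (≡.trans (solve 2 (λ a b → con (ιℚ 2) :* a :* (con ½ :* b) := a :* b) ≡.refl (ιℚ (2 ^ k)) (½^ k)) (2^k*½^k≡1 k))

  -- Each affine function k - 1 + t / 2 ^ k lies above the concave, piecewise affine interpolation of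
  -- log₂ t at the powers of 2. The k active at the right endpoint b of the last step of the Riemann
  -- sum satisfies b ≥ 2 ^ k, so that this step contributes h / b ≤ h / 2 ^ k; the bounds for larger k
  -- follow from those for smaller k.
  riemann≤affine : ∀ h → 0ℚ ≤ℚ h → ∀ n k → riemann _⁻¹ 1ℚ h n +ℚ 1ℚ ≤ℚ ιℚ k +ℚ (1ℚ +ℚ ιℚ n *ℚ h) *ℚ ½^ k
  riemann≤affine h 0≤h = affine
    where
    descend : ∀ n k → (1ℚ +ℚ ιℚ n *ℚ h) *ℚ ½^ suc k ≤ℚ 1ℚ → riemann _⁻¹ 1ℚ h n +ℚ 1ℚ ≤ℚ ιℚ k +ℚ (1ℚ +ℚ ιℚ n *ℚ h) *ℚ ½^ k →
              riemann _⁻¹ 1ℚ h n +ℚ 1ℚ ≤ℚ ιℚ (suc k) +ℚ (1ℚ +ℚ ιℚ n *ℚ h) *ℚ ½^ suc k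
    descend n k b≤ bound = begin
      riemann _⁻¹ 1ℚ h n +ℚ 1ℚ                ≤⟨ bound ⟩
      ιℚ k +ℚ b *ℚ ½^ k                        ≡⟨ cong (ιℚ k +ℚ_) (solve 2 (λ b p → b :* p := b :* (con ½ :* p) :+ b :* (con ½ :* p)) ≡.refl b (½^ k)) ⟩
      ιℚ k +ℚ (b *ℚ ½^ suc k +ℚ b *ℚ ½^ suc k)   ≤⟨ ℚ.+-monoʳ-≤ (ιℚ k) (ℚ.+-monoˡ-≤ (b *ℚ ½^ suc k) b≤) ⟩
      ιℚ k +ℚ (1ℚ +ℚ b *ℚ ½^ suc k)             ≡⟨ solve 2 (λ k e → k :+ (con 1ℚ :+ e) := con 1ℚ :+ k :+ e) ≡.refl (ιℚ k) (b *ℚ ½^ suc k) ⟩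
      1ℚ +ℚ ιℚ k +ℚ b *ℚ ½^ suc k               ≡⟨ cong (_+ℚ b *ℚ ½^ suc k) (ι-suc k) ⟨
      ιℚ (suc k) +ℚ b *ℚ ½^ suc k              ∎
      where
      b : ℚ
      b = 1ℚ +ℚ ιℚ n *ℚ h

    extend : ∀ n k → 1ℚ ≤ℚ (1ℚ +ℚ ιℚ (suc n) *ℚ h) *ℚ ½^ k → riemann _⁻¹ 1ℚ h n +ℚ 1ℚ ≤ℚ ιℚ k +ℚ (1ℚ +ℚ ιℚ n *ℚ h) *ℚ ½^ k →
             riemann _⁻¹ 1ℚ h (suc n) +ℚ 1ℚ ≤ℚ ιℚ k +ℚ (1ℚ +ℚ ιℚ (suc n) *ℚ h) *ℚ ½^ k
    extend n k 1≤ bound = begin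
      riemann _⁻¹ 1ℚ h (suc n) +ℚ 1ℚ          ≡⟨ cong (_+ℚ 1ℚ) (riemann-snoc _⁻¹ 1ℚ h n) ⟩
      riemann _⁻¹ 1ℚ h n +ℚ h *ℚ b ⁻¹ +ℚ 1ℚ     ≡⟨ solve 2 (λ r s → r :+ s :+ con 1ℚ := r :+ con 1ℚ :+ s) ≡.refl (riemann _⁻¹ 1ℚ h n) (h *ℚ b ⁻¹) ⟩
      riemann _⁻¹ 1ℚ h n +ℚ 1ℚ +ℚ h *ℚ b ⁻¹     ≤⟨ ℚ.+-mono-≤ bound (*-monoˡ 0≤h b⁻¹≤) ⟩
      ιℚ k +ℚ (1ℚ +ℚ ιℚ n *ℚ h) *ℚ ½^ k +ℚ h *ℚ ½^ k ≡⟨ solve 4 (λ k n h p → k :+ (con 1ℚ :+ n :* h) :* p :+ h :* p := k :+ (con 1ℚ :+ (con 1ℚ :+ n) :* h) :* p) ≡.refl (ιℚ k) (ιℚ n) h (½^ k) ⟩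
      ιℚ k +ℚ (1ℚ +ℚ (1ℚ +ℚ ιℚ n) *ℚ h) *ℚ ½^ k   ≡⟨ cong (λ s → ιℚ k +ℚ (1ℚ +ℚ s *ℚ h) *ℚ ½^ k) (ι-suc n) ⟨
      ιℚ k +ℚ b *ℚ ½^ k                        ∎
      where
      b : ℚ
      b = 1ℚ +ℚ ιℚ (suc n) *ℚ h
      0<b : 0ℚ <ℚ b
      0<b = ℚ.<-≤-trans (ℚ.positive⁻¹ 1ℚ) (subst (_≤ℚ b) (ℚ.+-identityʳ 1ℚ) (ℚ.+-monoʳ-≤ 1ℚ (*-nonNeg (ι-nonNeg (suc n)) 0≤h)))
      b⁻¹≤ : b ⁻¹ ≤ℚ ½^ k
      b⁻¹≤ = begin
        b ⁻¹              ≡⟨ ℚ.*-identityʳ (b ⁻¹) ⟨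
        b ⁻¹ *ℚ 1ℚ         ≤⟨ *-monoˡ (⁻¹-nonNeg (ℚ.<⇒≤ 0<b)) 1≤ ⟩
        b ⁻¹ *ℚ (b *ℚ ½^ k) ≡⟨ solve 3 (λ i b p → i :* (b :* p) := b :* i :* p) ≡.refl (b ⁻¹) b (½^ k) ⟩
        b *ℚ b ⁻¹ *ℚ ½^ k   ≡⟨ cong (_*ℚ ½^ k) (p*p⁻¹≡1 0<b) ⟩
        1ℚ *ℚ ½^ k         ≡⟨ ℚ.*-identityˡ (½^ k) ⟩
        ½^ k              ∎

    affine : ∀ n k → riemann _⁻¹ 1ℚ h n +ℚ 1ℚ ≤ℚ ιℚ k +ℚ (1ℚ +ℚ ιℚ n *ℚ h) *ℚ ½^ k
    affine zero zero = ℚ.≤-reflexive (solve 1 (λ h → con 0ℚ :+ con 1ℚ := con 0ℚ :+ (con 1ℚ :+ con 0ℚ :* h) :* con 1ℚ) ≡.refl h)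
    affine zero (suc k) = subst₂ _≤ℚ_ ≡.refl (cong (_+ℚ (1ℚ +ℚ 0ℚ *ℚ h) *ℚ ½^ suc k) (≡.sym (ι-suc k))) (begin
      0ℚ +ℚ 1ℚ                               ≡⟨ solve 1 (λ h → con 0ℚ :+ con 1ℚ := con 1ℚ :+ con 0ℚ :+ con 0ℚ) ≡.refl h ⟩
      1ℚ +ℚ 0ℚ +ℚ 0ℚ                          ≤⟨ ℚ.+-mono-≤ (ℚ.+-monoʳ-≤ 1ℚ (ι-nonNeg k)) (½^-nonNeg (suc k)) ⟩
      1ℚ +ℚ ιℚ k +ℚ ½^ suc k                  ≡⟨ solve 3 (λ k h p → con 1ℚ :+ k :+ p := con 1ℚ :+ k :+ (con 1ℚ :+ con 0ℚ :* h) :* p) ≡.refl (ιℚ k) h (½^ suc k) ⟩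
      1ℚ +ℚ ιℚ k +ℚ (1ℚ +ℚ 0ℚ *ℚ h) *ℚ ½^ suc k  ∎)
    affine (suc n) zero = extend n 0 (subst (1ℚ ≤ℚ_) (≡.sym (ℚ.*-identityʳ _))
      (subst (_≤ℚ 1ℚ +ℚ ιℚ (suc n) *ℚ h) (ℚ.+-identityʳ 1ℚ) (ℚ.+-monoʳ-≤ 1ℚ (*-nonNeg (ι-nonNeg (suc n)) 0≤h)))) (affine n 0)
    affine (suc n) (suc k) with ℚ.≤-total 1ℚ ((1ℚ +ℚ ιℚ (suc n) *ℚ h) *ℚ ½^ suc k)
    ... | inj₁ 1≤b = extend n (suc k) 1≤b (affine n (suc k))
    ... | inj₂ b≤1 = descend (suc n) k b≤1 (affine (suc n) k)

  endpoint : ∀ x n → 1ℚ +ℚ ιℚ (suc n) *ℚ ((x -ℚ 1ℚ) *ℚ ιℚ (suc n) ⁻¹) ≡ x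
  endpoint x n = begin-equality
    1ℚ +ℚ ι *ℚ ((x -ℚ 1ℚ) *ℚ ι ⁻¹) ≡⟨ solve 3 (λ x n i → con 1ℚ :+ n :* ((x :- con 1ℚ) :* i) := con 1ℚ :+ (x :- con 1ℚ) :* (n :* i)) ≡.refl x ι (ι ⁻¹) ⟩
    1ℚ +ℚ (x -ℚ 1ℚ) *ℚ (ι *ℚ ι ⁻¹) ≡⟨ cong (λ s → 1ℚ +ℚ (x -ℚ 1ℚ) *ℚ s) (p*p⁻¹≡1 (ℚ.<-≤-trans (ℚ.positive⁻¹ 1ℚ) (ι-mono {1} {suc n} (s≤s z≤n)))) ⟩
    1ℚ +ℚ (x -ℚ 1ℚ) *ℚ 1ℚ         ≡⟨ solve 1 (λ x → con 1ℚ :+ (x :- con 1ℚ) :* con 1ℚ := x) ≡.refl x ⟩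
    x                          ∎
    where
    ι : ℚ
    ι = ιℚ (suc n)

  step-nonNeg : ∀ {x} n → 1ℚ ≤ℚ x → 0ℚ ≤ℚ (x -ℚ 1ℚ) *ℚ ιℚ n ⁻¹
  step-nonNeg {x} n 1≤x = *-nonNeg (subst (_≤ℚ x -ℚ 1ℚ) (ℚ.+-inverseʳ 1ℚ) (ℚ.+-monoˡ-≤ (ℚ.- 1ℚ) 1≤x)) (⁻¹-nonNeg (ι-nonNeg n))

  logSum-nonNeg : ∀ {x} n → 1ℚ ≤ℚ x → 0ℚ ≤ℚ logSum x n
  logSum-nonNeg n 1≤x = riemann-nonNeg _ n 1ℚ (step-nonNeg n 1≤x) (ℚ.nonNegative⁻¹ 1ℚ)

  -- For `x ≥ 1` the affine bound with `k = K` ends in `x / 2 ^ K ≤ 1`; for `x ≤ 1` the sum is not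
  -- positive. The bound holds for each Riemann sum, not just in the limit.
  logSum≤log₂ : ∀ K {x} n → 0ℚ ≤ℚ x → x ≤ℚ ιℚ (2 ^ K) → logSum x n ≤ℚ ιℚ K
  logSum≤log₂ K zero _ _ = ι-nonNeg K
  logSum≤log₂ K {x} n@(suc n′) 0≤x x≤ with ℚ.≤-total 1ℚ x
  ... | inj₁ 1≤x = begin
    logSum x n              ≡⟨ solve 1 (λ r → r := r :+ con 1ℚ :- con 1ℚ) ≡.refl (logSum x n) ⟩
    logSum x n +ℚ 1ℚ -ℚ 1ℚ    ≤⟨ ℚ.+-monoˡ-≤ (ℚ.- 1ℚ) (riemann≤affine _ (step-nonNeg n 1≤x) n K) ⟩
    ιℚ K +ℚ (1ℚ +ℚ ιℚ n *ℚ ((x -ℚ 1ℚ) *ℚ ιℚ n ⁻¹)) *ℚ ½^ K -ℚ 1ℚ ≡⟨ cong (λ b → ιℚ K +ℚ b *ℚ ½^ K -ℚ 1ℚ) (endpoint x n′) ⟩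
    ιℚ K +ℚ x *ℚ ½^ K -ℚ 1ℚ    ≤⟨ ℚ.+-monoˡ-≤ (ℚ.- 1ℚ) (ℚ.+-monoʳ-≤ (ιℚ K) (subst (x *ℚ ½^ K ≤ℚ_) (2^k*½^k≡1 K) (*-monoʳ (½^-nonNeg K) x≤))) ⟩
    ιℚ K +ℚ 1ℚ -ℚ 1ℚ          ≡⟨ solve 1 (λ r → r :+ con 1ℚ :- con 1ℚ := r) ≡.refl (ιℚ K) ⟩
    ιℚ K                    ∎
  ... | inj₂ x≤1 = ℚ.≤-trans (riemann-nonPos _ n 1ℚ h≤0 (subst (0ℚ ≤ℚ_) (≡.sym (endpoint x n′)) 0≤x)) (ι-nonNeg K)
    where
    h≤0 : (x -ℚ 1ℚ) *ℚ ιℚ n ⁻¹ ≤ℚ 0ℚ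
    h≤0 = subst ((x -ℚ 1ℚ) *ℚ ιℚ n ⁻¹ ≤ℚ_) (ℚ.*-zeroˡ (ιℚ n ⁻¹))
      (*-monoʳ (⁻¹-nonNeg (ι-nonNeg n)) (subst (x -ℚ 1ℚ ≤ℚ_) (ℚ.+-inverseʳ 1ℚ) (ℚ.+-monoˡ-≤ (ℚ.- 1ℚ) x≤1)))

  logProduct≤ : ∀ C M → 0ℚ ≤ℚ C → C *ℚ ιℚ M ≤ℚ 1ℚ → ∀ q (1<q : 1 ℕ.< q) n K₁ K₂ →
    q ℕ.≤ 2 ^ K₁ → K₁ ℕ.≤ 2 ^ K₂ → K₁ ℕ.* K₂ ℕ.≤ M ℕ.* n →
    fromℚ C *ᴿ logℕ q 1<q *ᴿ loglogℕ q 1<q ≤ᴿ fromℕ n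
  logProduct≤ C M 0≤C CM≤1 q 1<q n K₁ K₂ q≤ K₁≤ product ε 0<ε = 0 , λ k _ → begin
    -- `Y k` can be negative, so it is bounded first, while its cofactor is known to be nonnegative.
    C *ℚ X k *ℚ Y k          ≤⟨ *-monoˡ (*-nonNeg 0≤C (0≤X k)) (logSum≤log₂ K₂ k (0≤X k) (ℚ.≤-trans (X≤ k) (ι-mono K₁≤))) ⟩
    C *ℚ X k *ℚ ιℚ K₂        ≤⟨ *-monoʳ (ι-nonNeg K₂) (*-monoˡ 0≤C (X≤ k)) ⟩
    C *ℚ ιℚ K₁ *ℚ ιℚ K₂      ≡⟨ ℚ.*-assoc C (ιℚ K₁) (ιℚ K₂) ⟩
    C *ℚ (ιℚ K₁ *ℚ ιℚ K₂)    ≡⟨ cong (C *ℚ_) (ι-* K₁ K₂) ⟨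
    C *ℚ ιℚ (K₁ ℕ.* K₂)     ≤⟨ *-monoˡ 0≤C (ι-mono product) ⟩
    C *ℚ ιℚ (M ℕ.* n)       ≡⟨ cong (C *ℚ_) (ι-* M n) ⟩
    C *ℚ (ιℚ M *ℚ ιℚ n)      ≡⟨ ℚ.*-assoc C (ιℚ M) (ιℚ n) ⟨
    C *ℚ ιℚ M *ℚ ιℚ n        ≤⟨ *-monoʳ (ι-nonNeg n) CM≤1 ⟩
    1ℚ *ℚ ιℚ n              ≡⟨ ℚ.*-identityˡ (ιℚ n) ⟩
    ιℚ n                   ≡⟨ ℚ.+-identityʳ (ιℚ n) ⟨
    ιℚ n +ℚ 0ℚ              ≤⟨ ℚ.+-monoʳ-≤ (ιℚ n) (ℚ.<⇒≤ 0<ε) ⟩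
    ιℚ n +ℚ ε               ∎
    where
    X Y : ℕ → ℚ
    X k = logSum (ιℚ q) k
    Y k = logSum (X k) k
    0≤X : ∀ k → 0ℚ ≤ℚ X k
    0≤X k = logSum-nonNeg k (ι-mono {1} {q} (ℕ.<⇒≤ 1<q))
    X≤ : ∀ k → X k ≤ℚ ιℚ K₁
    X≤ k = logSum≤log₂ K₁ k (ι-nonNeg q) (ι-mono q≤)

-- The bounds with the explicit constant.

open LogBounds using (logProduct≤)

0≤c* : 0ℚ ≤ℚ c*
0≤c* = ℚ.nonNegative⁻¹ c*

0ᴿ<c* : 0ᴿ <ᴿ fromℚ c*
0ᴿ<c* = c* , ℚ.positive⁻¹ c* , 0 , λ _ _ → ℚ.≤-reflexive (ℚ.+-identityˡ c*)

double-log-bound : ∀ w v → w ≡ 21 → v ≡ 35 → 46 * (3 + 288 * 2 ^ w) ≤ 2 ^ v → c* *ℚ ιℚ (46 * (3 + 288 * 2 ^ w) * v) ≤ℚ 1ℚ →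
  ∀ {c ℓ} (G : FiniteAbelianGroup c ℓ) (1<∣G∣ : 1 < order G) (A : FinSubset G) → 2 ≤ ∣ A ∣ → NoUniqueSum G A →
  fromℚ c* *ᴿ log-q G 1<∣G∣ *ᴿ loglog-q G 1<∣G∣ ≤ᴿ fromℕ ∣ A ∣
double-log-bound w v w≡ v≡ c-small c*-small G 1<∣G∣ A 2≤∣A∣ noUniqueSum =
  let (K₁ , K₂ , q≤ , K₁≤ , product) = double-log-bounds w v w≡ v≡ c-small ∣ A ∣ (q G 1<∣G∣) (<⇒≤ 2≤∣A∣)
                                         (q-upper-bound G 1<∣G∣ A 2≤∣A∣ noUniqueSum)
  in logProduct≤ c* (46 * (3 + 288 * 2 ^ w) * v) 0≤c* c*-small (q G 1<∣G∣) (1<q G 1<∣G∣) ∣ A ∣ K₁ K₂ q≤ K₁≤ product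

theorem1p2 : ∀ {c ℓ} →
    ((G : FiniteAbelianGroup c ℓ) (1<∣G∣ : 1 < order G) → 2 < q G 1<∣G∣ →
    (A : FinSubset G) → 2 ≤ ∣ A ∣ → NoUniqueSum G A →
    fromℚ c* *ᴿ log-q G 1<∣G∣ *ᴿ loglog-q G 1<∣G∣ ≤ᴿ fromℕ ∣ A ∣)
    × Σ ℝ (λ C → 0ᴿ <ᴿ C × Σ ℕ (λ q₀ →
    (G : FiniteAbelianGroup c ℓ) (3≤∣G∣ : 3 ≤ order G) →
    q₀ ≤ q G (<⇒≤ 3≤∣G∣) →
    C *ᴿ log-q G (<⇒≤ 3≤∣G∣) *ᴿ loglog-q G (<⇒≤ 3≤∣G∣) ≤ᴿ fromℕ (m G 3≤∣G∣)))
-- `m G` is itself the size of a set without unique sums, so the first bound applies to that set and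
-- `c*` serves as `C`.
theorem1p2 {c} {ℓ} = (λ G 1<∣G∣ _ → bound G 1<∣G∣) , fromℚ c* , 0ᴿ<c* , 3 , λ G 3≤∣G∣ _ →
  let (A , ∣A∣≡m , 2≤∣A∣ , noUniqueSum) = proj₁ (m-least G 3≤∣G∣)
  in subst (λ k → fromℚ c* *ᴿ log-q G (<⇒≤ 3≤∣G∣) *ᴿ loglog-q G (<⇒≤ 3≤∣G∣) ≤ᴿ fromℕ k) ∣A∣≡m
       (bound G (<⇒≤ 3≤∣G∣) A 2≤∣A∣ noUniqueSum)
  where
  bound : (G : FiniteAbelianGroup c ℓ) (1<∣G∣ : 1 < order G) (A : FinSubset G) → 2 ≤ ∣ A ∣ → NoUniqueSum G A →
          fromℚ c* *ᴿ log-q G 1<∣G∣ *ᴿ loglog-q G 1<∣G∣ ≤ᴿ fromℕ ∣ A ∣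
  -- 35 is the least exponent with `46 * (3 + 288 * 2 ^ 21) ≤ 2 ^ 35`. The resulting constant is
  -- about `1 / (9.8 * 10 ^ 11)`, larger than `c*` by a factor of more than `10 ^ 7`; both
  -- inequalities are checked by evaluation.
  bound = double-log-bound 21 35 ≡.refl ≡.refl (ℕ.≤ᵇ⇒≤ _ _ tt) (ℚ.≤ᵇ⇒≤ tt)
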